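{- Let $s\ge 2$ be an integer, $m_s=\lceil\log_2(s+2)\rceil$ and $m^*_s=\min\{m: s\le\binom{m}{\lceil m/2\rceil}\}$. (i) If $s\in[2^{m_s-1}-1,\,2^{m_s}-\binom{m_s}{\lceil m_s/2\rceil}-1]$, then for any $\varepsilon>0$ there exists $\delta>0$ such that every $\mathcal F\subseteq 2^{[n]}$ with $|\mathcal F|\ge (m_s+\varepsilon)\binom{n}{\lfloor n/2\rfloor}$ contains at least $\delta n^{m_s-0.5}\binom{n}{\lfloor n/2\rfloor}$ copies of $D_s$. (ii) For any $\varepsilon>0$ there exists $\delta>0$ such that every $\mathcal F\subseteq 2^{[n]}$ with $|\mathcal F|\ge(4+\varepsilon)\binom{n}{\lfloor n/2\rfloor}$ contains at least $\delta n^{3.5}\binom{n}{\lfloor n/2\rfloor}$ induced copies of $D_4$. (iii) For any constant $c$ with $1/2<c<1$ there exists an integer $s_c$ such that if $s\ge s_c$ and $s\le c\binom{m^*_s}{\lfloor m^*_s/2\rfloor}$, then for any $\varepsilon>0$ there exists $\delta>0$ such that every $\mathcal F\subseteq 2^{[n]}$ with $|\mathcal F|\ge(m^*_s+\varepsilon)\binom{n}{\lfloor n/2\rfloor}$ contains at least $\delta n^{m^*_s-0.5}\binom{n}{\lfloor n/2\rfloor}$ induced copies of $D_s$.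
   Context: The generalized diamond $D_s$ is the poset on $s+2$ elements $a,b_1,\dots,b_s,c$ with $a<b_1,\dots,b_s<c$ and the $b_i$ pairwise incomparable. For a finite poset $P$ and $\mathcal F\subseteq 2^{[n]}$, a copy of $P$ in $\mathcal F$ is a subfamily $\mathcal G\subseteq\mathcal F$ with a bijection $i:P\to\mathcal G$ such that $p\le q$ implies $i(p)\subseteq i(q)$; it is an induced copy if moreover $p\le q$ if and only if $i(p)\subseteq i(q)$. -}

module Defs where

open import Data.Nat using (ℕ; zero; suc; _+_; _*_; _∸_; _^_; ⌈_/2⌉; ⌊_/2⌋)
import Data.Nat
open import Data.Nat.Combinatorics using (_C_)
open import Data.Nat.Logarithm using (⌈log₂_⌉)
open import Data.Fin using (Fin)
open import Data.Fin.Subset using (Subset; _⊆_; _∈_)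
open import Data.List using (List; length)
open import Data.List.Relation.Unary.All using (All)
open import Data.List.Relation.Unary.Unique.Propositional using (Unique)
open import Data.Product using (Σ; ∃; _×_; _,_)
open import Data.Integer using (+_)
open import Data.Rational using (ℚ; _/_; 0ℚ)
import Data.Rational as Q
open import Function using (_⇔_)
open import Function.Definitions using (Injective)
open import Relation.Binary.PropositionalEquality using (_≡_)
open import Relation.Nullary using (¬_)

ℕ→ℚ : ℕ → ℚ
ℕ→ℚ k = + k / 1

centralBinom : ℕ → ℕ
centralBinom n = n C ⌊ n /2⌋

mₛ : ℕ → ℕ
mₛ s = ⌈log₂ (s + 2) ⌉

IsMStar : ℕ → ℕ → Set
IsMStar s m = (s Data.Nat.≤ m C ⌈ m /2⌉) × (∀ m' → m' Data.Nat.< m → ¬ (s Data.Nat.≤ m' C ⌈ m' /2⌉))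

data DElem (s : ℕ) : Set where
  bot : DElem s
  mid : Fin s → DElem s
  top : DElem s

data _≤D_ {s : ℕ} : DElem s → DElem s → Set where
  bot≤ : ∀ {p} → bot ≤D p
  ≤top : ∀ {p} → p ≤D top
  mid≤mid : ∀ {i} → mid i ≤D mid i

-- A family F ⊆ 2^[n] of size N, given as an injective enumeration
-- F : Fin N → Subset n.  A subfamily of F is a Subset N (of indices).

IsCopy : (s : ℕ) {n N : ℕ} → (Fin N → Subset n) → Subset N → Set
IsCopy s {n} {N} F G = Σ (DElem s → Fin N) λ f →
  Injective _≡_ _≡_ f ×
  (∀ j → (j ∈ G) ⇔ ∃ (λ p → f p ≡ j)) ×
  (∀ p q → p ≤D q → F (f p) ⊆ F (f q))

IsInducedCopy : (s : ℕ) {n N : ℕ} → (Fin N → Subset n) → Subset N → Set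
IsInducedCopy s {n} {N} F G = Σ (DElem s → Fin N) λ f →
  Injective _≡_ _≡_ f ×
  (∀ j → (j ∈ G) ⇔ ∃ (λ p → f p ≡ j)) ×
  (∀ p q → (p ≤D q) ⇔ (F (f p) ⊆ F (f q)))

AtLeast : {N : ℕ} → ℕ → (Subset N → Set) → Set
AtLeast {N} K P = Σ (List (Subset N)) λ L → (length L ≡ K) × Unique L × All P L

-- "F contains at least δ · n^(m - 1/2) · binom(n,⌊n/2⌋) subfamilies with P":
-- there is K with K ≥ δ n^(m-1/2) B, expressed (both sides ≥ 0) after squaring:
-- K² ≥ δ² · n^(2m-1) · B²
ManyCopies : {N : ℕ} → (δ : ℚ) (n m : ℕ) → (Subset N → Set) → Set
ManyCopies δ n m P = Σ ℕ λ K → AtLeast K P ×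
  ((δ Q.* δ) Q.* (ℕ→ℚ (n ^ (2 * m ∸ 1)) Q.* (ℕ→ℚ (centralBinom n) Q.* ℕ→ℚ (centralBinom n)))
     Q.≤ ℕ→ℚ K Q.* ℕ→ℚ K)

Supersat : ℕ → ({n N : ℕ} → (Fin N → Subset n) → Subset N → Set) → Set
Supersat m Copy = ∀ (ε : ℚ) → 0ℚ Q.< ε →
  Σ ℚ λ δ → (0ℚ Q.< δ) ×
    (∀ (n N : ℕ) (F : Fin N → Subset n) → Injective _≡_ _≡_ F →
      (ℕ→ℚ m Q.+ ε) Q.* ℕ→ℚ (centralBinom n) Q.≤ ℕ→ℚ N →
      ManyCopies δ n m (Copy F))

{-# OPTIONS --safe #-}
module Submission where

-- Count maximal chains of 2^[n]. A chain meeting F is sorted by its lowest member A and highest member B in F; given A and B, the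
-- expected number of members of F on it is the Lubell sum of F in [A , B]. This sum is at most m unless F has enough sets
-- strictly between A and B (for induced copies: on a single level) to complete a copy of D_s with ends A and B. As a random
-- chain contains at least m + ε members of F on average, the pairs (A , B) that bound a copy carry a chain weight of at least ε.
--
-- First remove the sets on levels whose size is below central n / (Q √n); there are only O(central n / Q) of them. A
-- remaining pair with ∣B∣ - ∣A∣ = k ≥ m lies on a fraction O(√n / (n^m central n)) of the chains, even after weighting by
-- k + 1 - m, so there are at least δ n^(m - 1/2) central n such pairs. Distinct pairs give distinct copies, because a copy
-- of D_s determines its least and greatest set.

open import Defs
open import Data.Nat using (ℕ; zero; suc; _+_; _∸_; _*_; _^_; _≤_; _<_; _<ᵇ_; _≡ᵇ_; _≤?_; _⊓_; _!; z≤n; s≤s; s≤s⁻¹; ⌈_/2⌉; ⌊_/2⌋; >-nonZero)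
open import Data.Nat.Properties
open import Data.Nat.Combinatorics using (_C_; nCn≡1; nC1≡n; nCk≡nC[n∸k]; k>n⇒nCk≡0; nCk≡n!/k![n-k]!; k![n∸k]!∣n!; nCk+nC[k+1]≡[n+1]C[k+1])
open import Data.Nat.DivMod using (_/_; _%_; m/n*n≡m; m/n*n≤m; m≡m%n+[m/n]*n; m%n<n)
open import Data.Nat.Tactic.RingSolver using (solve-∀)
open import Data.Product using (Σ; ∃; _×_; _,_; proj₁; proj₂)
open import Data.Sum using (_⊎_; inj₁; inj₂)
open import Data.Bool using (Bool; true; false; _∧_; not; T)
import Data.Bool as Bool
open import Data.Vec using ([]; _∷_; here; there)
open import Data.Fin using (Fin)
import Data.Fin as Fin
import Data.Fin.Properties as Fin
open import Data.Fin.Properties using (any?; inject≤-injective)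
open import Data.List using (List; []; _∷_; _++_; length; lookup)
open import Data.List.Properties using (length-++)
open import Data.List.Relation.Unary.All as All using (All; []; _∷_)
import Data.List.Relation.Unary.All.Properties as All
open import Data.List.Relation.Unary.AllPairs using ([]; _∷_)
open import Data.List.Relation.Unary.Unique.Propositional using (Unique)
import Data.List.Relation.Unary.Unique.Propositional.Properties as Unique
open import Data.List.Membership.Propositional.Properties using (∈-lookup)
open import Data.Fin.Subset using (Subset; ∁; ∣_∣; _⊆_; _∈_; ⊥)
open import Data.Fin.Subset.Properties using (∣⊥∣≡0; drop-∷-⊆; s⊆s; out⊆; ⊆-refl; ⊆-antisym; p⊆q⇒∣p∣≤∣q∣; ∣p∣≤n; ∣∁p∣≡n∸∣p∣)
open import Data.Empty using () renaming (⊥ to ⊥₀)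
open import Function using (_∘_; _⇔_; mk⇔; Equivalence)
open import Function.Definitions using (Injective)
open import Relation.Nullary using (¬_; Dec; yes; no; does; contradiction; _×-dec_)
open import Relation.Binary.PropositionalEquality
open import Data.Integer using (-[1+_]) renaming (+_ to pos)
import Data.Integer as ℤ
import Data.Integer.Properties as ℤ
open import Data.Rational using (ℚ; mkℚ; ½; 1ℚ; 0ℚ; toℚᵘ)
import Data.Rational as ℚ
import Data.Rational.Properties as ℚ
import Data.Rational.Unnormalised as ℚᵘ
import Data.Rational.Unnormalised.Properties as ℚᵘ
open import Data.Nat.Coprimality using (Coprime; 1-coprimeTo)

-- Binomial coefficients

-- Origin of the exponent m - 1/2: a random maximal chain passes through given A and B with ∣B∣ = b
-- and ∣B∣ - ∣A∣ = k with probability 1 / ((n C b) (b C k)). On the levels that are kept, the first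
-- factor is at least central n / (Q √n), which costs half a power of n, and b C k is at least of
-- order n^m (k + 1 - m). The factor k + 1 - m has to be absorbed there because the Lubell sum
-- between the ends of a copy can be as large as k + 1. Inequalities with √n are stated squared. Two
-- extremal problems bound the Lubell sum when no copy is found. At most s + 1 sets in [A , B] give
-- the largest sum when the smallest levels are filled first; for k = m the 2^m - central m sets
-- outside one middle level reach exactly m, whence the upper end of the range of s in (i). In the
-- induced case each level holds at most s - 1 sets, and the sum is at most Σ min (1 , (s - 1) / (k
-- C i)). Both times k = m is computed, and larger k is reduced to it by comparing consecutive rows
-- of Pascal's triangle.

sumTo : ℕ → (ℕ → ℕ) → ℕ
sumTo zero    f = 0
sumTo (suc n) f = sumTo n f + f n

sumTo-mono : ∀ n {f g : ℕ → ℕ} → (∀ i → i < n → f i ≤ g i) → sumTo n f ≤ sumTo n g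
sumTo-mono zero    f≤g = z≤n
sumTo-mono (suc n) f≤g = +-mono-≤ (sumTo-mono n λ i i<n → f≤g i (m<n⇒m<1+n i<n)) (f≤g n ≤-refl)

sumTo-cong : ∀ n {f g : ℕ → ℕ} → (∀ i → i < n → f i ≡ g i) → sumTo n f ≡ sumTo n g
sumTo-cong zero    f≡g = refl
sumTo-cong (suc n) f≡g = cong₂ _+_ (sumTo-cong n λ i i<n → f≡g i (m<n⇒m<1+n i<n)) (f≡g n ≤-refl)

sumTo-+ : ∀ n (f g : ℕ → ℕ) → sumTo n (λ i → f i + g i) ≡ sumTo n f + sumTo n g
sumTo-+ zero    f g = refl
sumTo-+ (suc n) f g rewrite sumTo-+ n f g = shuffle (sumTo n f) (sumTo n g) (f n) (g n)
  where
  shuffle : ∀ a b c d → a + b + (c + d) ≡ a + c + (b + d)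
  shuffle = solve-∀

sumTo-*ˡ : ∀ n c (f : ℕ → ℕ) → sumTo n (λ i → c * f i) ≡ c * sumTo n f
sumTo-*ˡ zero    c f = sym (*-zeroʳ c)
sumTo-*ˡ (suc n) c f rewrite sumTo-*ˡ n c f = sym (*-distribˡ-+ c (sumTo n f) (f n))

sumTo-const : ∀ n c → sumTo n (λ _ → c) ≡ n * c
sumTo-const zero    c = refl
sumTo-const (suc n) c rewrite sumTo-const n c = +-comm (n * c) c

sumTo-head : ∀ n (f : ℕ → ℕ) → sumTo (suc n) f ≡ f 0 + sumTo n (f ∘ suc)
sumTo-head zero    f = sym (+-identityʳ (f 0))
sumTo-head (suc n) f = trans (cong (_+ f (suc n)) (sumTo-head n f)) (+-assoc (f 0) _ _)

square-cancel-≤ : ∀ {x y} → x * x ≤ y * y → x ≤ y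
square-cancel-≤ {x} {y} x²≤y² with x ≤? y
... | yes x≤y = x≤y
... | no  x≰y = contradiction x²≤y² (<⇒≱ (*-mono-< (≰⇒> x≰y) (≰⇒> x≰y)))

nC0≡1 : ∀ n → n C 0 ≡ 1
nC0≡1 n = refl

0C[1+k]≡0 : ∀ k → 0 C suc k ≡ 0
0C[1+k]≡0 k = refl

nCk*k!*j!≡n! : ∀ k j → ((k + j) C k) * (k ! * j !) ≡ (k + j) !
nCk*k!*j!≡n! k j = begin
  ((k + j) C k) * (k ! * j !)                  ≡⟨ cong (λ x → ((k + j) C k) * (k ! * x !)) (sym (m+n∸m≡n k j)) ⟩
  ((k + j) C k) * (k ! * (k + j ∸ k) !)        ≡⟨ cong (_* (k ! * (k + j ∸ k) !)) (nCk≡n!/k![n-k]! (m≤m+n k j)) ⟩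
  _                                            ≡⟨ m/n*n≡m {{k !* (k + j ∸ k) !≢0}} (k![n∸k]!∣n! (m≤m+n k j)) ⟩
  (k + j) !                                    ∎
  where open ≡-Reasoning

-- The absorption identity (k + 1) (n C (k + 1)) = (n - k) (n C k), with the subtraction moved
-- across so that it also holds for k > n.
[1+k]nC[1+k]+knCk : ∀ n k → suc k * (n C suc k) + k * (n C k) ≡ n * (n C k)
[1+k]nC[1+k]+knCk zero zero = cong₂ _+_ (trans (*-identityˡ (0 C 1)) (0C[1+k]≡0 0)) refl
[1+k]nC[1+k]+knCk zero (suc k) rewrite 0C[1+k]≡0 (suc k) | 0C[1+k]≡0 k | *-zeroʳ k = refl
[1+k]nC[1+k]+knCk (suc n) zero rewrite nC1≡n (suc n) | nC0≡1 (suc n) = simplify n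
  where
  simplify : ∀ n → 1 * suc n + 0 ≡ suc n * 1
  simplify = solve-∀
[1+k]nC[1+k]+knCk (suc n) (suc k)
  rewrite sym (nCk+nC[k+1]≡[n+1]C[k+1] n (suc k)) | sym (nCk+nC[k+1]≡[n+1]C[k+1] n k) = begin
  (2 + k) * (c₁ + c₂) + suc k * (c₀ + c₁)                       ≡⟨ regroup k c₀ c₁ c₂ ⟩
  ((2 + k) * c₂ + suc k * c₁) + c₁ + ((suc k * c₁ + k * c₀) + c₀) ≡⟨ cong₂ (λ x y → x + c₁ + (y + c₀)) ([1+k]nC[1+k]+knCk n (suc k)) ([1+k]nC[1+k]+knCk n k) ⟩
  n * c₁ + c₁ + (n * c₀ + c₀)                                   ≡⟨ collect n c₀ c₁ ⟩
  suc n * (c₀ + c₁)                                             ∎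
  where
  open ≡-Reasoning
  c₀ = n C k
  c₁ = n C suc k
  c₂ = n C suc (suc k)
  regroup : ∀ k a b c → (2 + k) * (b + c) + suc k * (a + b)
                      ≡ ((2 + k) * c + suc k * b) + b + ((suc k * b + k * a) + a)
  regroup = solve-∀
  collect : ∀ n a b → n * b + b + (n * a + a) ≡ suc n * (a + b)
  collect = solve-∀

[1+k]nC[1+k]≡jnCk : ∀ k j → suc k * ((k + j) C suc k) ≡ j * ((k + j) C k)
[1+k]nC[1+k]≡jnCk k j = +-cancelʳ-≡ (k * c) _ _
  (trans ([1+k]nC[1+k]+knCk (k + j) k) (trans (*-distribʳ-+ c k j) (+-comm (k * c) (j * c))))
  where c = (k + j) C k

[1+k][1+n]C[1+k] : ∀ n k → suc k * (suc n C suc k) ≡ suc n * (n C k)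
[1+k][1+n]C[1+k] n k rewrite sym (nCk+nC[k+1]≡[n+1]C[k+1] n k) = begin
  suc k * (c + d)             ≡⟨ regroup k c d ⟩
  c + (suc k * d + k * c)     ≡⟨ cong (c +_) ([1+k]nC[1+k]+knCk n k) ⟩
  suc n * c                   ∎
  where
  open ≡-Reasoning
  c = n C k
  d = n C suc k
  regroup : ∀ k c d → suc k * (c + d) ≡ c + (suc k * d + k * c)
  regroup = solve-∀

nCk≤[1+n]Ck : ∀ n k → n C k ≤ suc n C k
nCk≤[1+n]Ck n zero    = ≤-reflexive (trans (nC0≡1 n) (sym (nC0≡1 (suc n))))
nCk≤[1+n]Ck n (suc k) = ≤-trans (m≤n+m _ (n C k)) (≤-reflexive (nCk+nC[k+1]≡[n+1]C[k+1] n k))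

nCk≤[1+n]C[1+k] : ∀ n k → n C k ≤ suc n C suc k
nCk≤[1+n]C[1+k] n k = ≤-trans (m≤m+n _ _) (≤-reflexive (nCk+nC[k+1]≡[n+1]C[k+1] n k))

C-monoˡ-≤ : ∀ k {m n} → m ≤ n → m C k ≤ n C k
C-monoˡ-≤ k {m} {n} m≤n = subst (λ x → m C k ≤ x C k) (m∸n+n≡m m≤n) (go (n ∸ m))
  where
  go : ∀ d → m C k ≤ (d + m) C k
  go zero    = ≤-refl
  go (suc d) = ≤-trans (go d) (nCk≤[1+n]Ck (d + m) k)

k≤n⇒1≤nCk : ∀ {n k} → k ≤ n → 1 ≤ n C k
k≤n⇒1≤nCk {n} {k} k≤n = ≤-trans (≤-reflexive (sym (nCn≡1 k))) (C-monoˡ-≤ k k≤n)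

nCk≤2^n : ∀ n k → n C k ≤ 2 ^ n
nCk≤2^n n       zero    = ≤-trans (≤-reflexive (nC0≡1 n)) (m^n>0 2 n)
nCk≤2^n zero    (suc k) = ≤-trans (≤-reflexive (0C[1+k]≡0 k)) z≤n
nCk≤2^n (suc n) (suc k) = ≤-trans (≤-reflexive (sym (nCk+nC[k+1]≡[n+1]C[k+1] n k)))
  (≤-trans (+-mono-≤ (nCk≤2^n n k) (nCk≤2^n n (suc k))) (≤-reflexive (cong (2 ^ n +_) (sym (+-identityʳ (2 ^ n))))))

C-step-≤ : ∀ {n k} → suc (k + k) ≤ n → n C k ≤ n C suc k
C-step-≤ {n} {k} 2k<n = *-cancelˡ-≤ (suc k) (+-cancelʳ-≤ (k * c) (suc k * c) (suc k * (n C suc k)) (begin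
  suc k * c + k * c             ≡⟨ sym (*-distribʳ-+ c (suc k) k) ⟩
  suc (k + k) * c               ≤⟨ *-monoˡ-≤ c 2k<n ⟩
  n * c                         ≡⟨ sym ([1+k]nC[1+k]+knCk n k) ⟩
  suc k * (n C suc k) + k * c   ∎))
  where
  open ≤-Reasoning
  c = n C k

C-mono-below : ∀ {n i j} → i ≤ j → j + j ≤ n → n C i ≤ n C j
C-mono-below {n} {i} {j} = go j
  where
  go : ∀ j → i ≤ j → j + j ≤ n → n C i ≤ n C j
  go zero    z≤n 2j≤n = ≤-refl
  go (suc j) i≤1+j 2j≤n with m≤n⇒m<n∨m≡n i≤1+j
  ... | inj₂ refl = ≤-refl
  ... | inj₁ (s≤s i≤j) = ≤-trans (go j i≤j (≤-trans (+-mono-≤ (n≤1+n j) (n≤1+n j)) 2j≤n))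
                                 (C-step-≤ (≤-trans (s≤s (+-monoʳ-≤ j (n≤1+n j))) 2j≤n))

^-distribʳ-* : ∀ n a b → (a * b) ^ n ≡ a ^ n * b ^ n
^-distribʳ-* zero    a b = refl
^-distribʳ-* (suc n) a b = trans (cong (a * b *_) (^-distribʳ-* n a b)) (rearrange a b (a ^ n) (b ^ n))
  where
  rearrange : ∀ a b x y → a * b * (x * y) ≡ (a * x) * (b * y)
  rearrange = solve-∀

infix 8 ⟦_⟧
⟦_⟧ : Bool → ℕ
⟦ true ⟧  = 1
⟦ false ⟧ = 0

⟦⟧≤1 : ∀ b → ⟦ b ⟧ ≤ 1
⟦⟧≤1 true  = ≤-refl
⟦⟧≤1 false = z≤n

⌊n/2⌋+⌊n/2⌋≤n : ∀ n → ⌊ n /2⌋ + ⌊ n /2⌋ ≤ n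
⌊n/2⌋+⌊n/2⌋≤n n = ≤-trans (+-monoʳ-≤ ⌊ n /2⌋ (⌊n/2⌋≤⌈n/2⌉ n)) (≤-reflexive (⌊n/2⌋+⌈n/2⌉≡n n))

⌈n/2⌉≤1+⌊n/2⌋ : ∀ n → ⌈ n /2⌉ ≤ suc ⌊ n /2⌋
⌈n/2⌉≤1+⌊n/2⌋ n = ⌊n/2⌋-mono (n≤1+n (suc n))

n≤1+⌊n/2⌋+⌊n/2⌋ : ∀ n → n ≤ suc (⌊ n /2⌋ + ⌊ n /2⌋)
n≤1+⌊n/2⌋+⌊n/2⌋ n = ≤-trans (≤-reflexive (sym (⌊n/2⌋+⌈n/2⌉≡n n)))
  (≤-trans (+-monoʳ-≤ ⌊ n /2⌋ (⌈n/2⌉≤1+⌊n/2⌋ n)) (≤-reflexive (+-suc _ _)))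

nCk≤central : ∀ n k → n C k ≤ centralBinom n
nCk≤central n k with k ≤? ⌊ n /2⌋ | k ≤? n
... | yes k≤h | _       = C-mono-below k≤h (⌊n/2⌋+⌊n/2⌋≤n n)
... | no _    | no k≰n  = ≤-trans (≤-reflexive (k>n⇒nCk≡0 (≰⇒> k≰n))) z≤n
... | no k≰h  | yes k≤n = ≤-trans (≤-reflexive (nCk≡nC[n∸k] k≤n))
  (C-mono-below n∸k≤h (⌊n/2⌋+⌊n/2⌋≤n n))
  where
  n∸k≤h : n ∸ k ≤ ⌊ n /2⌋
  n∸k≤h = m≤n+o⇒m∸n≤o n k (≤-trans (n≤1+⌊n/2⌋+⌊n/2⌋ n) (+-monoˡ-≤ ⌊ n /2⌋ (≰⇒> k≰h)))

-- Size of the central binomial coefficient and of initial sums of a row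

even-or-odd : ∀ n → (n ≡ ⌊ n /2⌋ + ⌊ n /2⌋) ⊎ (n ≡ suc (⌊ n /2⌋ + ⌊ n /2⌋))
even-or-odd zero          = inj₁ refl
even-or-odd (suc zero)    = inj₂ refl
even-or-odd (suc (suc n)) with even-or-odd n
... | inj₁ e = inj₁ (cong suc (trans (cong suc e) (sym (+-suc _ _))))
... | inj₂ e = inj₂ (cong (suc ∘ suc) (trans e (sym (+-suc _ _))))

evenCentral-suc : ∀ h → suc h * ((suc h + suc h) C suc h) ≡ 2 * (suc (h + h) * ((h + h) C h))
evenCentral-suc h = begin
  suc h * ((suc h + suc h) C suc h)                    ≡⟨ cong (λ x → suc h * (suc x C suc h)) (+-suc h h) ⟩
  suc h * (suc (suc (h + h)) C suc h)                  ≡⟨ cong (suc h *_) (sym (nCk+nC[k+1]≡[n+1]C[k+1] (suc (h + h)) h)) ⟩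
  suc h * (suc (h + h) C h + suc (h + h) C suc h)      ≡⟨ cong (λ x → suc h * (x + suc (h + h) C suc h)) flip ⟩
  suc h * (suc (h + h) C suc h + suc (h + h) C suc h)  ≡⟨ double (suc h) (suc (h + h) C suc h) ⟩
  2 * (suc h * (suc (h + h) C suc h))                  ≡⟨ cong (2 *_) ([1+k][1+n]C[1+k] (h + h) h) ⟩
  2 * (suc (h + h) * ((h + h) C h))                    ∎
  where
  open ≡-Reasoning
  double : ∀ a b → a * (b + b) ≡ 2 * (a * b)
  double = solve-∀
  flip : suc (h + h) C h ≡ suc (h + h) C suc h
  flip = trans (nCk≡nC[n∸k] (m≤n⇒m≤1+n (m≤m+n h h)))
    (cong (suc (h + h) C_) (trans (cong (_∸ h) (sym (+-suc h h))) (m+n∸m≡n h (suc h))))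

-- The bound 4^h / (2 √h) on the middle entry of row 2 h, squared. The induction closes because (2 h
-- + 1)² = 4 h (h + 1) + 1.
16^h≤4h[2hCh]² : ∀ h → 16 ^ suc h ≤ 4 * suc h * (((suc h + suc h) C suc h) * ((suc h + suc h) C suc h))
16^h≤4h[2hCh]² zero    = ≤-refl
16^h≤4h[2hCh]² (suc g) = *-cancelˡ-≤ (suc h) (begin
  suc h * (16 * 16 ^ h)                            ≤⟨ *-monoʳ-≤ (suc h) (*-monoʳ-≤ 16 (16^h≤4h[2hCh]² g)) ⟩
  suc h * (16 * (4 * h * (c * c)))                 ≤⟨ m≤m+n _ (16 * (c * c)) ⟩
  suc h * (16 * (4 * h * (c * c))) + 16 * (c * c)  ≡⟨ expand h c ⟩
  4 * ((2 * (suc (h + h) * c)) * (2 * (suc (h + h) * c))) ≡⟨ cong (λ x → 4 * (x * x)) (sym (evenCentral-suc h)) ⟩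
  4 * ((suc h * d) * (suc h * d))                  ≡⟨ regroup (suc h) d ⟩
  suc h * (4 * suc h * (d * d))                    ∎)
  where
  open ≤-Reasoning
  h = suc g
  c = (h + h) C h
  d = (suc h + suc h) C suc h
  expand : ∀ h c → suc h * (16 * (4 * h * (c * c))) + 16 * (c * c)
                 ≡ 4 * ((2 * (suc (h + h) * c)) * (2 * (suc (h + h) * c)))
  expand = solve-∀
  regroup : ∀ a d → 4 * ((a * d) * (a * d)) ≡ a * (4 * a * (d * d))
  regroup = solve-∀

4^[h+h]≡16^h : ∀ h → 4 ^ (h + h) ≡ 16 ^ h
4^[h+h]≡16^h h = trans (^-distribˡ-+-* 4 h h) (sym (^-distribʳ-* h 4 4))

4^n≤4n[central]² : ∀ n → 1 ≤ n → 4 ^ n ≤ 4 * n * (centralBinom n * centralBinom n)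
4^n≤4n[central]² n 1≤n with ⌊ n /2⌋ | even-or-odd n
4^n≤4n[central]² .0 () | zero | inj₁ refl
4^n≤4n[central]² .(h + h) 1≤n | h@(suc g) | inj₁ refl = begin
  4 ^ (h + h)                ≡⟨ 4^[h+h]≡16^h h ⟩
  16 ^ h                     ≤⟨ 16^h≤4h[2hCh]² g ⟩
  4 * h * (c * c)            ≤⟨ *-monoˡ-≤ (c * c) (*-monoʳ-≤ 4 (m≤m+n h h)) ⟩
  4 * (h + h) * (c * c)      ∎
  where
  open ≤-Reasoning
  c = (h + h) C h
-- In an odd row, twice the central entry is the middle entry of the next row.
4^n≤4n[central]² .(suc (h + h)) 1≤n | h | inj₂ refl = *-cancelˡ-≤ 4 (begin
  4 * (4 * 4 ^ (h + h))      ≡⟨ cong (λ x → 4 * (4 * x)) (4^[h+h]≡16^h h) ⟩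
  4 * (4 * 16 ^ h)           ≡⟨ sym (*-assoc 4 4 (16 ^ h)) ⟩
  16 * 16 ^ h                ≤⟨ 16^h≤4h[2hCh]² h ⟩
  4 * suc h * (d * d)        ≡⟨ cong (λ x → 4 * suc h * (x * x)) d≡2c ⟩
  4 * suc h * ((2 * c) * (2 * c)) ≡⟨ regroup h c ⟩
  4 * (4 * suc h * (c * c))  ≤⟨ *-monoʳ-≤ 4 (*-monoˡ-≤ (c * c) (*-monoʳ-≤ 4 (s≤s (m≤m+n h h)))) ⟩
  4 * (4 * suc (h + h) * (c * c)) ∎)
  where
  open ≤-Reasoning
  c = suc (h + h) C h
  d = (suc h + suc h) C suc h
  regroup : ∀ h c → 4 * suc h * ((2 * c) * (2 * c)) ≡ 4 * (4 * suc h * (c * c))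
  regroup = solve-∀
  flip : suc (h + h) C suc h ≡ c
  flip = trans (nCk≡nC[n∸k] (s≤s (m≤m+n h h))) (cong (suc (h + h) C_) (m+n∸m≡n h h))
  d≡2c : d ≡ 2 * c
  d≡2c = trans (cong (λ x → suc x C suc h) (+-suc h h))
    (trans (sym (nCk+nC[k+1]≡[n+1]C[k+1] (suc (h + h)) h)) (cong (c +_) (trans flip (sym (+-identityʳ c)))))

binomialSum : ℕ → (ℕ → ℕ) → ℕ
binomialSum n g = sumTo (suc n) (λ i → (n C i) * g i)

binomialSum-suc : ∀ n g → binomialSum (suc n) g ≡ binomialSum n (g ∘ suc) + binomialSum n g
binomialSum-suc n g = begin
  binomialSum (suc n) g
    ≡⟨ sumTo-head (suc n) _ ⟩
  (suc n C 0) * g 0 + sumTo (suc n) (λ i → (suc n C suc i) * g (suc i))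
    ≡⟨ cong₂ (λ x y → x * g 0 + y) (trans (nC0≡1 (suc n)) (sym (nC0≡1 n))) (sumTo-cong (suc n) λ i _ → split i) ⟩
  (n C 0) * g 0 + sumTo (suc n) (λ i → (n C i) * g (suc i) + (n C suc i) * g (suc i))
    ≡⟨ cong ((n C 0) * g 0 +_) (sumTo-+ (suc n) _ _) ⟩
  (n C 0) * g 0 + (binomialSum n (g ∘ suc) + sumTo (suc n) (λ i → (n C suc i) * g (suc i)))
    ≡⟨ swap ((n C 0) * g 0) (binomialSum n (g ∘ suc)) _ ⟩
  binomialSum n (g ∘ suc) + ((n C 0) * g 0 + sumTo (suc n) (λ i → (n C suc i) * g (suc i)))
    ≡⟨ cong (binomialSum n (g ∘ suc) +_) (sym (sumTo-head (suc n) (λ i → (n C i) * g i))) ⟩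
  binomialSum n (g ∘ suc) + (binomialSum n g + (n C suc n) * g (suc n))
    ≡⟨ cong (λ x → binomialSum n (g ∘ suc) + (binomialSum n g + x * g (suc n))) (k>n⇒nCk≡0 (≤-refl {suc n})) ⟩
  binomialSum n (g ∘ suc) + (binomialSum n g + 0)
    ≡⟨ cong (binomialSum n (g ∘ suc) +_) (+-identityʳ _) ⟩
  binomialSum n (g ∘ suc) + binomialSum n g ∎
  where
  open ≡-Reasoning
  split : ∀ i → (suc n C suc i) * g (suc i) ≡ (n C i) * g (suc i) + (n C suc i) * g (suc i)
  split i = trans (cong (_* g (suc i)) (sym (nCk+nC[k+1]≡[n+1]C[k+1] n i))) (*-distribʳ-+ (g (suc i)) (n C i) _)
  swap : ∀ a b c → a + (b + c) ≡ b + (a + c)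
  swap = solve-∀

sumTo-C≡2^n : ∀ n → sumTo (suc n) (n C_) ≡ 2 ^ n
sumTo-C≡2^n n = trans (sumTo-cong (suc n) λ i _ → sym (*-identityʳ (n C i))) (go n)
  where
  go : ∀ n → binomialSum n (λ _ → 1) ≡ 2 ^ n
  go zero    = refl
  go (suc n) = trans (binomialSum-suc n (λ _ → 1)) (trans (cong₂ _+_ (go n) (go n)) (cong (2 ^ n +_) (sym (+-identityʳ _))))

sumTo-monoˡ : ∀ f {m n} → m ≤ n → sumTo m f ≤ sumTo n f
sumTo-monoˡ f {n = zero}  z≤n = ≤-refl
sumTo-monoˡ f {n = suc n} m≤1+n with m≤n⇒m<n∨m≡n m≤1+n
... | inj₂ refl      = ≤-refl
... | inj₁ (s≤s m≤n) = ≤-trans (sumTo-monoˡ f m≤n) (m≤m+n _ _)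

-- The ratio (n - j) / (j + 1) of consecutive entries decreases in j.
C-log-concave : ∀ n {j r} → j ≤ r → r ≤ n → (n C j) * (n C suc r) ≤ (n C suc j) * (n C r)
C-log-concave n {j} {r} j≤r r≤n = *-cancelˡ-≤ (suc j * suc r) (begin
  suc j * suc r * (c * d′)             ≡⟨ assoc₁ (suc j) (suc r) c d′ ⟩
  suc j * c * (suc r * d′)             ≡⟨ cong (suc j * c *_) (absorb r≤n) ⟩
  suc j * c * ((n ∸ r) * d)            ≡⟨ assoc₂ (suc j) c (n ∸ r) d ⟩
  suc j * (n ∸ r) * (c * d)            ≤⟨ *-monoˡ-≤ (c * d) (*-mono-≤ (s≤s j≤r) (∸-monoʳ-≤ n j≤r)) ⟩
  suc r * (n ∸ j) * (c * d)            ≡⟨ assoc₃ (suc r) (n ∸ j) c d ⟩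
  (n ∸ j) * c * (suc r * d)            ≡⟨ cong (_* (suc r * d)) (sym (absorb (≤-trans j≤r r≤n))) ⟩
  suc j * c′ * (suc r * d)             ≡⟨ assoc₄ (suc j) c′ (suc r) d ⟩
  suc j * suc r * (c′ * d)             ∎)
  where
  open ≤-Reasoning
  c  = n C j
  c′ = n C suc j
  d  = n C r
  d′ = n C suc r
  absorb : ∀ {k} → k ≤ n → suc k * (n C suc k) ≡ (n ∸ k) * (n C k)
  absorb {k} k≤n = subst (λ x → suc k * (x C suc k) ≡ (n ∸ k) * (x C k)) (m+[n∸m]≡n k≤n) ([1+k]nC[1+k]≡jnCk k (n ∸ k))
  assoc₁ : ∀ a b x y → a * b * (x * y) ≡ a * x * (b * y)
  assoc₁ = solve-∀
  assoc₂ : ∀ a x b y → a * x * (b * y) ≡ a * b * (x * y)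
  assoc₂ = solve-∀
  assoc₃ : ∀ a b x y → a * b * (x * y) ≡ b * x * (a * y)
  assoc₃ = solve-∀
  assoc₄ : ∀ a x b y → a * x * (b * y) ≡ a * b * (x * y)
  assoc₄ = solve-∀

-- Log-concavity makes sumTo (suc r) (n C_) / (n C r) nondecreasing in r.
prefix-ratio : ∀ n {r} → r ≤ n →
  sumTo (suc r) (n C_) * (n C suc r) ≤ sumTo (suc (suc r)) (n C_) * (n C r)
prefix-ratio n {r} r≤n = begin
  sumTo (suc r) (n C_) * (n C suc r)                  ≡⟨ *-comm _ (n C suc r) ⟩
  (n C suc r) * sumTo (suc r) (n C_)                  ≡⟨ sym (sumTo-*ˡ (suc r) (n C suc r) _) ⟩
  sumTo (suc r) (λ j → (n C suc r) * (n C j))         ≤⟨ sumTo-mono (suc r) (λ { j (s≤s j≤r) → pointwise j j≤r }) ⟩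
  sumTo (suc r) (λ j → (n C r) * (n C suc j))         ≡⟨ sumTo-*ˡ (suc r) (n C r) _ ⟩
  (n C r) * sumTo (suc r) (λ j → n C suc j)           ≤⟨ *-monoʳ-≤ (n C r) (≤-trans (m≤n+m _ (n C 0)) (≤-reflexive (sym (sumTo-head (suc r) (n C_))))) ⟩
  (n C r) * sumTo (suc (suc r)) (n C_)                ≡⟨ *-comm (n C r) _ ⟩
  sumTo (suc (suc r)) (n C_) * (n C r)                ∎
  where
  open ≤-Reasoning
  pointwise : ∀ j → j ≤ r → (n C suc r) * (n C j) ≤ (n C r) * (n C suc j)
  pointwise j j≤r = subst₂ _≤_ (*-comm (n C j) (n C suc r)) (*-comm (n C suc j) (n C r)) (C-log-concave n j≤r r≤n)

-- The monotone ratio of `prefix-ratio` is followed up to the middle level, where the initial sum is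
-- at most 2^n. The induction is on the distance d to the middle.
prefix*central≤2^n*C : ∀ n d r → d + r ≡ ⌊ n /2⌋ → sumTo (suc r) (n C_) * centralBinom n ≤ 2 ^ n * (n C r)
prefix*central≤2^n*C n zero    r refl = *-monoˡ-≤ (n C r)
  (≤-trans (sumTo-monoˡ (n C_) (s≤s (⌊n/2⌋≤n n))) (≤-reflexive (sumTo-C≡2^n n)))
prefix*central≤2^n*C n (suc d) r e = *-cancelʳ-≤ _ _ (n C suc r) {{>-nonZero (k≤n⇒1≤nCk r<n)}} (begin
  S * B * (n C suc r)                          ≡⟨ flip S B (n C suc r) ⟩
  S * (n C suc r) * B                          ≤⟨ *-monoˡ-≤ B (prefix-ratio n (<⇒≤ r<n)) ⟩
  sumTo (suc (suc r)) (n C_) * (n C r) * B     ≡⟨ flip (sumTo (suc (suc r)) (n C_)) (n C r) B ⟩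
  sumTo (suc (suc r)) (n C_) * B * (n C r)     ≤⟨ *-monoˡ-≤ (n C r) (prefix*central≤2^n*C n d (suc r) (trans (+-suc d r) e)) ⟩
  2 ^ n * (n C suc r) * (n C r)                ≡⟨ flip (2 ^ n) (n C suc r) (n C r) ⟩
  2 ^ n * (n C r) * (n C suc r)                ∎)
  where
  open ≤-Reasoning
  B = centralBinom n
  S = sumTo (suc r) (n C_)
  flip : ∀ a b c → a * b * c ≡ a * c * b
  flip = solve-∀
  r<n : suc r ≤ n
  r<n = ≤-trans (≤-trans (s≤s (m≤n+m r d)) (≤-reflexive e)) (⌊n/2⌋≤n n)

1≤central : ∀ n → 1 ≤ centralBinom n
1≤central n = k≤n⇒1≤nCk (⌊n/2⌋≤n n)

-- The preceding bound combined with central n ≥ 2^n / (2 √n): up to the middle, all levels as far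
-- as r together are at most 2 √n times as large as level r alone.
prefix²≤4nC² : ∀ n r → 1 ≤ n → r ≤ ⌊ n /2⌋ →
  sumTo (suc r) (n C_) * sumTo (suc r) (n C_) ≤ 4 * n * ((n C r) * (n C r))
prefix²≤4nC² n r 1≤n r≤h = *-cancelʳ-≤ _ _ (B * B) {{>-nonZero (*-mono-≤ (1≤central n) (1≤central n))}} (begin
  S * S * (B * B)                        ≡⟨ swap S B ⟩
  (S * B) * (S * B)                      ≤⟨ *-mono-≤ S*B≤ S*B≤ ⟩
  (2 ^ n * c) * (2 ^ n * c)              ≡⟨ sym (swap (2 ^ n) c) ⟩
  2 ^ n * 2 ^ n * (c * c)                ≡⟨ cong (_* (c * c)) (sym (^-distribʳ-* n 2 2)) ⟩
  4 ^ n * (c * c)                        ≤⟨ *-monoˡ-≤ (c * c) (4^n≤4n[central]² n 1≤n) ⟩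
  4 * n * (B * B) * (c * c)              ≡⟨ flip (4 * n) (B * B) (c * c) ⟩
  4 * n * (c * c) * (B * B)              ∎)
  where
  open ≤-Reasoning
  B = centralBinom n
  S = sumTo (suc r) (n C_)
  c = n C r
  S*B≤ = prefix*central≤2^n*C n (⌊ n /2⌋ ∸ r) r (m∸n+n≡m r≤h)
  swap : ∀ a b → a * a * (b * b) ≡ (a * b) * (a * b)
  swap = solve-∀
  flip : ∀ a b c → a * b * c ≡ a * c * b
  flip = solve-∀

-- Thin levels

-- Level i is thin when n C i < central n / (Q √n).
thin : ℕ → ℕ → ℕ → Bool
thin Q n i = Q * Q * n * ((n C i) * (n C i)) <ᵇ centralBinom n * centralBinom n

sumTo-++ : ∀ a b f → sumTo (a + b) f ≡ sumTo a f + sumTo b (λ i → f (a + i))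
sumTo-++ a zero    f rewrite +-identityʳ a = sym (+-identityʳ _)
sumTo-++ a (suc b) f rewrite +-suc a b | sumTo-++ a b f = +-assoc (sumTo a f) _ _

sumTo-reverse : ∀ n f → sumTo n f ≡ sumTo n (λ i → f (n ∸ suc i))
sumTo-reverse zero    f = refl
sumTo-reverse (suc n) f = trans (+-comm (sumTo n f) (f n))
  (trans (cong (f n +_) (sumTo-reverse n f)) (sym (sumTo-head n (λ i → f (n ∸ i)))))

-- Only the highest thin level r matters: all levels up to r, thin or not, sum to at most 2 √n times
-- `n C r`, which is less than 2 central n / Q.
thin-prefix : ∀ Q n r → 1 ≤ n → r ≤ suc ⌊ n /2⌋ →
  Q * sumTo r (λ i → (n C i) * ⟦ thin Q n i ⟧) ≤ 2 * centralBinom n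
thin-prefix Q n zero    1≤n r≤h = ≤-trans (≤-reflexive (*-zeroʳ Q)) z≤n
thin-prefix Q n (suc r) 1≤n (s≤s r≤h) with thin Q n r in eq
... | false = ≤-trans (≤-reflexive (cong (Q *_) (trans (cong (Σ′ +_) (*-zeroʳ (n C r))) (+-identityʳ Σ′))))
                      (thin-prefix Q n r 1≤n (m≤n⇒m≤1+n r≤h))
  where Σ′ = sumTo r (λ i → (n C i) * ⟦ thin Q n i ⟧)
... | true  = square-cancel-≤ (begin
  (Q * Σ′) * (Q * Σ′)                  ≤⟨ *-mono-≤ (*-monoʳ-≤ Q Σ′≤S) (*-monoʳ-≤ Q Σ′≤S) ⟩
  (Q * S) * (Q * S)                    ≡⟨ swap Q S ⟩
  Q * Q * (S * S)                      ≤⟨ *-monoʳ-≤ (Q * Q) (prefix²≤4nC² n r 1≤n r≤h) ⟩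
  Q * Q * (4 * n * (c * c))            ≡⟨ rearrange Q n (c * c) ⟩
  4 * (Q * Q * n * (c * c))            ≤⟨ *-monoʳ-≤ 4 (<⇒≤ (<ᵇ⇒< (Q * Q * n * (c * c)) (B * B) (subst T (sym eq) _))) ⟩
  4 * (B * B)                          ≡⟨ four B ⟩
  (2 * B) * (2 * B)                    ∎)
  where
  open ≤-Reasoning
  B = centralBinom n
  c = n C r
  S = sumTo (suc r) (n C_)
  Σ′ = sumTo r (λ i → (n C i) * ⟦ thin Q n i ⟧) + c * 1
  Σ′≤S : Σ′ ≤ S
  Σ′≤S = +-mono-≤ (sumTo-mono r λ i _ → ≤-trans (*-monoʳ-≤ (n C i) (⟦⟧≤1 (thin Q n i))) (≤-reflexive (*-identityʳ _)))
                  (≤-reflexive (*-identityʳ c))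
  swap : ∀ q s → (q * s) * (q * s) ≡ q * q * (s * s)
  swap = solve-∀
  rearrange : ∀ q n x → q * q * (4 * n * x) ≡ 4 * (q * q * n * x)
  rearrange = solve-∀
  four : ∀ b → 4 * (b * b) ≡ (2 * b) * (2 * b)
  four = solve-∀

-- Thinness is symmetric under i ↦ n - i, so the levels above the middle mirror the lowest n - h
-- ones, of which there are at most h + 1. Each half costs at most 2 central n / Q.
thin-total : ∀ Q n → 1 ≤ n → Q * binomialSum n (λ i → ⟦ thin Q n i ⟧) ≤ 4 * centralBinom n
thin-total Q n 1≤n = begin
  Q * sumTo (suc n) f                                    ≡⟨ cong (λ x → Q * sumTo x f) (cong suc (sym (m+[n∸m]≡n (⌊n/2⌋≤n n)))) ⟩
  Q * sumTo (suc h + b) f                                ≡⟨ cong (Q *_) (sumTo-++ (suc h) b f) ⟩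
  Q * (sumTo (suc h) f + sumTo b (λ i → f (suc h + i)))  ≡⟨ cong (λ x → Q * (sumTo (suc h) f + x)) upper ⟩
  Q * (sumTo (suc h) f + sumTo b f)                      ≤⟨ *-monoʳ-≤ Q (+-monoʳ-≤ (sumTo (suc h) f) (sumTo-monoˡ f b≤1+h)) ⟩
  Q * (sumTo (suc h) f + sumTo (suc h) f)                ≡⟨ *-distribˡ-+ Q _ _ ⟩
  Q * sumTo (suc h) f + Q * sumTo (suc h) f              ≤⟨ +-mono-≤ (thin-prefix Q n (suc h) 1≤n ≤-refl) (thin-prefix Q n (suc h) 1≤n ≤-refl) ⟩
  2 * centralBinom n + 2 * centralBinom n                ≡⟨ sym (*-distribʳ-+ (centralBinom n) 2 2) ⟩
  4 * centralBinom n                                     ∎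
  where
  open ≤-Reasoning
  h = ⌊ n /2⌋
  b = n ∸ h
  f : ℕ → ℕ
  f i = (n C i) * ⟦ thin Q n i ⟧
  b≤1+h : b ≤ suc h
  b≤1+h = m≤n+o⇒m∸n≤o n h (≤-trans (n≤1+⌊n/2⌋+⌊n/2⌋ n) (≤-reflexive (sym (+-suc h h))))
  f-sym : ∀ i → i ≤ n → f i ≡ f (n ∸ i)
  f-sym i i≤n rewrite nCk≡nC[n∸k] i≤n = refl
  upper : sumTo b (λ i → f (suc h + i)) ≡ sumTo b f
  upper = trans (sumTo-reverse b _) (sumTo-cong b λ i i<b →
    trans (cong f (index i i<b)) (sym (f-sym i (≤-trans (<⇒≤ i<b) (m∸n≤m n h)))))
    where
    index : ∀ i → i < b → suc h + (b ∸ suc i) ≡ n ∸ i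
    index i i<b = trans (sym (+-suc h (b ∸ suc i))) (trans (cong (h +_) (suc-∸ i<b))
      (trans (sym (+-∸-assoc h (<⇒≤ i<b))) (cong (_∸ i) (m+[n∸m]≡n (⌊n/2⌋≤n n)))))
      where
      suc-∸ : ∀ {i b} → i < b → suc (b ∸ suc i) ≡ b ∸ i
      suc-∸ {i} {b} i<b = sym (+-∸-assoc 1 i<b)

-- While 3 i + 2 ≤ n, the ratio (n - i) / (i + 1) of consecutive levels is at least 2.
C-doubling : ∀ n a t → 3 * (a + t) ≤ n → 2 ^ t * (n C a) ≤ n C (a + t)
C-doubling n a zero    3a≤n rewrite +-identityʳ a | +-identityʳ (n C a) = ≤-refl
C-doubling n a (suc t) 3[a+1+t]≤n = begin
  2 * 2 ^ t * (n C a)        ≡⟨ *-assoc 2 (2 ^ t) (n C a) ⟩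
  2 * (2 ^ t * (n C a))      ≤⟨ *-monoʳ-≤ 2 (C-doubling n a t (≤-trans (*-monoʳ-≤ 3 (+-monoʳ-≤ a (n≤1+n t))) 3[a+1+t]≤n)) ⟩
  2 * (n C i)                ≤⟨ *-cancelˡ-≤ (suc i) (+-cancelʳ-≤ (i * (n C i)) _ _ step) ⟩
  n C suc i                  ≡⟨ cong (n C_) (sym (+-suc a t)) ⟩
  n C (a + suc t)            ∎
  where
  open ≤-Reasoning
  i = a + t
  regroup : ∀ i c → suc i * (2 * c) + i * c ≡ (3 * i + 2) * c
  regroup = solve-∀
  bound : 3 * i + 2 ≤ n
  bound = ≤-trans (≤-trans (n≤1+n _) (≤-reflexive (expand a t))) 3[a+1+t]≤n
    where
    expand : ∀ a t → suc (3 * (a + t) + 2) ≡ 3 * (a + suc t)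
    expand = solve-∀
  step : suc i * (2 * (n C i)) + i * (n C i) ≤ suc i * (n C suc i) + i * (n C i)
  step = begin
    suc i * (2 * (n C i)) + i * (n C i)   ≡⟨ regroup i (n C i) ⟩
    (3 * i + 2) * (n C i)                 ≤⟨ *-monoˡ-≤ (n C i) bound ⟩
    n * (n C i)                           ≡⟨ sym ([1+k]nC[1+k]+knCk n i) ⟩
    suc i * (n C suc i) + i * (n C i)     ∎

n<2^n : ∀ n → suc n ≤ 2 ^ n
n<2^n zero    = ≤-refl
n<2^n (suc n) = ≤-trans (+-mono-≤ (m^n>0 2 n) (n<2^n n)) (≤-reflexive (cong (2 ^ n +_) (sym (+-identityʳ (2 ^ n)))))

-- A level below n/6 is exponentially smaller than the middle one, so it can only be thick when n is bounded.
thick-low⇒small : ∀ Q n a → thin Q n a ≡ false → 6 * a ≤ n → n ≤ 6 * (6 * (Q * Q))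
thick-low⇒small Q n a thick 6a≤n = ≤-trans (<⇒≤ n<6[1+t]) (*-monoʳ-≤ 6 1+t≤6Q²)
  where
  open ≤-Reasoning
  t = n / 6
  c = n C a
  B = centralBinom n
  6t≤n : 6 * t ≤ n
  6t≤n = ≤-trans (≤-reflexive (*-comm 6 t)) (m/n*n≤m n 6)
  n<6[1+t] : n < 6 * suc t
  n<6[1+t] = begin-strict
    n                   ≡⟨ m≡m%n+[m/n]*n n 6 ⟩
    n % 6 + t * 6       <⟨ +-monoˡ-< (t * 6) (m%n<n n 6) ⟩
    6 + t * 6           ≡⟨ *-comm (suc t) 6 ⟩
    6 * suc t           ∎
  3[a+t]≤n : 3 * (a + t) ≤ n
  3[a+t]≤n = *-cancelˡ-≤ 2 (begin
    2 * (3 * (a + t))   ≡⟨ expand a t ⟩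
    6 * a + 6 * t       ≤⟨ +-mono-≤ 6a≤n 6t≤n ⟩
    n + n               ≡⟨ cong (n +_) (sym (+-identityʳ n)) ⟩
    2 * n               ∎)
    where
    expand : ∀ a t → 2 * (3 * (a + t)) ≡ 6 * a + 6 * t
    expand = solve-∀
  -- The weak bound t + 1 ≤ 2^t is enough: after squaring it outgrows the factor n < 6 (t + 1).
  [1+t]c≤B : suc t * c ≤ B
  [1+t]c≤B = ≤-trans (*-monoˡ-≤ c (n<2^n t)) (≤-trans (C-doubling n a t 3[a+t]≤n) (nCk≤central n (a + t)))
  1≤c : 1 ≤ c
  1≤c = k≤n⇒1≤nCk (≤-trans (m≤n*m a 6) 6a≤n)
  B²≤Q²nc² : B * B ≤ Q * Q * n * (c * c)
  B²≤Q²nc² = ≮⇒≥ λ lt → subst T thick (<⇒<ᵇ lt)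
  swap : ∀ t c → t * t * (c * c) ≡ (t * c) * (t * c)
  swap = solve-∀
  [1+t]²≤Q²n : suc t * suc t ≤ Q * Q * n
  [1+t]²≤Q²n = *-cancelʳ-≤ _ _ (c * c) {{>-nonZero (*-mono-≤ 1≤c 1≤c)}} (begin
    suc t * suc t * (c * c)       ≡⟨ swap (suc t) c ⟩
    (suc t * c) * (suc t * c)     ≤⟨ *-mono-≤ [1+t]c≤B [1+t]c≤B ⟩
    B * B                         ≤⟨ B²≤Q²nc² ⟩
    Q * Q * n * (c * c)           ∎)
  1+t≤6Q² : suc t ≤ 6 * (Q * Q)
  1+t≤6Q² = *-cancelʳ-≤ _ _ (suc t) (begin
    suc t * suc t           ≤⟨ [1+t]²≤Q²n ⟩
    Q * Q * n               ≤⟨ *-monoʳ-≤ (Q * Q) (<⇒≤ n<6[1+t]) ⟩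
    Q * Q * (6 * suc t)     ≡⟨ rearrange (Q * Q) (suc t) ⟩
    6 * (Q * Q) * suc t     ∎)
    where
    rearrange : ∀ q t → q * (6 * t) ≡ 6 * q * t
    rearrange = solve-∀

-- Growth of binomial coefficients above a thick level

a^m≤m!C : ∀ a m → a ^ m ≤ m ! * ((a + m) C m)
a^m≤m!C a zero    = ≤-trans (≤-reflexive (sym (nC0≡1 (a + 0)))) (m≤m+n _ 0)
a^m≤m!C a (suc m) = begin
  a * a ^ m                                    ≤⟨ *-mono-≤ (≤-trans (m≤m+n a m) (n≤1+n _)) (a^m≤m!C a m) ⟩
  suc (a + m) * (m ! * ((a + m) C m))          ≡⟨ rearrange (suc (a + m)) (m !) ((a + m) C m) ⟩
  m ! * (suc (a + m) * ((a + m) C m))          ≡⟨ cong (m ! *_) (sym ([1+k][1+n]C[1+k] (a + m) m)) ⟩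
  m ! * (suc m * (suc (a + m) C suc m))        ≡⟨ sym (*-assoc (m !) (suc m) _) ⟩
  m ! * suc m * (suc (a + m) C suc m)          ≡⟨ cong (_* (suc (a + m) C suc m)) (*-comm (m !) (suc m)) ⟩
  suc m ! * (suc (a + m) C suc m)              ≡⟨ cong (λ x → suc m ! * (x C suc m)) (sym (+-suc a m)) ⟩
  suc m ! * ((a + suc m) C suc m)              ∎
  where
  open ≤-Reasoning
  rearrange : ∀ x y z → x * (y * z) ≡ y * (x * z)
  rearrange = solve-∀

-- By Pascal's rule each step adds `n C suc k`. By symmetry this is (a + k) C (a - 1), which grows
-- with k and for k = m is at least (a + m) C m because m < a.
C-linear-growth : ∀ a m d → suc m ≤ a → suc d * ((a + m) C m) ≤ (a + (m + d)) C (m + d)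
C-linear-growth a m zero    m<a rewrite +-identityʳ m = ≤-reflexive (*-identityˡ _)
C-linear-growth a m (suc d) m<a rewrite +-suc m d | +-suc a (m + d) = begin
  c + suc d * c            ≤⟨ +-mono-≤ c≤next (C-linear-growth a m d m<a) ⟩
  n C suc k + n C k        ≡⟨ +-comm (n C suc k) (n C k) ⟩
  n C k + n C suc k        ≡⟨ nCk+nC[k+1]≡[n+1]C[k+1] n k ⟩
  suc n C suc k            ∎
  where
  open ≤-Reasoning
  k = m + d
  n = a + k
  c = (a + m) C m
  complement : ∀ j → suc j ≤ a + j → (a + j) C suc j ≡ (a + j) C (a ∸ 1)
  complement j lt = trans (nCk≡nC[n∸k] lt) (cong ((a + j) C_)
    (trans (sym (∸-+-assoc (a + j) 1 j)) (trans (cong (_∸ j) (+-∸-comm j (≤-trans (s≤s z≤n) m<a))) (m+n∸n≡m (a ∸ 1) j))))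
  c≤next : c ≤ n C suc k
  c≤next = begin
    (a + m) C m              ≤⟨ C-step-≤ (+-monoˡ-≤ m m<a) ⟩
    (a + m) C suc m          ≡⟨ complement m (+-monoˡ-≤ m (≤-trans (s≤s z≤n) m<a)) ⟩
    (a + m) C (a ∸ 1)        ≤⟨ C-monoˡ-≤ (a ∸ 1) (+-monoʳ-≤ a (m≤m+n m d)) ⟩
    (a + k) C (a ∸ 1)        ≡⟨ sym (complement k (+-monoˡ-≤ k (≤-trans (s≤s z≤n) m<a))) ⟩
    n C suc k                ∎

-- The first summand serves n ≤ 36 Q² + 6 m, where a crude bound suffices; the second serves larger
-- n, where a thick level a exceeds both n / 6 and m.
growthConstant : ℕ → ℕ → ℕ
growthConstant Q m = suc (6 * (6 * (Q * Q)) + 6 * m) ^ suc m + 6 ^ m * m !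

-- Long intervals pay for their own weight: for a > n / 6 the coefficient `(a + m) C m` already has
-- order n^m, and beyond k = m the growth in k is at least linear, which absorbs `suc k ∸ m`.
thick-growth : ∀ Q n m a k → thin Q n a ≡ false → a + k ≤ n →
  n ^ m * (suc k ∸ m) ≤ growthConstant Q m * ((a + k) C k)
thick-growth Q n m a k thick a+k≤n with n ≤? 6 * (6 * (Q * Q)) + 6 * m | m ≤? k
... | yes n≤n₀ | _ = begin
  n ^ m * (suc k ∸ m)                        ≤⟨ *-mono-≤ (^-monoˡ-≤ m (≤-trans n≤n₀ (n≤1+n _))) (≤-trans (m∸n≤m (suc k) m) (s≤s (≤-trans (m≤n+m k a) (≤-trans a+k≤n n≤n₀)))) ⟩
  N ^ m * N                                  ≡⟨ *-comm (N ^ m) N ⟩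
  N ^ suc m                                  ≤⟨ m≤m+n _ _ ⟩
  growthConstant Q m                         ≡⟨ sym (*-identityʳ _) ⟩
  growthConstant Q m * 1                     ≤⟨ *-monoʳ-≤ (growthConstant Q m) (k≤n⇒1≤nCk (m≤n+m k a)) ⟩
  growthConstant Q m * ((a + k) C k)         ∎
  where
  open ≤-Reasoning
  N = suc (6 * (6 * (Q * Q)) + 6 * m)
... | no _ | no m≰k = begin
  n ^ m * (suc k ∸ m)   ≡⟨ cong (n ^ m *_) (m≤n⇒m∸n≡0 (≰⇒> m≰k)) ⟩
  n ^ m * 0             ≡⟨ *-zeroʳ (n ^ m) ⟩
  0                     ≤⟨ z≤n ⟩
  _                     ∎
  where open ≤-Reasoning
... | no n≰n₀ | yes m≤k = begin
  n ^ m * (suc k ∸ m)                            ≤⟨ *-monoˡ-≤ (suc k ∸ m) (^-monoˡ-≤ m (<⇒≤ n<6a)) ⟩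
  (6 * a) ^ m * (suc k ∸ m)                      ≡⟨ cong₂ _*_ (^-distribʳ-* m 6 a) (+-∸-assoc 1 m≤k) ⟩
  6 ^ m * a ^ m * suc (k ∸ m)                    ≤⟨ *-monoˡ-≤ (suc (k ∸ m)) (*-monoʳ-≤ (6 ^ m) (a^m≤m!C a m)) ⟩
  6 ^ m * (m ! * ((a + m) C m)) * suc (k ∸ m)    ≡⟨ regroup (6 ^ m) (m !) ((a + m) C m) (suc (k ∸ m)) ⟩
  6 ^ m * m ! * (suc (k ∸ m) * ((a + m) C m))    ≤⟨ *-monoʳ-≤ (6 ^ m * m !) (C-linear-growth a m (k ∸ m) m<a) ⟩
  6 ^ m * m ! * ((a + (m + (k ∸ m))) C (m + (k ∸ m))) ≡⟨ cong (λ x → 6 ^ m * m ! * ((a + x) C x)) (m+[n∸m]≡n m≤k) ⟩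
  6 ^ m * m ! * ((a + k) C k)                    ≤⟨ *-monoˡ-≤ ((a + k) C k) (m≤n+m (6 ^ m * m !) (suc (6 * (6 * (Q * Q)) + 6 * m) ^ suc m)) ⟩
  growthConstant Q m * ((a + k) C k)             ∎
  where
  open ≤-Reasoning
  n<6a : n < 6 * a
  n<6a = ≰⇒> λ 6a≤n → n≰n₀ (≤-trans (thick-low⇒small Q n a thick 6a≤n) (m≤m+n _ _))
  m<a : m < a
  m<a = *-cancelˡ-< 6 m a (<-≤-trans (≤-<-trans (m≤n+m (6 * m) (6 * (6 * (Q * Q)))) (≰⇒> n≰n₀)) (<⇒≤ n<6a))
  regroup : ∀ s f c d → s * (f * c) * d ≡ s * f * (d * c)
  regroup = solve-∀

-- Maximal chains of the Boolean lattice

guard-cong : ∀ b {x y} → (b ≡ true → x ≡ y) → ⟦ b ⟧ * x ≡ ⟦ b ⟧ * y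
guard-cong true  x≡y = cong (_+ 0) (x≡y refl)
guard-cong false x≡y = refl

guard-∧ : ∀ a b → ⟦ a ∧ b ⟧ ≡ ⟦ a ⟧ * ⟦ b ⟧
guard-∧ true  b = sym (+-identityʳ ⟦ b ⟧)
guard-∧ false b = refl

∑ : ∀ {n} → (Subset n → ℕ) → ℕ
∑ {zero}  f = f []
∑ {suc n} f = ∑ (f ∘ (true ∷_)) + ∑ (f ∘ (false ∷_))

-- Stated for any additive relation because it later serves an inequality between squares, besides ≤
-- and ≡.
∑-rel : ∀ {n} (R : ℕ → ℕ → Set) → (∀ {a b c d} → R a b → R c d → R (a + c) (b + d)) →
  {f g : Subset n → ℕ} → (∀ S → R (f S) (g S)) → R (∑ f) (∑ g)
∑-rel {zero}  R +-R fRg = fRg []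
∑-rel {suc n} R +-R fRg = +-R (∑-rel R +-R (fRg ∘ (true ∷_))) (∑-rel R +-R (fRg ∘ (false ∷_)))

∑-mono : ∀ {n} {f g : Subset n → ℕ} → (∀ S → f S ≤ g S) → ∑ f ≤ ∑ g
∑-mono = ∑-rel _≤_ +-mono-≤

∑-cong : ∀ {n} {f g : Subset n → ℕ} → (∀ S → f S ≡ g S) → ∑ f ≡ ∑ g
∑-cong = ∑-rel _≡_ (cong₂ _+_)

∑-+ : ∀ {n} (f g : Subset n → ℕ) → ∑ (λ S → f S + g S) ≡ ∑ f + ∑ g
∑-+ {zero}  f g = refl
∑-+ {suc n} f g = trans (cong₂ _+_ (∑-+ (f ∘ (true ∷_)) _) (∑-+ (f ∘ (false ∷_)) _))
  (shuffle (∑ (f ∘ (true ∷_))) (∑ (g ∘ (true ∷_))) (∑ (f ∘ (false ∷_))) (∑ (g ∘ (false ∷_))))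
  where
  shuffle : ∀ a b c d → a + b + (c + d) ≡ a + c + (b + d)
  shuffle = solve-∀

∑-*ˡ : ∀ {n} c (f : Subset n → ℕ) → ∑ (λ S → c * f S) ≡ c * ∑ f
∑-*ˡ c f = ∑-rel (λ x y → x ≡ c * y) (λ {_} {b} {_} {d} e e′ → trans (cong₂ _+_ e e′) (sym (*-distribˡ-+ c b d)))
  {g = f} (λ S → refl)

∑-zero : ∀ n → ∑ {n} (λ _ → 0) ≡ 0
∑-zero n = ∑-*ˡ {n} 0 (λ _ → 0)

∑-swap : ∀ {m n} (f : Subset m → Subset n → ℕ) → ∑ (λ S → ∑ (f S)) ≡ ∑ (λ T → ∑ (λ S → f S T))
∑-swap {zero}  f = refl
∑-swap {suc m} f = trans (cong₂ _+_ (∑-swap (f ∘ (true ∷_))) (∑-swap (f ∘ (false ∷_)))) (sym (∑-+ (λ T → ∑ (λ S → f (true ∷ S) T)) (λ T → ∑ (λ S → f (false ∷ S) T))))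

sumTo-∑-swap : ∀ {n} k (f : ℕ → Subset n → ℕ) → sumTo k (λ i → ∑ (f i)) ≡ ∑ (λ S → sumTo k (λ i → f i S))
sumTo-∑-swap {n} zero    f = sym (∑-zero n)
sumTo-∑-swap     (suc k) f = trans (cong (_+ ∑ (f k)) (sumTo-∑-swap k f)) (sym (∑-+ _ (f k)))

∑-∁ : ∀ {n} (f : Subset n → ℕ) → ∑ (f ∘ ∁) ≡ ∑ f
∑-∁ {zero}  f = refl
∑-∁ {suc n} f = trans (cong₂ _+_ (∑-∁ (f ∘ (false ∷_))) (∑-∁ (f ∘ (true ∷_)))) (+-comm (∑ (f ∘ (false ∷_))) _)

∑-rank : ∀ n g → ∑ {n} (g ∘ ∣_∣) ≡ binomialSum n g
∑-rank zero    g = sym (+-identityʳ (g 0))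
∑-rank (suc n) g = trans (cong₂ _+_ (∑-rank n (g ∘ suc)) (∑-rank n g)) (sym (binomialSum-suc n g))

infix 4 _⊑_ _==_

_⊑_ : ∀ {n} → Subset n → Subset n → Bool
[]          ⊑ []      = true
(false ∷ A) ⊑ (b ∷ B) = A ⊑ B
(true  ∷ A) ⊑ (b ∷ B) = b ∧ (A ⊑ B)

_==_ : ∀ {n} → Subset n → Subset n → Bool
[]          == []          = true
(true  ∷ A) == (b ∷ B) = b ∧ (A == B)
(false ∷ A) == (b ∷ B) = not b ∧ (A == B)

⊑-size : ∀ {n} (A B : Subset n) → (A ⊑ B) ≡ true → ∣ A ∣ ≤ ∣ B ∣
⊑-size []          []          _ = z≤n
⊑-size (false ∷ A) (true  ∷ B) p = m≤n⇒m≤1+n (⊑-size A B p)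
⊑-size (false ∷ A) (false ∷ B) p = ⊑-size A B p
⊑-size (true  ∷ A) (true  ∷ B) p = s≤s (⊑-size A B p)

⊑-trans : ∀ {n} (A B D : Subset n) → (A ⊑ B) ≡ true → (B ⊑ D) ≡ true → (A ⊑ D) ≡ true
⊑-trans []          []          []          p q = refl
⊑-trans (false ∷ A) (false ∷ B) (_    ∷ D)  p q = ⊑-trans A B D p q
⊑-trans (false ∷ A) (true  ∷ B) (true ∷ D)  p q = ⊑-trans A B D p q
⊑-trans (true  ∷ A) (true  ∷ B) (true ∷ D)  p q = ⊑-trans A B D p q

∁-⊑ : ∀ {n} (A B : Subset n) → (∁ A ⊑ ∁ B) ≡ (B ⊑ A)
∁-⊑ []          []          = refl
∁-⊑ (true  ∷ A) (true  ∷ B) = ∁-⊑ A B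
∁-⊑ (true  ∷ A) (false ∷ B) = ∁-⊑ A B
∁-⊑ (false ∷ A) (true  ∷ B) = refl
∁-⊑ (false ∷ A) (false ∷ B) = ∁-⊑ A B

∁-involutive : ∀ {n} (A : Subset n) → ∁ (∁ A) ≡ A
∁-involutive []          = refl
∁-involutive (true  ∷ A) = cong (true ∷_) (∁-involutive A)
∁-involutive (false ∷ A) = cong (false ∷_) (∁-involutive A)

∑-point : ∀ {n} (S : Subset n) (g : Subset n → ℕ) → ∑ (λ A → ⟦ A == S ⟧ * g A) ≡ g S
∑-point []          g = +-identityʳ (g [])
∑-point {suc n} (true  ∷ S) g = trans (cong₂ _+_ (∑-point S (g ∘ (true ∷_))) (∑-zero n)) (+-identityʳ _)
∑-point {suc n} (false ∷ S) g = cong₂ _+_ (∑-zero n) (∑-point S (g ∘ (false ∷_)))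

isZero : ℕ → ℕ
isZero zero    = 1
isZero (suc _) = 0

-- The numeric form of antisymmetry is what allows the term A = S to be merged into a sum guarded by
-- `⟦ A ⊑ S ⟧`.
⊑∧sameSize : ∀ {n} (A B : Subset n) → ⟦ A ⊑ B ⟧ * isZero (∣ B ∣ ∸ ∣ A ∣) ≡ ⟦ A == B ⟧
⊑∧sameSize []          []          = refl
⊑∧sameSize (true  ∷ A) (true  ∷ B) = ⊑∧sameSize A B
⊑∧sameSize (true  ∷ A) (false ∷ B) = refl
⊑∧sameSize (false ∷ A) (false ∷ B) = ⊑∧sameSize A B
⊑∧sameSize (false ∷ A) (true  ∷ B) with A ⊑ B in p
... | false = refl
... | true rewrite +-∸-assoc 1 (⊑-size A B p) = refl

-- The sum of f over the sets obtained from S by deleting one element.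
∂ : ∀ {n} → (Subset n → ℕ) → Subset n → ℕ
∂ f []          = 0
∂ f (false ∷ S) = ∂ (f ∘ (false ∷_)) S
∂ f (true  ∷ S) = f (false ∷ S) + ∂ (f ∘ (true ∷_)) S

∂-cong : ∀ {n} {f g : Subset n → ℕ} S → (∀ R → suc ∣ R ∣ ≡ ∣ S ∣ → f R ≡ g R) → ∂ f S ≡ ∂ g S
∂-cong []          f≡g = refl
∂-cong (false ∷ S) f≡g = ∂-cong S (λ R → f≡g (false ∷ R))
∂-cong (true  ∷ S) f≡g = cong₂ _+_ (f≡g (false ∷ S) refl) (∂-cong S (λ R e → f≡g (true ∷ R) (cong suc e)))

∂-+ : ∀ {n} (f g : Subset n → ℕ) S → ∂ (λ R → f R + g R) S ≡ ∂ f S + ∂ g S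
∂-+ f g []          = refl
∂-+ f g (false ∷ S) = ∂-+ (f ∘ (false ∷_)) _ S
∂-+ f g (true  ∷ S) = trans (cong (f (false ∷ S) + g (false ∷ S) +_) (∂-+ (f ∘ (true ∷_)) _ S))
  (shuffle (f (false ∷ S)) (g (false ∷ S)) (∂ (f ∘ (true ∷_)) S) (∂ (g ∘ (true ∷_)) S))
  where
  shuffle : ∀ a b c d → a + b + (c + d) ≡ a + c + (b + d)
  shuffle = solve-∀

∂-*ˡ : ∀ {n} c (f : Subset n → ℕ) S → ∂ (λ R → c * f R) S ≡ c * ∂ f S
∂-*ˡ c f []          = sym (*-zeroʳ c)
∂-*ˡ c f (false ∷ S) = ∂-*ˡ c (f ∘ (false ∷_)) S
∂-*ˡ c f (true  ∷ S) = trans (cong (c * f (false ∷ S) +_) (∂-*ˡ c (f ∘ (true ∷_)) S)) (sym (*-distribˡ-+ c _ _))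

∂-const : ∀ {n} c (S : Subset n) → ∂ (λ _ → c) S ≡ ∣ S ∣ * c
∂-const c []          = refl
∂-const c (false ∷ S) = ∂-const c S
∂-const c (true  ∷ S) = cong (c +_) (∂-const c S)

∂-∑ : ∀ {m n} (f : Subset m → Subset n → ℕ) S → ∂ (λ R → ∑ (λ A → f A R)) S ≡ ∑ (λ A → ∂ (f A) S)
∂-∑ {zero}  f S = refl
∂-∑ {suc m} f S = trans (∂-+ _ _ S) (cong₂ _+_ (∂-∑ (f ∘ (true ∷_)) S) (∂-∑ (f ∘ (false ∷_)) S))

-- A deletion from S keeps A exactly when the deleted element is outside A. The additive form spares
-- the induction truncated subtraction.
∂-⊑ : ∀ {n} (A S : Subset n) → ∂ (λ R → ⟦ A ⊑ R ⟧) S + ∣ A ∣ * ⟦ A ⊑ S ⟧ ≡ ∣ S ∣ * ⟦ A ⊑ S ⟧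
∂-⊑ []          []          = refl
∂-⊑ (false ∷ A) (false ∷ S) = ∂-⊑ A S
∂-⊑ (false ∷ A) (true  ∷ S) = trans (+-assoc ⟦ A ⊑ S ⟧ _ _) (cong (⟦ A ⊑ S ⟧ +_) (∂-⊑ A S))
∂-⊑ {suc n} (true ∷ A) (false ∷ S) rewrite *-zeroʳ ∣ A ∣ | *-zeroʳ ∣ S ∣ | ∂-const 0 S | *-zeroʳ ∣ S ∣ = refl
∂-⊑ (true  ∷ A) (true  ∷ S) = trans (swap (∂ (λ R → ⟦ A ⊑ R ⟧) S) ⟦ A ⊑ S ⟧ (∣ A ∣ * ⟦ A ⊑ S ⟧)) (cong (⟦ A ⊑ S ⟧ +_) (∂-⊑ A S))
  where
  swap : ∀ a b c → a + (b + c) ≡ b + (a + c)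
  swap = solve-∀

∂-⊑′ : ∀ {n} (A S : Subset n) → ∂ (λ R → ⟦ A ⊑ R ⟧) S ≡ ⟦ A ⊑ S ⟧ * (∣ S ∣ ∸ ∣ A ∣)
∂-⊑′ A S = begin
  ∂ (λ R → ⟦ A ⊑ R ⟧) S                                          ≡⟨ sym (m+n∸n≡m _ (∣ A ∣ * ⟦ A ⊑ S ⟧)) ⟩
  ∂ (λ R → ⟦ A ⊑ R ⟧) S + ∣ A ∣ * ⟦ A ⊑ S ⟧ ∸ ∣ A ∣ * ⟦ A ⊑ S ⟧  ≡⟨ cong (_∸ ∣ A ∣ * ⟦ A ⊑ S ⟧) (∂-⊑ A S) ⟩
  ∣ S ∣ * ⟦ A ⊑ S ⟧ ∸ ∣ A ∣ * ⟦ A ⊑ S ⟧                          ≡⟨ sym (*-distribʳ-∸ ⟦ A ⊑ S ⟧ ∣ S ∣ ∣ A ∣) ⟩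
  (∣ S ∣ ∸ ∣ A ∣) * ⟦ A ⊑ S ⟧                                    ≡⟨ *-comm (∣ S ∣ ∸ ∣ A ∣) _ ⟩
  ⟦ A ⊑ S ⟧ * (∣ S ∣ ∸ ∣ A ∣)                                    ∎
  where open ≡-Reasoning

avoiding′ : ∀ {n} → (Subset n → Bool) → ℕ → Subset n → ℕ
avoiding′ χ zero    S = 1
avoiding′ χ (suc d) S = ∂ (λ R → ⟦ not (χ R) ⟧ * avoiding′ χ d R) S

-- The number of maximal chains from S down to ∅ that do not meet the family χ strictly below S.
avoiding : ∀ {n} → (Subset n → Bool) → Subset n → ℕ
avoiding χ S = avoiding′ χ ∣ S ∣ S

-- Counts the chains between sets whose sizes differ by r, with value 0 at r = 0 because a set is
-- not strictly below itself.
strict! : ℕ → ℕ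
strict! zero    = 0
strict! (suc r) = suc r !

-- Every maximal chain from S down to ∅ either avoids χ or has a last member A in χ; the first identity disregards S itself.
LastVisitBelow LastVisit : ∀ {n} → (Subset n → Bool) → Subset n → ℕ → Set
LastVisitBelow χ S d =
  d ! ≡ avoiding′ χ d S + ∑ (λ A → ⟦ χ A ⟧ * (⟦ A ⊑ S ⟧ * (strict! (d ∸ ∣ A ∣) * avoiding χ A)))
LastVisit χ S d =
  d ! ≡ ⟦ not (χ S) ⟧ * avoiding′ χ d S + ∑ (λ A → ⟦ χ A ⟧ * (⟦ A ⊑ S ⟧ * ((d ∸ ∣ A ∣) ! * avoiding χ A)))

-- If S is in χ, the chains avoiding χ strictly below S have S as their last member: they leave the
-- first summand and become the term A = S, which completes `strict!` to the factorial.
include-start : ∀ {n} (χ : Subset n → Bool) S → LastVisitBelow χ S ∣ S ∣ → LastVisit χ S ∣ S ∣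
include-start χ S below = begin
  ∣ S ∣ !
    ≡⟨ below ⟩
  v + ∑ h
    ≡⟨ cong (_+ ∑ h) (split (χ S)) ⟩
  ⟦ not (χ S) ⟧ * v + ⟦ χ S ⟧ * v + ∑ h
    ≡⟨ +-assoc (⟦ not (χ S) ⟧ * v) (⟦ χ S ⟧ * v) (∑ h) ⟩
  ⟦ not (χ S) ⟧ * v + (⟦ χ S ⟧ * v + ∑ h)
    ≡⟨ cong (λ x → ⟦ not (χ S) ⟧ * v + (x + ∑ h)) (sym (∑-point S (λ A → ⟦ χ A ⟧ * avoiding χ A))) ⟩
  ⟦ not (χ S) ⟧ * v + (∑ g + ∑ h)
    ≡⟨ cong (⟦ not (χ S) ⟧ * v +_) (trans (sym (∑-+ g h)) (∑-cong merge)) ⟩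
  ⟦ not (χ S) ⟧ * v + ∑ (λ A → ⟦ χ A ⟧ * (⟦ A ⊑ S ⟧ * ((∣ S ∣ ∸ ∣ A ∣) ! * avoiding χ A))) ∎
  where
  open ≡-Reasoning
  v = avoiding χ S
  g h : Subset _ → ℕ
  g A = ⟦ A == S ⟧ * (⟦ χ A ⟧ * avoiding χ A)
  h A = ⟦ χ A ⟧ * (⟦ A ⊑ S ⟧ * (strict! (∣ S ∣ ∸ ∣ A ∣) * avoiding χ A))
  split : ∀ b → v ≡ ⟦ not b ⟧ * v + ⟦ b ⟧ * v
  split true  = sym (+-identityʳ v)
  split false = sym (trans (+-identityʳ _) (+-identityʳ v))
  factorial : ∀ r → isZero r + strict! r ≡ r !
  factorial zero    = refl
  factorial (suc r) = refl
  regroup : ∀ p z c t v → p * z * (c * v) + c * (p * (t * v)) ≡ c * (p * ((z + t) * v))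
  regroup = solve-∀
  merge : ∀ A → g A + h A ≡ ⟦ χ A ⟧ * (⟦ A ⊑ S ⟧ * ((∣ S ∣ ∸ ∣ A ∣) ! * avoiding χ A))
  merge A rewrite sym (⊑∧sameSize A S) | sym (factorial (∣ S ∣ ∸ ∣ A ∣)) =
    regroup ⟦ A ⊑ S ⟧ (isZero (∣ S ∣ ∸ ∣ A ∣)) ⟦ χ A ⟧ (strict! (∣ S ∣ ∸ ∣ A ∣)) (avoiding χ A)

-- Mutual induction on ∣ S ∣: a chain starts by deleting one element of S, so applying `∂` to the
-- identity for the smaller sets gives the identity strictly below S.
last-visit-below : ∀ {n} (χ : Subset n → Bool) d S → ∣ S ∣ ≡ d → LastVisitBelow χ S d
last-visit : ∀ {n} (χ : Subset n → Bool) d S → ∣ S ∣ ≡ d → LastVisit χ S d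

last-visit χ d S e = subst (LastVisit χ S) e
  (include-start χ S (subst (LastVisitBelow χ S) (sym e) (last-visit-below χ d S e)))

last-visit-below {n} χ zero S e = sym (cong suc (trans (∑-cong vanish) (∑-zero n)))
  where
  vanish : ∀ A → ⟦ χ A ⟧ * (⟦ A ⊑ S ⟧ * (strict! (0 ∸ ∣ A ∣) * avoiding χ A)) ≡ 0
  vanish A rewrite 0∸n≡0 ∣ A ∣ | *-zeroʳ ⟦ A ⊑ S ⟧ = *-zeroʳ ⟦ χ A ⟧
last-visit-below χ (suc d) S e = begin
  suc d * d !
    ≡⟨ cong (_* d !) (sym e) ⟩
  ∣ S ∣ * d !
    ≡⟨ sym (∂-const (d !) S) ⟩
  ∂ (λ _ → d !) S
    ≡⟨ ∂-cong S (λ R r → last-visit χ d R (suc-injective (trans r e))) ⟩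
  ∂ (λ R → ⟦ not (χ R) ⟧ * avoiding′ χ d R + ∑ (λ A → ⟦ χ A ⟧ * (⟦ A ⊑ R ⟧ * ((d ∸ ∣ A ∣) ! * avoiding χ A)))) S
    ≡⟨ ∂-+ _ _ S ⟩
  avoiding′ χ (suc d) S + ∂ (λ R → ∑ (λ A → ⟦ χ A ⟧ * (⟦ A ⊑ R ⟧ * ((d ∸ ∣ A ∣) ! * avoiding χ A)))) S
    ≡⟨ cong (avoiding′ χ (suc d) S +_) (trans (∂-∑ (λ A R → ⟦ χ A ⟧ * (⟦ A ⊑ R ⟧ * ((d ∸ ∣ A ∣) ! * avoiding χ A))) S) (∑-cong each)) ⟩
  avoiding′ χ (suc d) S + ∑ (λ A → ⟦ χ A ⟧ * (⟦ A ⊑ S ⟧ * (strict! (suc d ∸ ∣ A ∣) * avoiding χ A))) ∎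
  where
  open ≡-Reasoning
  -- For a > d both sides are 0; this is the case in which no strict descent to A exists.
  strict-step : ∀ d a → (suc d ∸ a) * (d ∸ a) ! ≡ strict! (suc d ∸ a)
  strict-step d       zero    = refl
  strict-step zero    (suc a) rewrite 0∸n≡0 a = refl
  strict-step (suc d) (suc a) = strict-step d a
  rearrange₁ : ∀ c p f v → c * (p * (f * v)) ≡ c * (f * v) * p
  rearrange₁ = solve-∀
  rearrange₂ : ∀ c p f v r → c * (f * v) * (p * r) ≡ c * (p * (r * f * v))
  rearrange₂ = solve-∀
  each : ∀ A → ∂ (λ R → ⟦ χ A ⟧ * (⟦ A ⊑ R ⟧ * ((d ∸ ∣ A ∣) ! * avoiding χ A))) S
             ≡ ⟦ χ A ⟧ * (⟦ A ⊑ S ⟧ * (strict! (suc d ∸ ∣ A ∣) * avoiding χ A))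
  each A = begin
    ∂ (λ R → ⟦ χ A ⟧ * (⟦ A ⊑ R ⟧ * (f * v))) S       ≡⟨ ∂-cong S (λ R _ → rearrange₁ ⟦ χ A ⟧ ⟦ A ⊑ R ⟧ f v) ⟩
    ∂ (λ R → ⟦ χ A ⟧ * (f * v) * ⟦ A ⊑ R ⟧) S         ≡⟨ ∂-*ˡ (⟦ χ A ⟧ * (f * v)) _ S ⟩
    ⟦ χ A ⟧ * (f * v) * ∂ (λ R → ⟦ A ⊑ R ⟧) S         ≡⟨ cong (⟦ χ A ⟧ * (f * v) *_) (∂-⊑′ A S) ⟩
    ⟦ χ A ⟧ * (f * v) * (⟦ A ⊑ S ⟧ * (∣ S ∣ ∸ ∣ A ∣)) ≡⟨ rearrange₂ ⟦ χ A ⟧ ⟦ A ⊑ S ⟧ f v (∣ S ∣ ∸ ∣ A ∣) ⟩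
    ⟦ χ A ⟧ * (⟦ A ⊑ S ⟧ * ((∣ S ∣ ∸ ∣ A ∣) * f * v)) ≡⟨ cong (λ x → ⟦ χ A ⟧ * (⟦ A ⊑ S ⟧ * (x * v))) (trans (cong (λ s → (s ∸ ∣ A ∣) * f) e) (strict-step d ∣ A ∣)) ⟩
    ⟦ χ A ⟧ * (⟦ A ⊑ S ⟧ * (strict! (suc d ∸ ∣ A ∣) * v)) ∎
    where
    f = (d ∸ ∣ A ∣) !
    v = avoiding χ A

∑-*ʳ : ∀ {n} (f : Subset n → ℕ) c → ∑ (λ S → f S * c) ≡ ∑ f * c
∑-*ʳ f c = trans (∑-cong λ S → *-comm (f S) c) (trans (∑-*ˡ c f) (*-comm c (∑ f)))

∑-* : ∀ {m n} (f : Subset m → ℕ) (g : Subset n → ℕ) → ∑ f * ∑ g ≡ ∑ (λ A → ∑ (λ B → f A * g B))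
∑-* f g = trans (sym (∑-*ʳ f (∑ g))) (∑-cong λ A → sym (∑-*ˡ (f A) g))

[n∸s]∸[n∸b]≡b∸s : ∀ {n b} s → b ≤ n → (n ∸ s) ∸ (n ∸ b) ≡ b ∸ s
[n∸s]∸[n∸b]≡b∸s {n} {b} s b≤n = begin
  (n ∸ s) ∸ (n ∸ b)    ≡⟨ ∸-+-assoc n s (n ∸ b) ⟩
  n ∸ (s + (n ∸ b))    ≡⟨ cong (n ∸_) (+-comm s (n ∸ b)) ⟩
  n ∸ ((n ∸ b) + s)    ≡⟨ sym (∸-+-assoc n (n ∸ b) s) ⟩
  (n ∸ (n ∸ b)) ∸ s    ≡⟨ cong (_∸ s) (m∸[m∸n]≡n b≤n) ⟩
  b ∸ s                ∎
  where open ≡-Reasoning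

-- The number of maximal chains from the full set down to S that do not meet χ strictly above S.
avoidingAbove : ∀ {n} → (Subset n → Bool) → Subset n → ℕ
avoidingAbove χ S = avoiding (χ ∘ ∁) (∁ S)

-- Complementation reverses inclusion, so this is `last-visit` for `χ ∘ ∁` at `∁ S`.
first-visit : ∀ {n} (χ : Subset n → Bool) S → (n ∸ ∣ S ∣) ! ≡
  ⟦ not (χ S) ⟧ * avoidingAbove χ S + ∑ (λ B → ⟦ χ B ⟧ * (⟦ S ⊑ B ⟧ * ((∣ B ∣ ∸ ∣ S ∣) ! * avoidingAbove χ B)))
first-visit {n} χ S = begin
  (n ∸ ∣ S ∣) !          ≡⟨ cong _! (sym (∣∁p∣≡n∸∣p∣ S)) ⟩
  ∣ ∁ S ∣ !              ≡⟨ last-visit (χ ∘ ∁) ∣ ∁ S ∣ (∁ S) refl ⟩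
  ⟦ not (χ (∁ (∁ S))) ⟧ * avoidingAbove χ S + ∑ f
                         ≡⟨ cong₂ (λ T x → ⟦ not (χ T) ⟧ * avoidingAbove χ S + x) (∁-involutive S) (trans (sym (∑-∁ f)) (∑-cong reindex)) ⟩
  ⟦ not (χ S) ⟧ * avoidingAbove χ S + ∑ (λ B → ⟦ χ B ⟧ * (⟦ S ⊑ B ⟧ * ((∣ B ∣ ∸ ∣ S ∣) ! * avoidingAbove χ B))) ∎
  where
  open ≡-Reasoning
  f : Subset n → ℕ
  f A = ⟦ χ (∁ A) ⟧ * (⟦ A ⊑ ∁ S ⟧ * ((∣ ∁ S ∣ ∸ ∣ A ∣) ! * avoiding (χ ∘ ∁) A))
  reindex : ∀ B → f (∁ B) ≡ ⟦ χ B ⟧ * (⟦ S ⊑ B ⟧ * ((∣ B ∣ ∸ ∣ S ∣) ! * avoidingAbove χ B))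
  reindex B rewrite ∁-involutive B | ∁-⊑ B S | ∣∁p∣≡n∸∣p∣ S | ∣∁p∣≡n∸∣p∣ B | [n∸s]∸[n∸b]≡b∸s ∣ S ∣ (∣p∣≤n B) = refl

avoiding≤! : ∀ {n} (χ : Subset n → Bool) S → avoiding χ S ≤ ∣ S ∣ !
avoiding≤! χ S = ≤-trans (m≤m+n _ _) (≤-reflexive (sym (last-visit-below χ ∣ S ∣ S refl)))

avoidingAbove≤! : ∀ {n} (χ : Subset n → Bool) S → avoidingAbove χ S ≤ (n ∸ ∣ S ∣) !
avoidingAbove≤! χ S = ≤-trans (avoiding≤! (χ ∘ ∁) (∁ S)) (≤-reflexive (cong _! (∣∁p∣≡n∸∣p∣ S)))

-- The number of pairs (maximal chain of [A , B], member of χ on it).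
lubell : ∀ {n} → (Subset n → Bool) → Subset n → Subset n → ℕ
lubell χ A B = ∑ λ G → ⟦ χ G ⟧ * (⟦ A ⊑ G ⟧ * ⟦ G ⊑ B ⟧ * ((∣ G ∣ ∸ ∣ A ∣) ! * (∣ B ∣ ∸ ∣ G ∣) !))

lubell-⋢ : ∀ {n} (χ : Subset n → Bool) A B → (A ⊑ B) ≡ false → lubell χ A B ≡ 0
lubell-⋢ {n} χ A B A⋢B = trans (∑-cong vanish) (∑-zero n)
  where
  vanish : ∀ G → ⟦ χ G ⟧ * (⟦ A ⊑ G ⟧ * ⟦ G ⊑ B ⟧ * ((∣ G ∣ ∸ ∣ A ∣) ! * (∣ B ∣ ∸ ∣ G ∣) !)) ≡ 0
  vanish G with A ⊑ G in p | G ⊑ B in q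
  ... | false | _     = *-zeroʳ ⟦ χ G ⟧
  ... | true  | false = *-zeroʳ ⟦ χ G ⟧
  ... | true  | true  with trans (sym A⋢B) (⊑-trans A G B p q)
  ...   | ()

-- Maximal chains of 2^[n] are sorted by their lowest member A and highest member B in χ.
chain-decomposition : ∀ {n} (χ : Subset n → Bool) →
  ∑ (λ G → ⟦ χ G ⟧ * (∣ G ∣ ! * (n ∸ ∣ G ∣) !))
  ≡ ∑ (λ A → ∑ (λ B → ⟦ χ A ⟧ * avoiding χ A * (⟦ χ B ⟧ * avoidingAbove χ B) * lubell χ A B))
chain-decomposition {n} χ = begin
  ∑ (λ G → ⟦ χ G ⟧ * (∣ G ∣ ! * (n ∸ ∣ G ∣) !))         ≡⟨ ∑-cong (λ G → guard-cong (χ G) (λ G∈χ → cong₂ _*_ (below G G∈χ) (above G G∈χ))) ⟩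
  ∑ (λ G → ⟦ χ G ⟧ * (∑ (lo G) * ∑ (hi G)))             ≡⟨ ∑-cong (λ G → trans (cong (⟦ χ G ⟧ *_) (∑-* (lo G) (hi G))) (sym (∑-∑-*ˡ ⟦ χ G ⟧ (λ A B → lo G A * hi G B)))) ⟩
  ∑ (λ G → ∑ (λ A → ∑ (λ B → ⟦ χ G ⟧ * (lo G A * hi G B)))) ≡⟨ ∑-swap (λ G A → ∑ (λ B → ⟦ χ G ⟧ * (lo G A * hi G B))) ⟩
  ∑ (λ A → ∑ (λ G → ∑ (λ B → ⟦ χ G ⟧ * (lo G A * hi G B)))) ≡⟨ ∑-cong (λ A → ∑-swap (λ G B → ⟦ χ G ⟧ * (lo G A * hi G B))) ⟩
  ∑ (λ A → ∑ (λ B → ∑ (λ G → ⟦ χ G ⟧ * (lo G A * hi G B)))) ≡⟨ ∑-cong (λ A → ∑-cong (λ B → trans (∑-cong (regroup A B)) (∑-*ˡ (⟦ χ A ⟧ * avoiding χ A * (⟦ χ B ⟧ * avoidingAbove χ B)) (inside A B)))) ⟩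
  _ ∎
  where
  open ≡-Reasoning
  lo hi : Subset n → Subset n → ℕ
  lo G A = ⟦ χ A ⟧ * (⟦ A ⊑ G ⟧ * ((∣ G ∣ ∸ ∣ A ∣) ! * avoiding χ A))
  hi G B = ⟦ χ B ⟧ * (⟦ G ⊑ B ⟧ * ((∣ B ∣ ∸ ∣ G ∣) ! * avoidingAbove χ B))
  ∑-∑-*ˡ : ∀ c (f : Subset n → Subset n → ℕ) → ∑ (λ A → ∑ (λ B → c * f A B)) ≡ c * ∑ (λ A → ∑ (f A))
  ∑-∑-*ˡ c f = trans (∑-cong (λ A → ∑-*ˡ c (f A))) (∑-*ˡ c (λ A → ∑ (f A)))
  below : ∀ G → χ G ≡ true → ∣ G ∣ ! ≡ ∑ (lo G)
  below G G∈χ = trans (last-visit χ ∣ G ∣ G refl) (cong (λ b → ⟦ not b ⟧ * avoiding χ G + ∑ (lo G)) G∈χ)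
  above : ∀ G → χ G ≡ true → (n ∸ ∣ G ∣) ! ≡ ∑ (hi G)
  above G G∈χ = trans (first-visit χ G) (cong (λ b → ⟦ not b ⟧ * avoidingAbove χ G + ∑ (hi G)) G∈χ)
  shuffle : ∀ g a p f v b q f′ u → g * (a * (p * (f * v)) * (b * (q * (f′ * u)))) ≡ a * v * (b * u) * (g * (p * q * (f * f′)))
  shuffle = solve-∀
  inside : Subset n → Subset n → Subset n → ℕ
  inside A B G = ⟦ χ G ⟧ * (⟦ A ⊑ G ⟧ * ⟦ G ⊑ B ⟧ * ((∣ G ∣ ∸ ∣ A ∣) ! * (∣ B ∣ ∸ ∣ G ∣) !))
  regroup : ∀ A B G → ⟦ χ G ⟧ * (lo G A * hi G B) ≡ ⟦ χ A ⟧ * avoiding χ A * (⟦ χ B ⟧ * avoidingAbove χ B) * inside A B G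
  regroup A B G = shuffle ⟦ χ G ⟧ ⟦ χ A ⟧ ⟦ A ⊑ G ⟧ ((∣ G ∣ ∸ ∣ A ∣) !) (avoiding χ A) ⟦ χ B ⟧ ⟦ G ⊑ B ⟧ ((∣ B ∣ ∸ ∣ G ∣) !) (avoidingAbove χ B)

⊥-⊑ : ∀ {n} (S : Subset n) → (⊥ ⊑ S) ≡ true
⊥-⊑ []      = refl
⊥-⊑ (_ ∷ S) = ⊥-⊑ S

-- The left side counts the maximal chains that meet χ. Summed over A it collapses to ∣ B ∣ ! by
-- `last-visit`, and the remaining sum over B is the one in `first-visit` at `⊥`.
chain-count : ∀ {n} (χ : Subset n → Bool) →
  ∑ (λ A → ∑ (λ B → ⟦ χ A ⟧ * avoiding χ A * (⟦ χ B ⟧ * avoidingAbove χ B) * (⟦ A ⊑ B ⟧ * (∣ B ∣ ∸ ∣ A ∣) !))) ≤ n !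
chain-count {n} χ = begin
  ∑ (λ A → ∑ (λ B → term A B))   ≡⟨ ∑-swap term ⟩
  ∑ (λ B → ∑ (λ A → term A B))   ≤⟨ ∑-mono each ⟩
  ∑ hi                           ≤⟨ m≤n+m _ (⟦ not (χ ⊥) ⟧ * avoidingAbove χ ⊥) ⟩
  ⟦ not (χ ⊥) ⟧ * avoidingAbove χ ⊥ + ∑ hi ≡⟨ sym (first-visit χ ⊥) ⟩
  (n ∸ ∣ ⊥ {n} ∣) !              ≡⟨ cong (λ x → (n ∸ x) !) (∣⊥∣≡0 n) ⟩
  n !                            ∎
  where
  open ≤-Reasoning
  term : Subset n → Subset n → ℕ
  term A B = ⟦ χ A ⟧ * avoiding χ A * (⟦ χ B ⟧ * avoidingAbove χ B) * (⟦ A ⊑ B ⟧ * (∣ B ∣ ∸ ∣ A ∣) !)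
  hi : Subset n → ℕ
  hi B = ⟦ χ B ⟧ * (⟦ ⊥ ⊑ B ⟧ * ((∣ B ∣ ∸ ∣ ⊥ {n} ∣) ! * avoidingAbove χ B))
  lo : Subset n → Subset n → ℕ
  lo B A = ⟦ χ A ⟧ * (⟦ A ⊑ B ⟧ * ((∣ B ∣ ∸ ∣ A ∣) ! * avoiding χ A))
  shuffle : ∀ a v b u p f → a * v * (b * u) * (p * f) ≡ b * u * (a * (p * (f * v)))
  shuffle = solve-∀
  unit : ∀ b u f → b * u * f ≡ b * (1 * (f * u))
  unit = solve-∀
  each : ∀ B → ∑ (λ A → term A B) ≤ hi B
  each B = begin
    ∑ (λ A → term A B)                                ≡⟨ ∑-cong (λ A → shuffle ⟦ χ A ⟧ (avoiding χ A) ⟦ χ B ⟧ (avoidingAbove χ B) ⟦ A ⊑ B ⟧ _) ⟩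
    ∑ (λ A → ⟦ χ B ⟧ * avoidingAbove χ B * lo B A)    ≡⟨ ∑-*ˡ (⟦ χ B ⟧ * avoidingAbove χ B) (lo B) ⟩
    ⟦ χ B ⟧ * avoidingAbove χ B * ∑ (lo B)            ≤⟨ *-monoʳ-≤ (⟦ χ B ⟧ * avoidingAbove χ B) (≤-trans (m≤n+m _ _) (≤-reflexive (sym (last-visit χ ∣ B ∣ B refl)))) ⟩
    ⟦ χ B ⟧ * avoidingAbove χ B * ∣ B ∣ !             ≡⟨ unit ⟦ χ B ⟧ (avoidingAbove χ B) (∣ B ∣ !) ⟩
    ⟦ χ B ⟧ * (1 * (∣ B ∣ ! * avoidingAbove χ B))     ≡⟨ cong₂ (λ x y → ⟦ χ B ⟧ * (⟦ x ⟧ * ((∣ B ∣ ∸ y) ! * avoidingAbove χ B))) (sym (⊥-⊑ B)) (sym (∣⊥∣≡0 n)) ⟩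
    hi B                                              ∎

-- The number of maximal chains of 2^[n] through both A and B is ∣A∣! (n - ∣B∣)! (∣B∣ - ∣A∣)!.
excess : ∀ {n} → ℕ → (Subset n → Bool) → (Subset n → Subset n → Bool) → Subset n → Subset n → ℕ
excess {n} m χ good A B = ⟦ χ A ⟧ * (⟦ χ B ⟧ * (⟦ A ⊑ B ⟧ * (⟦ good A B ⟧ *
  ((suc (∣ B ∣ ∸ ∣ A ∣) ∸ m) * ((∣ B ∣ ∸ ∣ A ∣) ! * (∣ A ∣ ! * (n ∸ ∣ B ∣) !))))))

-- The m-parts of the local bounds add up to at most m n ! by `chain-count`. In the remainder,
-- carried by good pairs, the avoiding chains below A and above B are replaced by all chains there.
chain-bound : ∀ {n} m (χ : Subset n → Bool) (good : Subset n → Subset n → Bool) →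
  (∀ A B → χ A ≡ true → χ B ≡ true → (A ⊑ B) ≡ true →
    lubell χ A B ≤ (m + ⟦ good A B ⟧ * (suc (∣ B ∣ ∸ ∣ A ∣) ∸ m)) * (∣ B ∣ ∸ ∣ A ∣) !) →
  ∑ (λ G → ⟦ χ G ⟧ * (∣ G ∣ ! * (n ∸ ∣ G ∣) !)) ≤ m * n ! + ∑ (λ A → ∑ (excess m χ good A))
chain-bound {n} m χ good local = begin
  ∑ (λ G → ⟦ χ G ⟧ * (∣ G ∣ ! * (n ∸ ∣ G ∣) !))
    ≡⟨ chain-decomposition χ ⟩
  ∑ (λ A → ∑ (λ B → pair A B * lubell χ A B))
    ≤⟨ ∑-mono (λ A → ∑-mono (λ B → pointwise (χ A) (χ B) (A ⊑ B) (good A B) (local A B) (lubell-⋢ χ A B) (avoiding≤! χ A) (avoidingAbove≤! χ B))) ⟩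
  ∑ (λ A → ∑ (λ B → m * (pair A B * (⟦ A ⊑ B ⟧ * (∣ B ∣ ∸ ∣ A ∣) !)) + excess m χ good A B))
    ≡⟨ trans (∑-cong (λ A → ∑-+ (λ B → m * (pair A B * (⟦ A ⊑ B ⟧ * (∣ B ∣ ∸ ∣ A ∣) !))) (excess m χ good A))) (∑-+ _ (λ A → ∑ (excess m χ good A))) ⟩
  ∑ (λ A → ∑ (λ B → m * (pair A B * (⟦ A ⊑ B ⟧ * (∣ B ∣ ∸ ∣ A ∣) !)))) + Z
    ≡⟨ cong (_+ Z) (trans (∑-cong (λ A → ∑-*ˡ m (λ B → pair A B * (⟦ A ⊑ B ⟧ * (∣ B ∣ ∸ ∣ A ∣) !)))) (∑-*ˡ m (λ A → ∑ (λ B → pair A B * (⟦ A ⊑ B ⟧ * (∣ B ∣ ∸ ∣ A ∣) !))))) ⟩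
  m * ∑ (λ A → ∑ (λ B → pair A B * (⟦ A ⊑ B ⟧ * (∣ B ∣ ∸ ∣ A ∣) !))) + Z
    ≤⟨ +-monoˡ-≤ Z (*-monoʳ-≤ m (chain-count χ)) ⟩
  m * n ! + Z ∎
  where
  open ≤-Reasoning
  pair : Subset n → Subset n → ℕ
  pair A B = ⟦ χ A ⟧ * avoiding χ A * (⟦ χ B ⟧ * avoidingAbove χ B)
  Z = ∑ (λ A → ∑ (excess m χ good A))
  units : ∀ v u x → (v + 0) * (u + 0) * x ≡ v * u * x
  units = solve-∀
  distribute : ∀ v u m g e f → v * u * ((m + g * e) * f) ≡ m * ((v + 0) * (u + 0) * (f + 0)) + g * (e * (f * (v * u)))
  distribute = solve-∀
  pointwise : ∀ a b p g {v u L f v! u! e} →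
    (a ≡ true → b ≡ true → p ≡ true → L ≤ (m + ⟦ g ⟧ * e) * f) → (p ≡ false → L ≡ 0) → v ≤ v! → u ≤ u! →
    ⟦ a ⟧ * v * (⟦ b ⟧ * u) * L ≤ m * (⟦ a ⟧ * v * (⟦ b ⟧ * u) * (⟦ p ⟧ * f)) + ⟦ a ⟧ * (⟦ b ⟧ * (⟦ p ⟧ * (⟦ g ⟧ * (e * (f * (v! * u!))))))
  pointwise false _     _     _ _ _ _ _ = z≤n
  pointwise true  false _     _ {v} {L = L} _ _ _ _ = ≤-trans (≤-reflexive (cong (_* L) (*-zeroʳ (1 * v)))) z≤n
  pointwise true  true  false _ {v} {u} _ L≡0 _ _ rewrite L≡0 refl = ≤-trans (≤-reflexive (*-zeroʳ ((v + 0) * (u + 0)))) z≤n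
  pointwise true  true  true  g {v} {u} {L} {f} {v!} {u!} {e} L≤ _ v≤ u≤ = begin
    (v + 0) * (u + 0) * L                     ≡⟨ units v u L ⟩
    v * u * L                                 ≤⟨ *-monoʳ-≤ (v * u) (L≤ refl refl refl) ⟩
    v * u * ((m + ⟦ g ⟧ * e) * f)             ≡⟨ distribute v u m ⟦ g ⟧ e f ⟩
    m * ((v + 0) * (u + 0) * (f + 0)) + ⟦ g ⟧ * (e * (f * (v * u)))
      ≤⟨ +-monoʳ-≤ (m * ((v + 0) * (u + 0) * (f + 0))) (≤-trans (*-monoʳ-≤ ⟦ g ⟧ (*-monoʳ-≤ e (*-monoʳ-≤ f (*-mono-≤ v≤ u≤)))) (≤-reflexive (pad (⟦ g ⟧ * (e * (f * (v! * u!))))))) ⟩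
    m * ((v + 0) * (u + 0) * (f + 0)) + (⟦ g ⟧ * (e * (f * (v! * u!))) + 0 + 0 + 0) ∎
    where
    pad : ∀ x → x ≡ x + 0 + 0 + 0
    pad = solve-∀

-- Lubell sums of intervals

level : ∀ {n} → (Subset n → Bool) → Subset n → Subset n → ℕ → ℕ
level χ A B i = ∑ λ S → ⟦ χ S ⟧ * (⟦ A ⊑ S ⟧ * ⟦ S ⊑ B ⟧ * ⟦ ∣ S ∣ ≡ᵇ ∣ A ∣ + i ⟧)

-- Induction on the coordinates: one in B but not in A is free and gives Pascal's rule, any other is
-- forced.
interval-level≤C : ∀ {n} (A B : Subset n) i → (A ⊑ B) ≡ true →
  ∑ (λ S → ⟦ A ⊑ S ⟧ * ⟦ S ⊑ B ⟧ * ⟦ ∣ S ∣ ≡ᵇ ∣ A ∣ + i ⟧) ≤ (∣ B ∣ ∸ ∣ A ∣) C i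
interval-level≤C []          []          zero    A⊑B = ≤-refl
interval-level≤C []          []          (suc i) A⊑B = z≤n
interval-level≤C {suc n} (false ∷ A) (false ∷ B) i A⊑B =
  ≤-trans (≤-reflexive (cong (_+ ∑ (λ S → ⟦ A ⊑ S ⟧ * ⟦ S ⊑ B ⟧ * ⟦ ∣ S ∣ ≡ᵇ ∣ A ∣ + i ⟧)) (trans (∑-cong (λ S → cong (_* ⟦ suc ∣ S ∣ ≡ᵇ ∣ A ∣ + i ⟧) (*-zeroʳ ⟦ A ⊑ S ⟧))) (∑-zero n))))
          (interval-level≤C A B i A⊑B)
interval-level≤C {suc n} (true ∷ A) (true ∷ B) i A⊑B =
  ≤-trans (≤-reflexive (trans (cong (∑ (λ S → ⟦ A ⊑ S ⟧ * ⟦ S ⊑ B ⟧ * ⟦ ∣ S ∣ ≡ᵇ ∣ A ∣ + i ⟧) +_) (∑-zero n)) (+-identityʳ _)))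
          (interval-level≤C A B i A⊑B)
interval-level≤C {suc n} (false ∷ A) (true ∷ B) zero A⊑B =
  ≤-trans (+-mono-≤ (≤-reflexive (trans (∑-cong none) (∑-zero n))) (interval-level≤C A B zero A⊑B)) ≤-refl
  where
  none : ∀ S → ⟦ A ⊑ S ⟧ * ⟦ S ⊑ B ⟧ * ⟦ suc ∣ S ∣ ≡ᵇ ∣ A ∣ + 0 ⟧ ≡ 0
  none S with A ⊑ S in A⊑S | suc ∣ S ∣ ≡ᵇ ∣ A ∣ + 0 in e
  ... | false | _     = refl
  ... | true  | false = *-zeroʳ (1 * ⟦ S ⊑ B ⟧)
  ... | true  | true  = contradiction (⊑-size A S A⊑S)
    (<⇒≱ (≤-reflexive (trans (≡ᵇ⇒≡ (suc ∣ S ∣) _ (subst T (sym e) _)) (+-identityʳ ∣ A ∣))))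
interval-level≤C {suc n} (false ∷ A) (true ∷ B) (suc i) A⊑B
  rewrite +-∸-assoc 1 (⊑-size A B A⊑B) | +-suc ∣ A ∣ i | sym (nCk+nC[k+1]≡[n+1]C[k+1] (∣ B ∣ ∸ ∣ A ∣) i) =
  +-mono-≤ (interval-level≤C A B i A⊑B)
           (subst (λ x → ∑ (λ S → ⟦ A ⊑ S ⟧ * ⟦ S ⊑ B ⟧ * ⟦ ∣ S ∣ ≡ᵇ x ⟧) ≤ (∣ B ∣ ∸ ∣ A ∣) C suc i) (+-suc ∣ A ∣ i) (interval-level≤C A B (suc i) A⊑B))

⟦⟧*≤ : ∀ b x → ⟦ b ⟧ * x ≤ x
⟦⟧*≤ true  x = ≤-reflexive (+-identityʳ x)
⟦⟧*≤ false x = z≤n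

level≤C : ∀ {n} (χ : Subset n → Bool) A B i → (A ⊑ B) ≡ true → level χ A B i ≤ (∣ B ∣ ∸ ∣ A ∣) C i
level≤C χ A B i A⊑B = ≤-trans (∑-mono λ S → ⟦⟧*≤ (χ S) _) (interval-level≤C A B i A⊑B)

sumTo-pick : ∀ K r (w : ℕ → ℕ) → r < K → sumTo K (λ i → ⟦ r ≡ᵇ i ⟧ * w i) ≡ w r
sumTo-pick (suc K) r w (s≤s r≤K) with m≤n⇒m<n∨m≡n r≤K
... | inj₁ r<K rewrite sumTo-pick K r w r<K = trans (cong (λ b → w r + ⟦ b ⟧ * w K) (miss r<K)) (+-identityʳ (w r))
  where
  miss : ∀ {r K} → r < K → (r ≡ᵇ K) ≡ false
  miss {zero}  {suc K} _         = refl
  miss {suc r} {suc K} (s≤s r<K) = miss r<K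
... | inj₂ refl = trans (cong₂ _+_ (none K r ≤-refl) (cong (λ b → ⟦ b ⟧ * w r) (hit r))) (+-identityʳ (w r))
  where
  hit : ∀ r → (r ≡ᵇ r) ≡ true
  hit zero    = refl
  hit (suc r) = hit r
  miss : ∀ {K r} → K < r → (r ≡ᵇ K) ≡ false
  miss {zero}  {suc r} _         = refl
  miss {suc K} {suc r} (s≤s K<r) = miss K<r
  none : ∀ K r → K ≤ r → sumTo K (λ i → ⟦ r ≡ᵇ i ⟧ * w i) ≡ 0
  none zero    r K≤r = refl
  none (suc K) r K<r rewrite none K r (<⇒≤ K<r) | miss K<r = refl

by-level : ∀ {n} (χ : Subset n → Bool) A B (w : ℕ → ℕ) →
  ∑ (λ S → ⟦ χ S ⟧ * (⟦ A ⊑ S ⟧ * ⟦ S ⊑ B ⟧ * w (∣ S ∣ ∸ ∣ A ∣)))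
  ≡ sumTo (suc (∣ B ∣ ∸ ∣ A ∣)) (λ i → level χ A B i * w i)
by-level {n} χ A B w = sym (begin
  sumTo K (λ i → level χ A B i * w i)                          ≡⟨ sumTo-cong K (λ i _ → sym (∑-*ʳ (λ S → term S i) (w i))) ⟩
  sumTo K (λ i → ∑ (λ S → term S i * w i))                     ≡⟨ sumTo-∑-swap K (λ i S → term S i * w i) ⟩
  ∑ (λ S → sumTo K (λ i → term S i * w i))                     ≡⟨ ∑-cong each ⟩
  ∑ (λ S → ⟦ χ S ⟧ * (⟦ A ⊑ S ⟧ * ⟦ S ⊑ B ⟧ * w (∣ S ∣ ∸ ∣ A ∣))) ∎)
  where
  open ≡-Reasoning
  K = suc (∣ B ∣ ∸ ∣ A ∣)
  term : Subset n → ℕ → ℕ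
  term S i = ⟦ χ S ⟧ * (⟦ A ⊑ S ⟧ * ⟦ S ⊑ B ⟧ * ⟦ ∣ S ∣ ≡ᵇ ∣ A ∣ + i ⟧)
  assoc : ∀ c p q e w → c * (p * q * e) * w ≡ c * (p * (q * (e * w)))
  assoc = solve-∀
  +-≡ᵇ : ∀ a r i → (a + r ≡ᵇ a + i) ≡ (r ≡ᵇ i)
  +-≡ᵇ zero    r i = refl
  +-≡ᵇ (suc a) r i = +-≡ᵇ a r i
  pick : ∀ S → (A ⊑ S) ≡ true → (S ⊑ B) ≡ true → sumTo K (λ i → ⟦ ∣ S ∣ ≡ᵇ ∣ A ∣ + i ⟧ * w i) ≡ w (∣ S ∣ ∸ ∣ A ∣)
  pick S A⊑S S⊑B = trans (sumTo-cong K (λ i _ → cong (λ b → ⟦ b ⟧ * w i)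
      (trans (cong (_≡ᵇ ∣ A ∣ + i) (sym (m+[n∸m]≡n (⊑-size A S A⊑S)))) (+-≡ᵇ ∣ A ∣ (∣ S ∣ ∸ ∣ A ∣) i))))
    (sumTo-pick K (∣ S ∣ ∸ ∣ A ∣) w (s≤s (∸-monoˡ-≤ ∣ A ∣ (⊑-size S B S⊑B))))
  each : ∀ S → sumTo K (λ i → term S i * w i) ≡ ⟦ χ S ⟧ * (⟦ A ⊑ S ⟧ * ⟦ S ⊑ B ⟧ * w (∣ S ∣ ∸ ∣ A ∣))
  each S = begin
    sumTo K (λ i → term S i * w i)
      ≡⟨ sumTo-cong K (λ i _ → assoc ⟦ χ S ⟧ ⟦ A ⊑ S ⟧ ⟦ S ⊑ B ⟧ ⟦ ∣ S ∣ ≡ᵇ ∣ A ∣ + i ⟧ (w i)) ⟩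
    sumTo K (λ i → ⟦ χ S ⟧ * (⟦ A ⊑ S ⟧ * (⟦ S ⊑ B ⟧ * (⟦ ∣ S ∣ ≡ᵇ ∣ A ∣ + i ⟧ * w i))))
      ≡⟨ trans (sumTo-*ˡ K ⟦ χ S ⟧ _) (cong (⟦ χ S ⟧ *_) (trans (sumTo-*ˡ K ⟦ A ⊑ S ⟧ _) (cong (⟦ A ⊑ S ⟧ *_) (sumTo-*ˡ K ⟦ S ⊑ B ⟧ _)))) ⟩
    ⟦ χ S ⟧ * (⟦ A ⊑ S ⟧ * (⟦ S ⊑ B ⟧ * sumTo K (λ i → ⟦ ∣ S ∣ ≡ᵇ ∣ A ∣ + i ⟧ * w i)))
      ≡⟨ cong (⟦ χ S ⟧ *_) (guard-cong (A ⊑ S) (λ p → guard-cong (S ⊑ B) (pick S p))) ⟩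
    ⟦ χ S ⟧ * (⟦ A ⊑ S ⟧ * (⟦ S ⊑ B ⟧ * w (∣ S ∣ ∸ ∣ A ∣)))
      ≡⟨ cong (⟦ χ S ⟧ *_) (sym (*-assoc ⟦ A ⊑ S ⟧ ⟦ S ⊑ B ⟧ _)) ⟩
    ⟦ χ S ⟧ * (⟦ A ⊑ S ⟧ * ⟦ S ⊑ B ⟧ * w (∣ S ∣ ∸ ∣ A ∣)) ∎

lubell-by-level : ∀ {n} (χ : Subset n → Bool) A B →
  lubell χ A B ≡ sumTo (suc (∣ B ∣ ∸ ∣ A ∣)) (λ i → level χ A B i * (i ! * (∣ B ∣ ∸ ∣ A ∣ ∸ i) !))
lubell-by-level χ A B = trans (∑-cong (λ S → cong (⟦ χ S ⟧ *_)
    (trans (*-assoc ⟦ A ⊑ S ⟧ ⟦ S ⊑ B ⟧ _) (trans (guard-cong (A ⊑ S) (λ p → cong (λ x → ⟦ S ⊑ B ⟧ * ((∣ S ∣ ∸ ∣ A ∣) ! * x !)) (codim S p)))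
           (sym (*-assoc ⟦ A ⊑ S ⟧ ⟦ S ⊑ B ⟧ _))))))
  (by-level χ A B (λ i → i ! * (∣ B ∣ ∸ ∣ A ∣ ∸ i) !))
  where
  codim : ∀ S → (A ⊑ S) ≡ true → ∣ B ∣ ∸ ∣ S ∣ ≡ ∣ B ∣ ∸ ∣ A ∣ ∸ (∣ S ∣ ∸ ∣ A ∣)
  codim S p = sym (trans (∸-+-assoc ∣ B ∣ ∣ A ∣ (∣ S ∣ ∸ ∣ A ∣)) (cong (∣ B ∣ ∸_) (m+[n∸m]≡n (⊑-size A S p))))

nCi*i!*[n∸i]!≡n! : ∀ {n i} → i ≤ n → (n C i) * (i ! * (n ∸ i) !) ≡ n !
nCi*i!*[n∸i]!≡n! {n} {i} i≤n = subst (λ x → (x C i) * (i ! * (n ∸ i) !) ≡ x !) (m+[n∸m]≡n i≤n) (nCk*k!*j!≡n! i (n ∸ i))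

level-chains≤k! : ∀ {n} (χ : Subset n → Bool) A B → (A ⊑ B) ≡ true → ∀ i → i ≤ ∣ B ∣ ∸ ∣ A ∣ →
  level χ A B i * (i ! * (∣ B ∣ ∸ ∣ A ∣ ∸ i) !) ≤ (∣ B ∣ ∸ ∣ A ∣) !
level-chains≤k! χ A B A⊑B i i≤k = ≤-trans (*-monoˡ-≤ _ (level≤C χ A B i A⊑B)) (≤-reflexive (nCi*i!*[n∸i]!≡n! i≤k))

lubell≤[1+k]k! : ∀ {n} (χ : Subset n → Bool) A B → (A ⊑ B) ≡ true →
  lubell χ A B ≤ suc (∣ B ∣ ∸ ∣ A ∣) * (∣ B ∣ ∸ ∣ A ∣) !
lubell≤[1+k]k! χ A B A⊑B = begin
  lubell χ A B                                           ≡⟨ lubell-by-level χ A B ⟩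
  sumTo (suc k) (λ i → level χ A B i * (i ! * (k ∸ i) !)) ≤⟨ sumTo-mono (suc k) (λ { i (s≤s i≤k) → level-chains≤k! χ A B A⊑B i i≤k }) ⟩
  sumTo (suc k) (λ _ → k !)                              ≡⟨ sumTo-const (suc k) (k !) ⟩
  suc k * k !                                            ∎
  where
  open ≤-Reasoning
  k = ∣ B ∣ ∸ ∣ A ∣

-- Compares a row with one that has a level less: after an initial block settled by the base, level
-- j + 1 of f is charged to level j of g.
sumTo-merge : ∀ K₀ {f g : ℕ → ℕ} → sumTo (suc K₀) f ≤ sumTo K₀ g → ∀ d →
  (∀ j → K₀ ≤ j → j < d + K₀ → f (suc j) ≤ g j) → sumTo (suc (d + K₀)) f ≤ sumTo (d + K₀) g
sumTo-merge K₀ base zero    step = base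
sumTo-merge K₀ base (suc d) step =
  +-mono-≤ (sumTo-merge K₀ base d (λ j K₀≤j j< → step j K₀≤j (m<n⇒m<1+n j<))) (step (d + K₀) (m≤n+m K₀ d) ≤-refl)

-- Lubell bounds from the number of sets and from the width of the levels

shortfall : ℕ → ℕ → ℕ
shortfall t k = sumTo (suc k) (λ i → t ∸ k C i)

-- In row k + 1 level p contributes 0, as t ≤ m C p. Levels below p keep their index, levels above p
-- are matched with the preceding one in row k, and no binomial coefficient gets smaller.
shortfall-antitone : ∀ {t m p} → p ≤ m → t ≤ m C p → ∀ {k} → m ≤ k → shortfall t k ≤ shortfall t m
shortfall-antitone {t} {m} {p} p≤m t≤mCp {k} m≤k =
  subst (λ x → shortfall t x ≤ shortfall t m) (m∸n+n≡m m≤k) (go (k ∸ m))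
  where
  step : ∀ k → m ≤ k → shortfall t (suc k) ≤ shortfall t k
  step k m≤k = subst (λ K → sumTo (suc K) (λ i → t ∸ suc k C i) ≤ sumTo K (λ i → t ∸ k C i)) (m∸n+n≡m p≤1+k)
    (sumTo-merge p base (suc k ∸ p) (λ j _ _ → ∸-monoʳ-≤ t (nCk≤[1+n]C[1+k] k j)))
    where
    p≤1+k : p ≤ suc k
    p≤1+k = ≤-trans p≤m (m≤n⇒m≤1+n m≤k)
    base : sumTo (suc p) (λ i → t ∸ suc k C i) ≤ sumTo p (λ i → t ∸ k C i)
    base = ≤-trans (+-mono-≤ (sumTo-mono p (λ i _ → ∸-monoʳ-≤ t (nCk≤[1+n]Ck k i)))
                             (≤-reflexive (m≤n⇒m∸n≡0 (≤-trans t≤mCp (C-monoˡ-≤ p (m≤n⇒m≤1+n m≤k))))))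
                   (≤-reflexive (+-identityʳ _))
  go : ∀ d → shortfall t (d + m) ≤ shortfall t m
  go zero    = ≤-refl
  go (suc d) = ≤-trans (step (d + m) (m≤n+m m d)) (go d)

intervalCount : ∀ {n} → (Subset n → Bool) → Subset n → Subset n → ℕ
intervalCount χ A B = ∑ λ S → ⟦ χ S ⟧ * (⟦ A ⊑ S ⟧ * ⟦ S ⊑ B ⟧)

-- The linear programming dual bound: x / c ≤ max(0, 1 - c / t) + x / t for 0 ≤ x ≤ c, summed over the levels.
lubell-dual : ∀ {n} (χ : Subset n → Bool) A B t → (A ⊑ B) ≡ true →
  t * lubell χ A B ≤ (shortfall t (∣ B ∣ ∸ ∣ A ∣) + intervalCount χ A B) * (∣ B ∣ ∸ ∣ A ∣) !
lubell-dual χ A B t A⊑B = begin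
  t * lubell χ A B                                                 ≡⟨ cong (t *_) (lubell-by-level χ A B) ⟩
  t * sumTo (suc k) (λ i → x i * (i ! * (k ∸ i) !))                ≡⟨ sym (sumTo-*ˡ (suc k) t _) ⟩
  sumTo (suc k) (λ i → t * (x i * (i ! * (k ∸ i) !)))              ≤⟨ sumTo-mono (suc k) (λ { i (s≤s i≤k) → each i i≤k }) ⟩
  sumTo (suc k) (λ i → k ! * ((t ∸ k C i) + x i * 1))              ≡⟨ trans (sumTo-*ˡ (suc k) (k !) _) (cong (k ! *_) (sumTo-+ (suc k) (λ i → t ∸ k C i) (λ i → x i * 1))) ⟩
  k ! * (shortfall t k + sumTo (suc k) (λ i → x i * 1))            ≡⟨ cong (λ y → k ! * (shortfall t k + y)) (trans (sym (by-level χ A B (λ _ → 1))) (∑-cong (λ S → cong (⟦ χ S ⟧ *_) (*-identityʳ _)))) ⟩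
  k ! * (shortfall t k + intervalCount χ A B)                      ≡⟨ *-comm (k !) _ ⟩
  (shortfall t k + intervalCount χ A B) * k !                      ∎
  where
  open ≤-Reasoning
  k = ∣ B ∣ ∸ ∣ A ∣
  x = level χ A B
  split : ∀ d c x w → (d + c) * (x * w) ≡ d * (x * w) + x * (c * w)
  split = solve-∀
  factor : ∀ d f x → d * f + x * f ≡ f * (d + x * 1)
  factor = solve-∀
  each : ∀ i → i ≤ k → t * (x i * (i ! * (k ∸ i) !)) ≤ k ! * ((t ∸ k C i) + x i * 1)
  each i i≤k = begin
    t * (x i * w)                                  ≤⟨ *-monoˡ-≤ (x i * w) (m≤n+m∸n t (k C i)) ⟩
    (k C i + (t ∸ k C i)) * (x i * w)              ≡⟨ cong (_* (x i * w)) (+-comm (k C i) _) ⟩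
    ((t ∸ k C i) + k C i) * (x i * w)              ≡⟨ split (t ∸ k C i) (k C i) (x i) w ⟩
    (t ∸ k C i) * (x i * w) + x i * ((k C i) * w)  ≤⟨ +-mono-≤ (*-monoʳ-≤ (t ∸ k C i) (level-chains≤k! χ A B A⊑B i i≤k)) (≤-reflexive (cong (x i *_) (nCi*i!*[n∸i]!≡n! i≤k))) ⟩
    (t ∸ k C i) * k ! + x i * k !                  ≡⟨ factor (t ∸ k C i) (k !) (x i) ⟩
    k ! * ((t ∸ k C i) + x i * 1)                  ∎
    where w = i ! * (k ∸ i) !

-- For t = central m no entry of row m exceeds t, so the shortfall is exactly (m + 1) t - 2^m, and
-- the dual bound drops to m once s + t + 1 ≤ 2^m. The count s + 1 stands for at most s - 1 interior
-- sets and the two ends.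
few⇒lubell≤m : ∀ {n} (χ : Subset n → Bool) A B m s → (A ⊑ B) ≡ true → m ≤ ∣ B ∣ ∸ ∣ A ∣ →
  s + centralBinom m + 1 ≤ 2 ^ m → intervalCount χ A B ≤ suc s →
  lubell χ A B ≤ m * (∣ B ∣ ∸ ∣ A ∣) !
few⇒lubell≤m χ A B m s A⊑B m≤k s+t<2^m X≤1+s = *-cancelˡ-≤ t {{>-nonZero (1≤central m)}} (begin
  t * lubell χ A B                                   ≤⟨ lubell-dual χ A B t A⊑B ⟩
  (shortfall t k + intervalCount χ A B) * k !        ≤⟨ *-monoˡ-≤ (k !) (+-mono-≤ (shortfall-antitone (⌊n/2⌋≤n m) ≤-refl m≤k) X≤1+s) ⟩
  (shortfall t m + suc s) * k !                      ≤⟨ *-monoˡ-≤ (k !) room ⟩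
  m * t * k !                                        ≡⟨ rearrange m t (k !) ⟩
  t * (m * k !)                                      ∎)
  where
  open ≤-Reasoning
  t = centralBinom m
  k = ∣ B ∣ ∸ ∣ A ∣
  rearrange : ∀ m t f → m * t * f ≡ t * (m * f)
  rearrange = solve-∀
  shuffle : ∀ g s t → g + suc s + t ≡ g + (s + t + 1)
  shuffle = solve-∀
  complement : shortfall t m + 2 ^ m ≡ suc m * t
  complement = trans (cong (shortfall t m +_) (sym (sumTo-C≡2^n m))) (trans (sym (sumTo-+ (suc m) _ _))
    (trans (sumTo-cong (suc m) (λ i _ → m∸n+n≡m (nCk≤central m i))) (sumTo-const (suc m) t)))
  room : shortfall t m + suc s ≤ m * t
  room = +-cancelʳ-≤ t _ _ (begin
    shortfall t m + suc s + t       ≡⟨ shuffle (shortfall t m) s t ⟩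
    shortfall t m + (s + t + 1)     ≤⟨ +-monoʳ-≤ (shortfall t m) s+t<2^m ⟩
    shortfall t m + 2 ^ m           ≡⟨ complement ⟩
    t + m * t                       ≡⟨ +-comm t (m * t) ⟩
    m * t + t                       ∎)

-- k ! times the bound Σ min (1 , w / (k C i)) on the Lubell sum of a family with at most w sets on each level.
cappedSum : ℕ → ℕ → ℕ
cappedSum w k = sumTo (suc k) (λ i → k ! ⊓ (w * (i ! * (k ∸ i) !)))

lubell≤cappedSum : ∀ {n} (χ : Subset n → Bool) A B w → (A ⊑ B) ≡ true →
  (∀ i → i ≤ ∣ B ∣ ∸ ∣ A ∣ → level χ A B i ≤ w) → lubell χ A B ≤ cappedSum w (∣ B ∣ ∸ ∣ A ∣)
lubell≤cappedSum χ A B w A⊑B level≤w = ≤-trans (≤-reflexive (lubell-by-level χ A B))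
  (sumTo-mono _ λ { i (s≤s i≤k) → ⊓-glb (level-chains≤k! χ A B A⊑B i i≤k) (*-monoˡ-≤ _ (level≤w i i≤k)) })

-- The new row has one level more, yet its normalised sum must not be larger. Levels p and p + 1 of
-- row k are not capped, and the reciprocals of the entries p, p + 1, p + 2 of row k + 1 sum to at
-- most those of the entries p, p + 1 of row k. All other levels are matched with one that has no
-- larger binomial coefficient. The factor `suc k` is the ratio of the normalising factorials.
cappedSum-step : ∀ {w} p q → 1 ≤ p → 1 ≤ q → let k = suc (p + q) in
  w ≤ k C p → w ≤ k C suc p → cappedSum w (suc k) ≤ suc k * cappedSum w k
cappedSum-step {w} p@(suc p′) q@(suc q′) _ _ w≤kCp w≤kC[1+p] = begin
  sumTo (suc (suc k)) f                    ≡⟨ cong (λ K → sumTo (suc K) f) (sym K≡) ⟩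
  sumTo (suc (q + suc (suc p))) f          ≤⟨ sumTo-merge (suc (suc p)) {f} {g} base q (λ j _ j< → right j (s≤s⁻¹ (≤-trans j< (≤-reflexive K≡)))) ⟩
  sumTo (q + suc (suc p)) g                ≡⟨ cong (λ K → sumTo K g) K≡ ⟩
  sumTo (suc k) g                          ≡⟨ sumTo-*ˡ (suc k) (suc k) _ ⟩
  suc k * cappedSum w k                    ∎
  where
  open ≤-Reasoning
  k = suc (p + q)
  f g : ℕ → ℕ
  f i = suc k ! ⊓ (w * (i ! * (suc k ∸ i) !))
  g i = suc k * (k ! ⊓ (w * (i ! * (k ∸ i) !)))
  K≡ : q + suc (suc p) ≡ suc k
  K≡ = reorder p q
    where
    reorder : ∀ p q → q + suc (suc p) ≡ suc (suc (p + q))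
    reorder = solve-∀
  scaled : ∀ {x y} → x ≤ suc k * y → suc k ! ⊓ x ≤ suc k * (k ! ⊓ y)
  scaled {x} {y} x≤ = ≤-trans (⊓-monoʳ-≤ (suc k !) x≤) (≤-reflexive (sym (*-distribˡ-⊓ (suc k) (k !) y)))
  rearrange₁ : ∀ w a b c → w * (a * (b * c)) ≡ b * (w * (a * c))
  rearrange₁ = solve-∀
  rearrange₂ : ∀ w a b c → w * (b * a * c) ≡ b * (w * (a * c))
  rearrange₂ = solve-∀
  left : ∀ i → i ≤ k → f i ≤ g i
  left i i≤k = scaled (begin
    w * (i ! * (suc k ∸ i) !)               ≡⟨ cong (λ x → w * (i ! * x !)) (+-∸-assoc 1 i≤k) ⟩
    w * (i ! * (suc (k ∸ i) * (k ∸ i) !))   ≡⟨ rearrange₁ w (i !) (suc (k ∸ i)) _ ⟩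
    suc (k ∸ i) * (w * (i ! * (k ∸ i) !))   ≤⟨ *-monoˡ-≤ _ (s≤s (m∸n≤m k i)) ⟩
    suc k * (w * (i ! * (k ∸ i) !))         ∎)
  right : ∀ j → j ≤ k → f (suc j) ≤ g j
  right j j≤k = scaled (begin
    w * (suc j * j ! * (k ∸ j) !)           ≡⟨ rearrange₂ w (j !) (suc j) _ ⟩
    suc j * (w * (j ! * (k ∸ j) !))         ≤⟨ *-monoˡ-≤ _ (s≤s j≤k) ⟩
    suc k * (w * (j ! * (k ∸ j) !))         ∎)
  unsaturated : ∀ i → i ≤ k → w ≤ k C i → k ! ⊓ (w * (i ! * (k ∸ i) !)) ≡ w * (i ! * (k ∸ i) !)
  unsaturated i i≤k w≤ = m≥n⇒m⊓n≡n (≤-trans (*-monoˡ-≤ _ w≤) (≤-reflexive (nCi*i!*[n∸i]!≡n! i≤k)))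
  f≤ : ∀ i d → i + d ≡ suc k → f i ≤ w * (i ! * d !)
  f≤ i d e = ≤-trans (m⊓n≤n _ _) (≤-reflexive (cong (λ x → w * (i ! * x !)) (trans (cong (_∸ i) (sym e)) (m+n∸m≡n i d))))
  g≡ : ∀ i d → i + d ≡ k → w ≤ k C i → g i ≡ suc k * (w * (i ! * d !))
  g≡ i d e w≤ = cong (suc k *_) (trans (unsaturated i (≤-trans (m≤m+n i d) (≤-reflexive e)) w≤)
    (cong (λ x → w * (i ! * x !)) (trans (cong (_∸ i) (sym e)) (m+n∸m≡n i d))))
  index : ∀ p q → p + suc (suc q) ≡ suc (suc (p + q))
  index = solve-∀
  index′ : ∀ p q → p + suc q ≡ suc (p + q)
  index′ = solve-∀
  -- In units of w p ! q ! the gain is p q - 1 for the outer p and q, whose predecessors appear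
  -- here; this is where both must be positive.
  slack : ∀ w x y p q →
    w * (x * (suc (suc (suc q)) * (suc (suc q) * y))) + w * (suc (suc p) * x * (suc (suc q) * y)) + w * (suc (suc (suc p)) * (suc (suc p) * x) * y)
    + w * x * y * (p * q + p + q)
    ≡ suc (suc (suc p + suc q)) * (w * (x * (suc (suc q) * y))) + suc (suc (suc p + suc q)) * (w * (suc (suc p) * x * y))
  slack = solve-∀
  base : sumTo (suc (suc (suc p))) f ≤ sumTo (suc (suc p)) g
  base = begin
    sumTo p f + f p + f (suc p) + f (suc (suc p))
      ≡⟨ trans (+-assoc (sumTo p f + f p) _ _) (+-assoc (sumTo p f) _ _) ⟩
    sumTo p f + (f p + (f (suc p) + f (suc (suc p))))
      ≤⟨ +-mono-≤ (sumTo-mono p (λ i i<p → left i (≤-trans (<⇒≤ i<p) (m≤n⇒m≤1+n (m≤m+n p q))))) (≤-trans (≤-reflexive (sym (+-assoc (f p) _ _))) triple) ⟩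
    sumTo p g + (g p + g (suc p))
      ≡⟨ sym (+-assoc (sumTo p g) _ _) ⟩
    sumTo p g + g p + g (suc p) ∎
    where
    triple : f p + f (suc p) + f (suc (suc p)) ≤ g p + g (suc p)
    triple = begin
      f p + f (suc p) + f (suc (suc p))
        ≤⟨ +-mono-≤ (+-mono-≤ (f≤ p (suc (suc q)) (index p q)) (f≤ (suc p) (suc q) (cong suc (index′ p q)))) (f≤ (suc (suc p)) q refl) ⟩
      w * (p ! * suc (suc q) !) + w * (suc p ! * suc q !) + w * (suc (suc p) ! * q !)
        ≤⟨ m≤m+n _ (w * p ! * q ! * (p′ * q′ + p′ + q′)) ⟩
      w * (p ! * suc (suc q) !) + w * (suc p ! * suc q !) + w * (suc (suc p) ! * q !) + w * p ! * q ! * (p′ * q′ + p′ + q′)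
        ≡⟨ slack w (p !) (q !) p′ q′ ⟩
      suc k * (w * (p ! * suc q !)) + suc k * (w * (suc p ! * q !))
        ≡⟨ sym (cong₂ _+_ (g≡ p (suc q) (index′ p q) w≤kCp) (g≡ (suc p) q refl w≤kC[1+p])) ⟩
      g p + g (suc p) ∎

cappedSum-bound : ∀ {w m} p → 1 ≤ p → suc (suc p) ≤ m → w ≤ m C p → w ≤ m C suc p → cappedSum w m ≤ m * m ! →
  ∀ {k} → m ≤ k → cappedSum w k ≤ m * k !
cappedSum-bound {w} {m} p 1≤p p+2≤m w≤mCp w≤mC[1+p] base {k} m≤k =
  subst (λ x → cappedSum w x ≤ m * x !) (m∸n+n≡m m≤k) (go (k ∸ m))
  where
  step : ∀ k → m ≤ k → cappedSum w (suc k) ≤ suc k * cappedSum w k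
  step k m≤k = subst (λ x → w ≤ x C p → w ≤ x C suc p → cappedSum w (suc x) ≤ suc x * cappedSum w x)
    (m+[n∸m]≡n (≤-trans (≤-trans (n≤1+n (suc p)) p+2≤m) m≤k))
    (cappedSum-step p (k ∸ suc p) 1≤p (m<n⇒0<n∸m (≤-trans p+2≤m m≤k)))
    (≤-trans w≤mCp (C-monoˡ-≤ p m≤k)) (≤-trans w≤mC[1+p] (C-monoˡ-≤ (suc p) m≤k))
  go : ∀ d → cappedSum w (d + m) ≤ m * (d + m) !
  go zero    = base
  go (suc d) = ≤-trans (step (d + m) (m≤n+m m d)) (≤-trans (*-monoʳ-≤ (suc (d + m)) (go d)) (≤-reflexive (swap (suc (d + m)) m ((d + m) !))))
    where
    swap : ∀ a b c → a * (b * c) ≡ b * (a * c)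
    swap = solve-∀

-- t + 1 central levels, each of which a family of width w fills up to a fraction of at most t / (t + 1).
cappedSum-base : ∀ w m t a → a + t ≡ ⌊ m /2⌋ → suc t * w ≤ t * (m C a) → cappedSum w m ≤ m * m !
cappedSum-base w m t a a+t≡h tw≤ = *-cancelˡ-≤ (suc t) (begin
  suc t * cappedSum w m                        ≡⟨ sym (sumTo-*ˡ (suc m) (suc t) φ) ⟩
  sumTo (suc m) ψ                              ≡⟨ cong (λ x → sumTo x ψ) (sym parts) ⟩
  sumTo (a + suc t + c) ψ                      ≡⟨ trans (sumTo-++ (a + suc t) c ψ) (cong (_+ sumTo c (λ i → ψ (a + suc t + i))) (sumTo-++ a (suc t) ψ)) ⟩
  sumTo a ψ + sumTo (suc t) (λ i → ψ (a + i)) + sumTo c (λ i → ψ (a + suc t + i))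
    ≤⟨ +-mono-≤ (+-mono-≤ (sumTo-mono a (λ i _ → crude i)) (sumTo-mono (suc t) (λ { j (s≤s j≤t) → central j j≤t }))) (sumTo-mono c (λ i _ → crude (a + suc t + i))) ⟩
  sumTo a (λ _ → suc t * m !) + sumTo (suc t) (λ _ → t * m !) + sumTo c (λ _ → suc t * m !)
    ≡⟨ cong₂ _+_ (cong₂ _+_ (sumTo-const a _) (sumTo-const (suc t) _)) (sumTo-const c _) ⟩
  a * (suc t * m !) + suc t * (t * m !) + c * (suc t * m !)
    ≡⟨ collect a t c (m !) ⟩
  suc t * ((a + t + c) * m !)
    ≡⟨ cong (λ x → suc t * (x * m !)) (suc-injective (trans (cong (_+ c) (sym (+-suc a t))) parts)) ⟩
  suc t * (m * m !) ∎)
  where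
  open ≤-Reasoning
  φ ψ : ℕ → ℕ
  φ i = m ! ⊓ (w * (i ! * (m ∸ i) !))
  ψ i = suc t * φ i
  c = suc m ∸ (a + suc t)
  h≤m = ⌊n/2⌋≤n m
  parts : a + suc t + c ≡ suc m
  parts = m+[n∸m]≡n (≤-trans (≤-reflexive (trans (+-suc a t) (cong suc a+t≡h))) (s≤s h≤m))
  collect : ∀ a t c f → a * (suc t * f) + suc t * (t * f) + c * (suc t * f) ≡ suc t * ((a + t + c) * f)
  collect = solve-∀
  crude : ∀ i → ψ i ≤ suc t * m !
  crude i = *-monoʳ-≤ (suc t) (m⊓n≤m (m !) _)
  central : ∀ j → j ≤ t → ψ (a + j) ≤ t * m !
  central j j≤t = begin
    suc t * φ i                                ≤⟨ *-monoʳ-≤ (suc t) (m⊓n≤n (m !) _) ⟩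
    suc t * (w * (i ! * (m ∸ i) !))            ≡⟨ sym (*-assoc (suc t) w _) ⟩
    suc t * w * (i ! * (m ∸ i) !)              ≤⟨ *-monoˡ-≤ _ (≤-trans tw≤ (*-monoʳ-≤ t (C-mono-below (m≤m+n a j) (≤-trans (+-mono-≤ i≤h i≤h) (⌊n/2⌋+⌊n/2⌋≤n m))))) ⟩
    t * (m C i) * (i ! * (m ∸ i) !)            ≡⟨ *-assoc t (m C i) _ ⟩
    t * ((m C i) * (i ! * (m ∸ i) !))          ≡⟨ cong (t *_) (nCi*i!*[n∸i]!≡n! (≤-trans i≤h h≤m)) ⟩
    t * m !                                    ∎
    where
    i = a + j
    i≤h : i ≤ ⌊ m /2⌋
    i≤h = ≤-trans (+-monoʳ-≤ a j≤t) (≤-reflexive a+t≡h)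

-- Going down from level a + 1 to level a, at distance j + 1 from the middle, loses at most 2 (j +
-- 1) central m / h, and 2 + 4 + ... + 2 j = j (j + 1).
near-central : ∀ m j a → a + j ≡ ⌊ m /2⌋ →
  ⌊ m /2⌋ * centralBinom m ≤ ⌊ m /2⌋ * (m C a) + j * suc j * centralBinom m
near-central m zero    a e rewrite sym (trans (sym (+-identityʳ a)) e) = m≤m+n _ 0
near-central m (suc j) a e = begin
  h * B                                                    ≤⟨ near-central m j (suc a) (trans (sym (+-suc a j)) e) ⟩
  h * c₁ + j * suc j * B                                   ≤⟨ +-monoˡ-≤ (j * suc j * B) drop ⟩
  h * c₀ + (j + suc (suc j)) * B + j * suc j * B           ≡⟨ collect (h * c₀) j B ⟩
  h * c₀ + suc j * suc (suc j) * B                         ∎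
  where
  open ≤-Reasoning
  h = ⌊ m /2⌋
  B = centralBinom m
  c₀ = m C a
  c₁ = m C suc a
  h≡ : h ≡ suc a + j
  h≡ = trans (sym e) (+-suc a j)
  collect : ∀ x j b → x + (j + suc (suc j)) * b + j * suc j * b ≡ x + suc j * suc (suc j) * b
  collect = solve-∀
  split : ∀ a j c → (suc a + j) * c ≡ suc a * c + j * c
  split = solve-∀
  bound : ∀ a j c → suc (suc a + j + (suc a + j)) * c ≡ (suc a + j) * c + suc (suc j) * c + a * c
  bound = solve-∀
  regroup : ∀ x j b → x + suc (suc j) * b + j * b ≡ x + (j + suc (suc j)) * b
  regroup = solve-∀
  absorbed : suc a * c₁ ≤ h * c₀ + suc (suc j) * c₀
  absorbed = +-cancelʳ-≤ (a * c₀) _ _ (begin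
    suc a * c₁ + a * c₀                      ≡⟨ [1+k]nC[1+k]+knCk m a ⟩
    m * c₀                                   ≤⟨ *-monoˡ-≤ c₀ (n≤1+⌊n/2⌋+⌊n/2⌋ m) ⟩
    suc (h + h) * c₀                         ≡⟨ cong (λ x → suc (x + x) * c₀) h≡ ⟩
    suc (suc a + j + (suc a + j)) * c₀       ≡⟨ bound a j c₀ ⟩
    (suc a + j) * c₀ + suc (suc j) * c₀ + a * c₀ ≡⟨ cong (λ x → x * c₀ + suc (suc j) * c₀ + a * c₀) (sym h≡) ⟩
    h * c₀ + suc (suc j) * c₀ + a * c₀       ∎)
  drop : h * c₁ ≤ h * c₀ + (j + suc (suc j)) * B
  drop = begin
    h * c₁                                   ≡⟨ trans (cong (_* c₁) h≡) (split a j c₁) ⟩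
    suc a * c₁ + j * c₁                      ≤⟨ +-mono-≤ absorbed (*-monoʳ-≤ j (nCk≤central m (suc a))) ⟩
    h * c₀ + suc (suc j) * c₀ + j * B        ≤⟨ +-monoˡ-≤ (j * B) (+-monoʳ-≤ (h * c₀) (*-monoʳ-≤ (suc (suc j)) (nCk≤central m a))) ⟩
    h * c₀ + suc (suc j) * B + j * B         ≡⟨ regroup (h * c₀) j B ⟩
    h * c₀ + (j + suc (suc j)) * B           ∎

-- Copies of the diamond

⊑⇒⊆ : ∀ {n} (A B : Subset n) → (A ⊑ B) ≡ true → A ⊆ B
⊑⇒⊆ []          []         _ = λ ()
⊑⇒⊆ (false ∷ A) (b ∷ B)    p = out⊆ (⊑⇒⊆ A B p)
⊑⇒⊆ (true  ∷ A) (true ∷ B) p = s⊆s (⊑⇒⊆ A B p)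

⊆⇒⊑ : ∀ {n} (A B : Subset n) → A ⊆ B → (A ⊑ B) ≡ true
⊆⇒⊑ []          []          _   = refl
⊆⇒⊑ (false ∷ A) (b ∷ B)     A⊆B = ⊆⇒⊑ A B (drop-∷-⊆ A⊆B)
⊆⇒⊑ (true  ∷ A) (true  ∷ B) A⊆B = ⊆⇒⊑ A B (drop-∷-⊆ A⊆B)
⊆⇒⊑ (true  ∷ A) (false ∷ B) A⊆B with A⊆B here
... | ()

==⇒≡ : ∀ {n} (A B : Subset n) → (A == B) ≡ true → A ≡ B
==⇒≡ []          []          _ = refl
==⇒≡ (true  ∷ A) (true  ∷ B) p = cong (true ∷_) (==⇒≡ A B p)
==⇒≡ (false ∷ A) (false ∷ B) p = cong (false ∷_) (==⇒≡ A B p)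

==-refl : ∀ {n} (A : Subset n) → (A == A) ≡ true
==-refl []          = refl
==-refl (true  ∷ A) = ==-refl A
==-refl (false ∷ A) = ==-refl A

⊑-sameSize⇒≡ : ∀ {n} (A B : Subset n) → (A ⊑ B) ≡ true → ∣ A ∣ ≡ ∣ B ∣ → A ≡ B
⊑-sameSize⇒≡ A B A⊑B e = ==⇒≡ A B (1⇒true (trans (sym (⊑∧sameSize A B))
  (cong₂ (λ b d → ⟦ b ⟧ * isZero d) A⊑B (trans (cong (_∸ ∣ A ∣) (sym e)) (n∸n≡0 ∣ A ∣)))))
  where
  1⇒true : ∀ {b} → ⟦ b ⟧ ≡ 1 → b ≡ true
  1⇒true {true} _ = refl

⊑-≢⇒smaller : ∀ {n} (A B : Subset n) → (A ⊑ B) ≡ true → A ≢ B → ∣ A ∣ < ∣ B ∣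
⊑-≢⇒smaller A B A⊑B A≢B = ≤∧≢⇒< (⊑-size A B A⊑B) (A≢B ∘ ⊑-sameSize⇒≡ A B A⊑B)

∑-==≡1 : ∀ {n} (S : Subset n) → ∑ (λ A → ⟦ A == S ⟧) ≡ 1
∑-==≡1 S = trans (∑-cong (λ A → sym (*-identityʳ ⟦ A == S ⟧))) (∑-point S (λ _ → 1))

Distinct : ∀ {Y : Set} → ℕ → (Y → Set) → Set
Distinct {Y} k Q = Σ (List Y) λ L → (length L ≡ k) × Unique L × All Q L

-- As y determines S, lists belonging to different S are disjoint, and concatenating them keeps the
-- entries distinct.
collect : ∀ {n} {Y : Set} (R : Subset n → Y → Set) → (∀ {S S′ y} → R S y → R S′ y → S ≡ S′) →
  ∀ {c : Subset n → ℕ} → (∀ S → Distinct (c S) (R S)) → Distinct (∑ c) (λ y → ∃ λ S → R S y)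
collect {zero}  R det lists with lists []
... | L , len , uniq , all = L , len , uniq , All.map ([] ,_) all
collect {suc n} R det lists
  with collect (R ∘ (true ∷_)) (λ r r′ → drop-head (det r r′)) (lists ∘ (true ∷_))
     | collect (R ∘ (false ∷_)) (λ r r′ → drop-head (det r r′)) (lists ∘ (false ∷_))
  where
  drop-head : ∀ {b} {S S′ : Subset n} → b ∷ S ≡ b ∷ S′ → S ≡ S′
  drop-head refl = refl
... | L₁ , len₁ , uniq₁ , all₁ | L₂ , len₂ , uniq₂ , all₂ =
  L₁ ++ L₂ , trans (length-++ L₁) (cong₂ _+_ len₁ len₂) ,
  Unique.++⁺ uniq₁ uniq₂ (λ { (y∈L₁ , y∈L₂) → clash (All.lookup all₁ y∈L₁) (All.lookup all₂ y∈L₂) }) ,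
  All.++⁺ (All.map (λ { (S , r) → true ∷ S , r }) all₁) (All.map (λ { (S , r) → false ∷ S , r }) all₂)
  where
  clash : ∀ {y} → (∃ λ S → R (true ∷ S) y) → (∃ λ S → R (false ∷ S) y) → ⊥₀
  clash (_ , r) (_ , r′) with det r r′
  ... | ()

members : ∀ {n} (p : Subset n → Bool) → Distinct (∑ (λ S → ⟦ p S ⟧)) (λ S → p S ≡ true)
members p with collect (λ S T → S ≡ T × p T ≡ true) (λ { (e , _) (e′ , _) → trans e (sym e′) }) single
  where
  single : ∀ S → Distinct ⟦ p S ⟧ (λ T → S ≡ T × p T ≡ true)
  single S with p S in e
  ... | true  = S ∷ [] , refl , [] ∷ [] , (refl , e) ∷ []
  ... | false = [] , refl , [] , []
... | L , len , uniq , all = L , len , uniq , All.map (proj₂ ∘ proj₂) all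

lookup-injective : ∀ {Y : Set} {L : List Y} → Unique L → ∀ i j → lookup L i ≡ lookup L j → i ≡ j
lookup-injective (x∉L ∷ uniq) Fin.zero    Fin.zero    e = refl
lookup-injective (x∉L ∷ uniq) Fin.zero    (Fin.suc j) e = contradiction e (All.lookup x∉L (∈-lookup j))
lookup-injective (x∉L ∷ uniq) (Fin.suc i) Fin.zero    e = contradiction (sym e) (All.lookup x∉L (∈-lookup i))
lookup-injective (x∉L ∷ uniq) (Fin.suc i) (Fin.suc j) e = cong Fin.suc (lookup-injective uniq i j e)

choose : ∀ {n} (p : Subset n → Bool) s → s ≤ ∑ (λ S → ⟦ p S ⟧) →
  Σ (Fin s → Subset n) λ e → Injective _≡_ _≡_ e × (∀ i → p (e i) ≡ true)
choose p s s≤ with members p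
... | L , len , uniq , all =
  (λ i → lookup L (Fin.inject≤ i s≤len)) ,
  (λ {i} {j} e → inject≤-injective s≤len s≤len i j (lookup-injective uniq _ _ e)) ,
  (λ i → All.lookup all (∈-lookup (Fin.inject≤ i s≤len)))
  where
  s≤len : s ≤ length L
  s≤len = ≤-trans s≤ (≤-reflexive (sym len))

comprehension : ∀ {N} {Q : Fin N → Set} → (∀ j → Dec (Q j)) → Σ (Subset N) λ G → ∀ j → (j ∈ G) ⇔ Q j
comprehension {zero}  Q? = [] , λ ()
comprehension {suc N} Q? with comprehension (Q? ∘ Fin.suc) | Q? Fin.zero
... | G , G⇔ | yes q = true ∷ G , λ
  { Fin.zero    → mk⇔ (λ _ → q) (λ _ → here)
  ; (Fin.suc j) → mk⇔ (λ { (there j∈G) → Equivalence.to (G⇔ j) j∈G }) (there ∘ Equivalence.from (G⇔ j)) }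
... | G , G⇔ | no ¬q = false ∷ G , λ
  { Fin.zero    → mk⇔ (λ ()) (λ q → contradiction q ¬q)
  ; (Fin.suc j) → mk⇔ (λ { (there j∈G) → Equivalence.to (G⇔ j) j∈G }) (there ∘ Equivalence.from (G⇔ j)) }

Ends : ∀ {n N} → (Fin N → Subset n) → Subset N → Subset n → Subset n → Set
Ends F G A B = (∃ λ a → a ∈ G × F a ≡ A) × (∃ λ b → b ∈ G × F b ≡ B) × (∀ j → j ∈ G → A ⊆ F j × F j ⊆ B)

Ends-unique : ∀ {n N} (F : Fin N → Subset n) G {A B A′ B′} → Ends F G A B → Ends F G A′ B′ → A ≡ A′ × B ≡ B′
Ends-unique F G ((a , a∈ , refl) , (b , b∈ , refl) , between) ((a′ , a′∈ , refl) , (b′ , b′∈ , refl) , between′) =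
  ⊆-antisym (proj₁ (between a′ a′∈)) (proj₁ (between′ a a∈)) , ⊆-antisym (proj₂ (between′ b b∈)) (proj₂ (between b′ b′∈))

-- The strict size conditions serve twice: they separate the ends from the middle elements, and they
-- exclude the reverse inclusions in the induced case.
module Diamond {n N s} (F : Fin N → Subset n) (a b : Fin N) (g : Fin s → Fin N) (g-inj : Injective _≡_ _≡_ g)
  (a⊆b : F a ⊆ F b) (a⊆g : ∀ i → F a ⊆ F (g i)) (g⊆b : ∀ i → F (g i) ⊆ F b)
  (a<b : ∣ F a ∣ < ∣ F b ∣) (a<g : ∀ i → ∣ F a ∣ < ∣ F (g i) ∣) (g<b : ∀ i → ∣ F (g i) ∣ < ∣ F b ∣) where

  f : DElem s → Fin N
  f bot     = a
  f (mid i) = g i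
  f top     = b

  f-injective : Injective _≡_ _≡_ f
  f-injective {bot}   {bot}   e = refl
  f-injective {bot}   {mid i} e = contradiction (cong (∣_∣ ∘ F) e) (<⇒≢ (a<g i))
  f-injective {bot}   {top}   e = contradiction (cong (∣_∣ ∘ F) e) (<⇒≢ a<b)
  f-injective {mid i} {bot}   e = contradiction (cong (∣_∣ ∘ F) (sym e)) (<⇒≢ (a<g i))
  f-injective {mid i} {mid j} e = cong mid (g-inj e)
  f-injective {mid i} {top}   e = contradiction (cong (∣_∣ ∘ F) e) (<⇒≢ (g<b i))
  f-injective {top}   {bot}   e = contradiction (cong (∣_∣ ∘ F) (sym e)) (<⇒≢ a<b)
  f-injective {top}   {mid i} e = contradiction (cong (∣_∣ ∘ F) (sym e)) (<⇒≢ (g<b i))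
  f-injective {top}   {top}   e = refl

  above-a : ∀ p → F a ⊆ F (f p)
  above-a bot     = ⊆-refl
  above-a (mid i) = a⊆g i
  above-a top     = a⊆b

  below-b : ∀ p → F (f p) ⊆ F b
  below-b bot     = a⊆b
  below-b (mid i) = g⊆b i
  below-b top     = ⊆-refl

  monotone : ∀ p q → p ≤D q → F (f p) ⊆ F (f q)
  monotone bot     q       bot≤    = above-a q
  monotone p       top     ≤top    = below-b p
  monotone (mid i) (mid i) mid≤mid = ⊆-refl

  in-image? : ∀ j → Dec (∃ λ p → f p ≡ j)
  in-image? j with a Fin.≟ j | any? (λ i → g i Fin.≟ j) | b Fin.≟ j
  ... | yes e | _           | _     = yes (bot , e)
  ... | no _  | yes (i , e) | _     = yes (mid i , e)
  ... | no _  | no _        | yes e = yes (top , e)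
  ... | no ¬a | no ¬g       | no ¬b = no λ
    { (bot , e) → ¬a e ; (mid i , e) → ¬g (i , e) ; (top , e) → ¬b e }

  image : Subset N
  image = proj₁ (comprehension in-image?)

  image⇔ : ∀ j → (j ∈ image) ⇔ ∃ (λ p → f p ≡ j)
  image⇔ = proj₂ (comprehension in-image?)

  ends : Ends F image (F a) (F b)
  ends = (a , Equivalence.from (image⇔ a) (bot , refl) , refl) , (b , Equivalence.from (image⇔ b) (top , refl) , refl) ,
    λ j j∈ → between j (Equivalence.to (image⇔ j) j∈)
    where
    between : ∀ j → (∃ λ p → f p ≡ j) → F a ⊆ F j × F j ⊆ F b
    between .(f p) (p , refl) = above-a p , below-b p

  copy : IsCopy s F image
  copy = f , f-injective , image⇔ , monotone

  module _ (antichain : ∀ i j → F (g i) ⊆ F (g j) → i ≡ j) where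

    reflecting : ∀ p q → F (f p) ⊆ F (f q) → p ≤D q
    reflecting bot     q       _ = bot≤
    reflecting (mid i) bot     h = contradiction (p⊆q⇒∣p∣≤∣q∣ h) (<⇒≱ (a<g i))
    reflecting (mid i) (mid j) h with antichain i j h
    ... | refl = mid≤mid
    reflecting (mid i) top     _ = ≤top
    reflecting top     bot     h = contradiction (p⊆q⇒∣p∣≤∣q∣ h) (<⇒≱ a<b)
    reflecting top     (mid i) h = contradiction (p⊆q⇒∣p∣≤∣q∣ h) (<⇒≱ (g<b i))
    reflecting top     top     _ = ≤top

    inducedCopy : IsInducedCopy s F image
    inducedCopy = f , f-injective , image⇔ , λ p q → mk⇔ (monotone p q) (reflecting p q)

∧⁻ : ∀ {a b} → a ∧ b ≡ true → a ≡ true × b ≡ true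
∧⁻ {true} {true} _ = refl , refl

record StrictlyBetween {n} (χ : Subset n → Bool) (A B S : Subset n) : Set where
  field
    member : χ S ≡ true
    above  : (A ⊑ S) ≡ true
    below  : (S ⊑ B) ≡ true
    larger : ∣ A ∣ < ∣ S ∣
    smaller : ∣ S ∣ < ∣ B ∣

-- χ is kept abstract so that it can be F without its thin levels; `index` leads from its members
-- back to positions in F.
module Local {n N} (F : Fin N → Subset n) (χ : Subset n → Bool) (index : ∀ S → χ S ≡ true → ∃ λ j → F j ≡ S) where

  copies : ∀ {s} A B → 1 ≤ s → χ A ≡ true → χ B ≡ true → (A ⊑ B) ≡ true →
    (e : Fin s → Subset n) → Injective _≡_ _≡_ e → (∀ i → StrictlyBetween χ A B (e i)) →
    Σ (Subset N) λ G → IsCopy s F G × Ends F G A B × ((∀ i j → e i ⊆ e j → i ≡ j) → IsInducedCopy s F G)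
  copies {suc s} A B _ A∈χ B∈χ A⊑B e e-inj between with index A A∈χ | index B B∈χ
  ... | a , refl | b , refl = image , copy , ends , λ antichain →
    inducedCopy (λ i j h → antichain i j (subst₂ _⊆_ (Fg≡e i) (Fg≡e j) h))
    where
    g : Fin (suc s) → Fin N
    g i = proj₁ (index (e i) (StrictlyBetween.member (between i)))
    Fg≡e : ∀ i → F (g i) ≡ e i
    Fg≡e i = proj₂ (index (e i) (StrictlyBetween.member (between i)))
    open Diamond F a b g
      (λ {i} {j} gi≡gj → e-inj (trans (sym (Fg≡e i)) (trans (cong F gi≡gj) (Fg≡e j))))
      (⊑⇒⊆ A B A⊑B)
      (λ i → subst (F a ⊆_) (sym (Fg≡e i)) (⊑⇒⊆ A (e i) (StrictlyBetween.above (between i))))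
      (λ i → subst (_⊆ F b) (sym (Fg≡e i)) (⊑⇒⊆ (e i) B (StrictlyBetween.below (between i))))
      (<-trans (StrictlyBetween.larger (between Fin.zero)) (StrictlyBetween.smaller (between Fin.zero)))
      (λ i → subst (λ S → ∣ F a ∣ < ∣ S ∣) (sym (Fg≡e i)) (StrictlyBetween.larger (between i)))
      (λ i → subst (λ S → ∣ S ∣ < ∣ F b ∣) (sym (Fg≡e i)) (StrictlyBetween.smaller (between i)))

  LocalDichotomy : ℕ → (Subset N → Set) → Set
  LocalDichotomy m Copy = ∀ A B → χ A ≡ true → χ B ≡ true → (A ⊑ B) ≡ true →
    (Σ (Subset N) λ G → Copy G × Ends F G A B) ⊎ (lubell χ A B ≤ m * (∣ B ∣ ∸ ∣ A ∣) !)

  -- Each of the k + 1 levels contributes at most 1 to the normalised sum, so k < m settles the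
  -- matter without any copy.
  short-interval : ∀ m A B → (A ⊑ B) ≡ true → ¬ m ≤ ∣ B ∣ ∸ ∣ A ∣ → lubell χ A B ≤ m * (∣ B ∣ ∸ ∣ A ∣) !
  short-interval m A B A⊑B m≰k = ≤-trans (lubell≤[1+k]k! χ A B A⊑B) (*-monoˡ-≤ _ (≰⇒> m≰k))

  interior : Subset n → Subset n → Subset n → Bool
  interior A B S = χ S ∧ ((A ⊑ S) ∧ ((S ⊑ B) ∧ (not (S == A) ∧ not (S == B))))

  interior⇒between : ∀ A B S → interior A B S ≡ true → StrictlyBetween χ A B S
  interior⇒between A B S p with ∧⁻ p
  ... | S∈χ , p₁ with ∧⁻ p₁
  ... | A⊑S , p₂ with ∧⁻ p₂
  ... | S⊑B , p₃ with ∧⁻ {not (S == A)} {not (S == B)} p₃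
  ... | S≠A , S≠B = record
    { member  = S∈χ
    ; above   = A⊑S
    ; below   = S⊑B
    ; larger  = ⊑-≢⇒smaller A S A⊑S λ { refl → contra (==-refl A) S≠A }
    ; smaller = ⊑-≢⇒smaller S B S⊑B λ { refl → contra (==-refl S) S≠B }
    }
    where
    contra : ∀ {b} → b ≡ true → not b ≡ true → ⊥₀
    contra refl ()

  intervalCount≤interior+2 : ∀ A B → intervalCount χ A B ≤ ∑ (λ S → ⟦ interior A B S ⟧) + 2
  intervalCount≤interior+2 A B = begin
    intervalCount χ A B
      ≤⟨ ∑-mono (λ S → pointwise (χ S) (A ⊑ S) (S ⊑ B) (S == A) (S == B)) ⟩
    ∑ (λ S → ⟦ interior A B S ⟧ + (⟦ S == A ⟧ + ⟦ S == B ⟧))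
      ≡⟨ trans (∑-+ (λ S → ⟦ interior A B S ⟧) (λ S → ⟦ S == A ⟧ + ⟦ S == B ⟧)) (cong (∑ (λ S → ⟦ interior A B S ⟧) +_) (∑-+ (λ S → ⟦ S == A ⟧) (λ S → ⟦ S == B ⟧))) ⟩
    ∑ (λ S → ⟦ interior A B S ⟧) + (∑ (λ S → ⟦ S == A ⟧) + ∑ (λ S → ⟦ S == B ⟧))
      ≡⟨ cong (∑ (λ S → ⟦ interior A B S ⟧) +_) (cong₂ _+_ (∑-==≡1 A) (∑-==≡1 B)) ⟩
    ∑ (λ S → ⟦ interior A B S ⟧) + 2 ∎
    where
    open ≤-Reasoning
    pointwise : ∀ c p q x y → ⟦ c ⟧ * (⟦ p ⟧ * ⟦ q ⟧) ≤ ⟦ c ∧ (p ∧ (q ∧ (not x ∧ not y))) ⟧ + (⟦ x ⟧ + ⟦ y ⟧)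
    pointwise false p     q     x     y     = z≤n
    pointwise true  false q     x     y     = z≤n
    pointwise true  true  false x     y     = z≤n
    pointwise true  true  true  true  y     = s≤s z≤n
    pointwise true  true  true  false true  = s≤s z≤n
    pointwise true  true  true  false false = s≤s z≤n

  copy-dichotomy : ∀ m s → 1 ≤ s → s + centralBinom m + 1 ≤ 2 ^ m → LocalDichotomy m (IsCopy s F)
  copy-dichotomy m s 1≤s s+t<2^m A B A∈χ B∈χ A⊑B with m ≤? ∣ B ∣ ∸ ∣ A ∣ | s ≤? ∑ (λ S → ⟦ interior A B S ⟧)
  ... | no m≰k  | _ = inj₂ (short-interval m A B A⊑B m≰k)
  ... | yes m≤k | no s≰ = inj₂ (few⇒lubell≤m χ A B m s A⊑B m≤k s+t<2^m
    (≤-trans (intervalCount≤interior+2 A B) (≤-trans (≤-reflexive (+-comm _ 2)) (s≤s (≰⇒> s≰)))))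
  ... | yes _   | yes s≤ with choose (interior A B) s s≤
  ... | e , e-inj , inside with copies A B 1≤s A∈χ B∈χ A⊑B e e-inj (λ i → interior⇒between A B (e i) (inside i))
  ... | G , isCopy , ends , _ = inj₁ (G , isCopy , ends)

  onLevel : Subset n → Subset n → ℕ → Subset n → Bool
  onLevel A B i S = χ S ∧ ((A ⊑ S) ∧ (S ⊑ B) ∧ (∣ S ∣ ≡ᵇ ∣ A ∣ + i))

  level≡∑onLevel : ∀ A B i → level χ A B i ≡ ∑ (λ S → ⟦ onLevel A B i S ⟧)
  level≡∑onLevel A B i = ∑-cong λ S → sym (trans (guard-∧ (χ S) _) (cong (⟦ χ S ⟧ *_)
    (trans (guard-∧ (A ⊑ S) _) (trans (cong (⟦ A ⊑ S ⟧ *_) (guard-∧ (S ⊑ B) _)) (sym (*-assoc ⟦ A ⊑ S ⟧ ⟦ S ⊑ B ⟧ _))))))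

  -- Sets of equal size form an antichain, so s of them on one inner level give an induced copy.
  -- Otherwise every level has width at most s - 1 and the capped sum applies.
  inducedCopy-dichotomy : ∀ m s → 2 ≤ s → (∀ {k} → m ≤ k → cappedSum (s ∸ 1) k ≤ m * k !) → LocalDichotomy m (IsInducedCopy s F)
  inducedCopy-dichotomy m s@(suc w) (s≤s 1≤w) capped A B A∈χ B∈χ A⊑B
    with m ≤? ∣ B ∣ ∸ ∣ A ∣ | anyUpTo? (λ i → (1 ≤? i) ×-dec (s ≤? level χ A B i)) (∣ B ∣ ∸ ∣ A ∣)
  ... | no m≰k  | _ = inj₂ (short-interval m A B A⊑B m≰k)
  ... | yes m≤k | no none = inj₂ (≤-trans (lubell≤cappedSum χ A B w A⊑B thin-level) (capped m≤k))
    where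
    k = ∣ B ∣ ∸ ∣ A ∣
    thin-level : ∀ i → i ≤ k → level χ A B i ≤ w
    -- The extreme levels i = 0 and i = k hold at most one set, and 1 ≤ s - 1.
    thin-level zero    _   = ≤-trans (level≤C χ A B 0 A⊑B) (≤-trans (≤-reflexive (nC0≡1 k)) 1≤w)
    thin-level (suc i) i<k with m≤n⇒m<n∨m≡n i<k
    ... | inj₁ 1+i<k = s≤s⁻¹ (≰⇒> λ s≤ → none (suc i , 1+i<k , s≤s z≤n , s≤))
    ... | inj₂ e     = ≤-trans (level≤C χ A B (suc i) A⊑B) (≤-trans (≤-reflexive (trans (cong (k C_) e) (nCn≡1 k))) 1≤w)
  ... | yes _   | yes (i , i<k , 1≤i , s≤) with choose (onLevel A B i) s (≤-trans s≤ (≤-reflexive (level≡∑onLevel A B i)))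
  ... | e , e-inj , inside = found
    where
    k = ∣ B ∣ ∸ ∣ A ∣
    size : ∀ j → ∣ e j ∣ ≡ ∣ A ∣ + i
    size j = ≡ᵇ⇒≡ _ _ (subst T (sym (proj₂ (∧⁻ {e j ⊑ B} (proj₂ (∧⁻ {A ⊑ e j} (proj₂ (∧⁻ {χ (e j)} (inside j)))))))) _)
    between : ∀ j → StrictlyBetween χ A B (e j)
    between j = record
      { member  = proj₁ (∧⁻ (inside j))
      ; above   = proj₁ (∧⁻ (proj₂ (∧⁻ {χ (e j)} (inside j))))
      ; below   = proj₁ (∧⁻ (proj₂ (∧⁻ {A ⊑ e j} (proj₂ (∧⁻ {χ (e j)} (inside j))))))
      ; larger  = ≤-trans (≤-trans (≤-reflexive (+-comm 1 ∣ A ∣)) (+-monoʳ-≤ ∣ A ∣ 1≤i)) (≤-reflexive (sym (size j)))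
      ; smaller = ≤-trans (≤-reflexive (cong suc (size j))) (≤-trans (≤-reflexive (sym (+-suc ∣ A ∣ i)))
                    (≤-trans (+-monoʳ-≤ ∣ A ∣ i<k) (≤-reflexive (m+[n∸m]≡n (⊑-size A B A⊑B)))))
      }
    found : (Σ (Subset N) λ G → IsInducedCopy s F G × Ends F G A B) ⊎ (lubell χ A B ≤ m * (∣ B ∣ ∸ ∣ A ∣) !)
    found with copies A B (s≤s z≤n) A∈χ B∈χ A⊑B e e-inj between
    ... | G , _ , ends , induced = inj₁ (G , induced (λ x y h → e-inj
      (⊑-sameSize⇒≡ (e x) (e y) (⊆⇒⊑ (e x) (e y) h) (trans (size x) (sym (size y))))) , ends)

-- Counting good pairs

contains : ∀ {n N} → (Fin N → Subset n) → Subset n → Bool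
contains F S = does (any? λ j → (F j == S) Bool.≟ true)

contains⇒index : ∀ {n N} (F : Fin N → Subset n) S → contains F S ≡ true → ∃ λ j → F j ≡ S
contains⇒index F S p with any? (λ j → (F j == S) Bool.≟ true)
... | yes (j , e) = j , ==⇒≡ (F j) S e

index⇒contains : ∀ {n N} (F : Fin N → Subset n) j → contains F (F j) ≡ true
index⇒contains F j with any? (λ i → (F i == F j) Bool.≟ true)
... | yes _ = refl
... | no ¬p = contradiction (j , ==-refl (F j)) ¬p

N≤∑contains : ∀ {n N} (F : Fin N → Subset n) → Injective _≡_ _≡_ F → N ≤ ∑ (λ S → ⟦ contains F S ⟧)
N≤∑contains {N = zero}  F F-inj = z≤n
N≤∑contains {N = suc N} F F-inj = begin
  1 + N                                                       ≤⟨ +-mono-≤ (≤-reflexive (sym (∑-==≡1 (F Fin.zero)))) (N≤∑contains (F ∘ Fin.suc) (λ e → Fin.suc-injective (F-inj e))) ⟩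
  ∑ (λ S → ⟦ S == F Fin.zero ⟧) + ∑ (λ S → ⟦ contains (F ∘ Fin.suc) S ⟧) ≡⟨ sym (∑-+ (λ S → ⟦ S == F Fin.zero ⟧) (λ S → ⟦ contains (F ∘ Fin.suc) S ⟧)) ⟩
  ∑ (λ S → ⟦ S == F Fin.zero ⟧ + ⟦ contains (F ∘ Fin.suc) S ⟧) ≤⟨ ∑-mono pointwise ⟩
  ∑ (λ S → ⟦ contains F S ⟧)                                  ∎
  where
  open ≤-Reasoning
  disjoint-cover : ∀ x y c → (x ≡ true → c ≡ true) → (y ≡ true → c ≡ true) → (x ≡ true → y ≡ true → ⊥₀) → ⟦ x ⟧ + ⟦ y ⟧ ≤ ⟦ c ⟧
  disjoint-cover false false c     _  _  _  = z≤n
  disjoint-cover true  true  c     _  _  xy = contradiction refl (xy refl)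
  disjoint-cover true  false true  _  _  _  = ≤-refl
  disjoint-cover false true  true  _  _  _  = ≤-refl
  disjoint-cover true  false false x⇒ _  _  = contradiction (x⇒ refl) λ ()
  disjoint-cover false true  false _  y⇒ _  = contradiction (y⇒ refl) λ ()
  pointwise : ∀ S → ⟦ S == F Fin.zero ⟧ + ⟦ contains (F ∘ Fin.suc) S ⟧ ≤ ⟦ contains F S ⟧
  pointwise S = disjoint-cover (S == F Fin.zero) (contains (F ∘ Fin.suc) S) (contains F S) first later apart
    where
    first : (S == F Fin.zero) ≡ true → contains F S ≡ true
    first e = trans (cong (contains F) (==⇒≡ S (F Fin.zero) e)) (index⇒contains F Fin.zero)
    later : contains (F ∘ Fin.suc) S ≡ true → contains F S ≡ true
    later p with contains⇒index (F ∘ Fin.suc) S p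
    ... | j , refl = index⇒contains F (Fin.suc j)
    apart : (S == F Fin.zero) ≡ true → contains (F ∘ Fin.suc) S ≡ true → ⊥₀
    apart e p with contains⇒index (F ∘ Fin.suc) S p | ==⇒≡ S (F Fin.zero) e
    ... | j , e₁ | e₂ with F-inj (trans e₁ e₂)
    ...   | ()

-- The sum of a √X ≤ b √Y and c √X ≤ d √Y in squared form; the mixed term is compared through its
-- own square, the product of the two assumptions.
+-square-bound : ∀ {X Y a b c d} → a * a * X ≤ b * b * Y → c * c * X ≤ d * d * Y →
  (a + c) * (a + c) * X ≤ (b + d) * (b + d) * Y
+-square-bound {X} {Y} {a} {b} {c} {d} p q = begin
  (a + c) * (a + c) * X                                ≡⟨ expand a c X ⟩
  a * a * X + c * c * X + 2 * (a * c * X)              ≤⟨ +-mono-≤ (+-mono-≤ p q) (*-monoʳ-≤ 2 cross) ⟩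
  b * b * Y + d * d * Y + 2 * (b * d * Y)              ≡⟨ sym (expand b d Y) ⟩
  (b + d) * (b + d) * Y                                ∎
  where
  open ≤-Reasoning
  expand : ∀ a c X → (a + c) * (a + c) * X ≡ a * a * X + c * c * X + 2 * (a * c * X)
  expand = solve-∀
  square : ∀ a c X → (a * c * X) * (a * c * X) ≡ (a * a * X) * (c * c * X)
  square = solve-∀
  cross : a * c * X ≤ b * d * Y
  cross = square-cancel-≤ (≤-trans (≤-reflexive (square a c X)) (≤-trans (*-mono-≤ p q) (≤-reflexive (sym (square b d Y)))))

n^[2m∸1]*n : ∀ n m → 1 ≤ m → n ^ (2 * m ∸ 1) * n ≡ n ^ m * n ^ m
n^[2m∸1]*n n m 1≤m = begin
  n ^ (2 * m ∸ 1) * n      ≡⟨ *-comm _ n ⟩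
  n ^ suc (2 * m ∸ 1)      ≡⟨ cong (n ^_) (m+[n∸m]≡n {1} {2 * m} (≤-trans 1≤m (m≤m+n m _))) ⟩
  n ^ (2 * m)              ≡⟨ cong (λ x → n ^ (m + x)) (+-identityʳ m) ⟩
  n ^ (m + m)              ≡⟨ ^-distribˡ-+-* n m m ⟩
  n ^ m * n ^ m            ∎
  where open ≡-Reasoning

-- One good pair with ends of sizes a and a + k carries at most a 1 / (n ^ (m - 1/2) * central n) share of the chains.
pair-weight : ∀ Q n m a k → 1 ≤ n → 1 ≤ m → a + k ≤ n → thin Q n a ≡ false → thin Q n (a + k) ≡ false →
  let z = (suc k ∸ m) * (k ! * (a ! * (n ∸ (a + k)) !)); Y = n ! * growthConstant Q m * Q in
  z * z * (n ^ (2 * m ∸ 1) * (centralBinom n * centralBinom n)) ≤ Y * Y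
pair-weight Q n m a k 1≤n 1≤m b≤n thick-a thick-b = *-cancelʳ-≤ _ _ n {{>-nonZero 1≤n}} (begin
  z * z * (n ^ (2 * m ∸ 1) * (B * B)) * n          ≡⟨ rearrange₁ z (n ^ (2 * m ∸ 1)) (B * B) n ⟩
  z * z * (n ^ (2 * m ∸ 1) * n) * (B * B)          ≡⟨ cong (λ x → z * z * x * (B * B)) (n^[2m∸1]*n n m 1≤m) ⟩
  z * z * (n ^ m * n ^ m) * (B * B)                ≤⟨ *-monoʳ-≤ (z * z * (n ^ m * n ^ m)) (≮⇒≥ λ lt → subst T thick-b (<⇒<ᵇ lt)) ⟩
  z * z * (n ^ m * n ^ m) * (Q * Q * n * (c * c))  ≡⟨ rearrange₂ z (n ^ m) Q n c ⟩
  (z * c * n ^ m) * (z * c * n ^ m) * (Q * Q * n)  ≤⟨ *-monoˡ-≤ (Q * Q * n) (*-mono-≤ zcn^m≤ zcn^m≤) ⟩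
  (n ! * K) * (n ! * K) * (Q * Q * n)              ≡⟨ rearrange₃ (n ! * K) Q n ⟩
  n ! * K * Q * (n ! * K * Q) * n                  ∎)
  where
  open ≤-Reasoning
  B = centralBinom n
  K = growthConstant Q m
  b = a + k
  c = n C b
  c′ = b C k
  e = suc k ∸ m
  z = e * (k ! * (a ! * (n ∸ b) !))
  rearrange₁ : ∀ z p b n → z * z * (p * b) * n ≡ z * z * (p * n) * b
  rearrange₁ = solve-∀
  rearrange₂ : ∀ z p q n c → z * z * (p * p) * (q * q * n * (c * c)) ≡ (z * c * p) * (z * c * p) * (q * q * n)
  rearrange₂ = solve-∀
  rearrange₃ : ∀ y q n → y * y * (q * q * n) ≡ y * q * (y * q) * n
  rearrange₃ = solve-∀
  rearrange₄ : ∀ e k a d c p c′ → e * (k * (a * d)) * c * p * c′ ≡ c * (c′ * (k * a) * d) * (p * e)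
  rearrange₄ = solve-∀
  b! : c′ * (k ! * a !) ≡ b !
  b! = subst (λ x → (x C k) * (k ! * a !) ≡ x !) (+-comm k a) (nCk*k!*j!≡n! k a)
  zcn^m≤ : z * c * n ^ m ≤ n ! * K
  zcn^m≤ = *-cancelʳ-≤ _ _ c′ {{>-nonZero (k≤n⇒1≤nCk (m≤n+m k a))}} (begin
    z * c * n ^ m * c′                                   ≡⟨ rearrange₄ e (k !) (a !) ((n ∸ b) !) c (n ^ m) c′ ⟩
    c * (c′ * (k ! * a !) * (n ∸ b) !) * (n ^ m * e)     ≡⟨ cong (λ x → c * (x * (n ∸ b) !) * (n ^ m * e)) b! ⟩
    c * (b ! * (n ∸ b) !) * (n ^ m * e)                  ≡⟨ cong (_* (n ^ m * e)) (nCi*i!*[n∸i]!≡n! b≤n) ⟩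
    n ! * (n ^ m * e)                                    ≤⟨ *-monoʳ-≤ (n !) (thick-growth Q n m a k thick-a b≤n) ⟩
    n ! * (K * c′)                                       ≡⟨ sym (*-assoc (n !) K c′) ⟩
    n ! * K * c′                                         ∎)

-- Here 1 / (2 e) is the surplus left after thinning, and the other factor is the constant of
-- `pair-weight` without n !.
supersatConstant : ℕ → ℕ → ℕ
supersatConstant e m = 2 * e * (growthConstant (8 * e) m * (8 * e))

module Count {n N} (F : Fin N → Subset n) (F-inj : Injective _≡_ _≡_ F) (e m : ℕ) (1≤n : 1 ≤ n) (1≤m : 1 ≤ m) where

  B Q : ℕ
  B = centralBinom n
  -- Thin levels then hold at most 4 B / Q = B / (2 e) sets, half of the surplus B / e of the
  -- family.
  Q = 8 * e

  χ : Subset n → Bool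
  χ S = contains F S ∧ not (thin Q n ∣ S ∣)

  χ⇒index : ∀ S → χ S ≡ true → ∃ λ j → F j ≡ S
  χ⇒index S p = contains⇒index F S (proj₁ (∧⁻ p))

  χ⇒thick : ∀ S → χ S ≡ true → thin Q n ∣ S ∣ ≡ false
  χ⇒thick S p with thin Q n ∣ S ∣ | proj₂ (∧⁻ {contains F S} p)
  ... | false | _ = refl

  kept : (m * e + 1) * B ≤ N * e → (2 * (m * e) + 1) * B ≤ 2 * e * ∑ (λ S → ⟦ χ S ⟧)
  kept many = +-cancelʳ-≤ B _ _ (begin
    (2 * (m * e) + 1) * B + B                        ≡⟨ double (m * e) B ⟩
    2 * ((m * e + 1) * B)                            ≤⟨ *-monoʳ-≤ 2 many ⟩
    2 * (N * e)                                      ≤⟨ *-monoʳ-≤ 2 (*-monoˡ-≤ e N≤) ⟩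
    2 * ((M + R) * e)                                ≡⟨ distribute M R e ⟩
    2 * e * M + 2 * e * R                            ≤⟨ +-monoʳ-≤ (2 * e * M) 2eR≤B ⟩
    2 * e * M + B                                    ∎)
    where
    open ≤-Reasoning
    M = ∑ (λ S → ⟦ χ S ⟧)
    R = ∑ {n} (λ S → ⟦ thin Q n ∣ S ∣ ⟧)
    double : ∀ x b → (2 * x + 1) * b + b ≡ 2 * ((x + 1) * b)
    double = solve-∀
    distribute : ∀ x y e → 2 * ((x + y) * e) ≡ 2 * e * x + 2 * e * y
    distribute = solve-∀
    pointwise : ∀ c t → ⟦ c ⟧ ≤ ⟦ c ∧ not t ⟧ + ⟦ t ⟧
    pointwise false t     = z≤n
    pointwise true  true  = ≤-refl
    pointwise true  false = ≤-refl
    N≤ : N ≤ M + R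
    N≤ = ≤-trans (N≤∑contains F F-inj) (≤-trans (∑-mono (λ S → pointwise (contains F S) (thin Q n ∣ S ∣))) (≤-reflexive (∑-+ (λ S → ⟦ χ S ⟧) (λ S → ⟦ thin Q n ∣ S ∣ ⟧))))
    4* : ∀ e r → 4 * (2 * e * r) ≡ 8 * e * r
    4* = solve-∀
    2eR≤B : 2 * e * R ≤ B
    2eR≤B = *-cancelˡ-≤ 4 (begin
      4 * (2 * e * R)                                ≡⟨ 4* e R ⟩
      Q * R                                          ≡⟨ cong (Q *_) (∑-rank n (λ i → ⟦ thin Q n i ⟧)) ⟩
      Q * binomialSum n (λ i → ⟦ thin Q n i ⟧)       ≤⟨ thin-total Q n 1≤n ⟩
      4 * B                                          ∎)

  module _ (Copy : Subset N → Set) (dichotomy : Local.LocalDichotomy F χ χ⇒index m Copy) where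

    -- The dichotomy extended to all pairs, so that `good` is a Boolean function free of membership
    -- proofs.
    decide : ∀ A B → (Σ (Subset N) λ G → Copy G × Ends F G A B)
      ⊎ (χ A ≡ true → χ B ≡ true → (A ⊑ B) ≡ true → lubell χ A B ≤ m * (∣ B ∣ ∸ ∣ A ∣) !)
    decide A B with χ A Bool.≟ true | χ B Bool.≟ true | (A ⊑ B) Bool.≟ true
    ... | no ¬p | _     | _     = inj₂ λ p → contradiction p ¬p
    ... | yes _ | no ¬q | _     = inj₂ λ _ q → contradiction q ¬q
    ... | yes _ | yes _ | no ¬r = inj₂ λ _ _ r → contradiction r ¬r
    ... | yes p | yes q | yes r with dichotomy A B p q r
    ...   | inj₁ copy = inj₁ copy
    ...   | inj₂ le   = inj₂ λ _ _ _ → le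

    good : Subset n → Subset n → Bool
    good A B with decide A B
    ... | inj₁ _ = true
    ... | inj₂ _ = false

    #good : ℕ
    #good = ∑ λ A → ∑ λ B → ⟦ good A B ⟧

    copiesAt : ∀ A B → Distinct ⟦ good A B ⟧ (λ G → Copy G × Ends F G A B)
    copiesAt A B with decide A B
    ... | inj₁ (G , copy) = G ∷ [] , refl , [] ∷ [] , copy ∷ []
    ... | inj₂ _          = [] , refl , [] , []

    copies : AtLeast #good Copy
    copies with collect (λ A G → ∃ λ B → Copy G × Ends F G A B)
        (λ { {y = G} (_ , _ , ends) (_ , _ , ends′) → proj₁ (Ends-unique F G ends ends′) })
        (λ A → collect (λ B G → Copy G × Ends F G A B)
          (λ { {y = G} (_ , ends) (_ , ends′) → proj₂ (Ends-unique F G ends ends′) })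
          (copiesAt A))
    ... | L , len , uniq , all = L , len , uniq , All.map (λ { (_ , _ , copy , _) → copy }) all

    local-bound : ∀ A B → χ A ≡ true → χ B ≡ true → (A ⊑ B) ≡ true →
      lubell χ A B ≤ (m + ⟦ good A B ⟧ * (suc (∣ B ∣ ∸ ∣ A ∣) ∸ m)) * (∣ B ∣ ∸ ∣ A ∣) !
    local-bound A B p q r with decide A B
    ... | inj₂ le = ≤-trans (le p q r) (≤-reflexive (cong (_* (∣ B ∣ ∸ ∣ A ∣) !) (sym (+-identityʳ m))))
    ... | inj₁ _  = ≤-trans (lubell≤[1+k]k! χ A B r) (*-monoˡ-≤ _
      (≤-trans (m≤n+m∸n (suc (∣ B ∣ ∸ ∣ A ∣)) m) (≤-reflexive (cong (m +_) (sym (+-identityʳ _))))))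

    totalExcess : ℕ
    totalExcess = ∑ λ A → ∑ (excess m χ good A)

    -- A set of size i lies on n ! / (n C i) ≥ n ! / B maximal chains, so a chain contains on
    -- average at least m + 1 / (2 e) kept sets; `chain-bound` accounts for m of them.
    n!≤2e*totalExcess : (m * e + 1) * B ≤ N * e → n ! ≤ 2 * e * totalExcess
    n!≤2e*totalExcess many = +-cancelˡ-≤ (2 * (m * e) * n !) _ _ (*-cancelˡ-≤ B {{>-nonZero (1≤central n)}} (begin
      B * (2 * (m * e) * n ! + n !)                     ≡⟨ rearrange₁ B (m * e) (n !) ⟩
      (2 * (m * e) + 1) * B * n !                       ≤⟨ *-monoˡ-≤ (n !) (kept many) ⟩
      2 * e * ∑ (λ S → ⟦ χ S ⟧) * n !                   ≡⟨ trans (*-assoc (2 * e) _ (n !)) (cong (2 * e *_) (sym (∑-*ʳ (λ S → ⟦ χ S ⟧) (n !)))) ⟩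
      2 * e * ∑ (λ S → ⟦ χ S ⟧ * n !)                   ≤⟨ *-monoʳ-≤ (2 * e) (∑-mono pointwise) ⟩
      2 * e * ∑ (λ S → B * (⟦ χ S ⟧ * (∣ S ∣ ! * (n ∸ ∣ S ∣) !))) ≡⟨ cong (2 * e *_) (∑-*ˡ B (λ S → ⟦ χ S ⟧ * (∣ S ∣ ! * (n ∸ ∣ S ∣) !))) ⟩
      2 * e * (B * ∑ (λ S → ⟦ χ S ⟧ * (∣ S ∣ ! * (n ∸ ∣ S ∣) !))) ≤⟨ *-monoʳ-≤ (2 * e) (*-monoʳ-≤ B (chain-bound m χ good local-bound)) ⟩
      2 * e * (B * (m * n ! + totalExcess))             ≡⟨ rearrange₂ e B m (n !) totalExcess ⟩
      B * (2 * (m * e) * n ! + 2 * e * totalExcess)     ∎))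
      where
      open ≤-Reasoning
      rearrange₁ : ∀ b x f → b * (2 * x * f + f) ≡ (2 * x + 1) * b * f
      rearrange₁ = solve-∀
      rearrange₂ : ∀ e b m f z → 2 * e * (b * (m * f + z)) ≡ b * (2 * (m * e) * f + 2 * e * z)
      rearrange₂ = solve-∀
      swap : ∀ b x w → x * (b * w) ≡ b * (x * w)
      swap = solve-∀
      pointwise : ∀ S → ⟦ χ S ⟧ * n ! ≤ B * (⟦ χ S ⟧ * (∣ S ∣ ! * (n ∸ ∣ S ∣) !))
      pointwise S = begin
        ⟦ χ S ⟧ * n !                                          ≡⟨ cong (⟦ χ S ⟧ *_) (sym (nCi*i!*[n∸i]!≡n! (∣p∣≤n S))) ⟩
        ⟦ χ S ⟧ * ((n C ∣ S ∣) * (∣ S ∣ ! * (n ∸ ∣ S ∣) !))    ≤⟨ *-monoʳ-≤ ⟦ χ S ⟧ (*-monoˡ-≤ _ (nCk≤central n ∣ S ∣)) ⟩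
        ⟦ χ S ⟧ * (B * (∣ S ∣ ! * (n ∸ ∣ S ∣) !))              ≡⟨ swap B ⟦ χ S ⟧ _ ⟩
        B * (⟦ χ S ⟧ * (∣ S ∣ ! * (n ∸ ∣ S ∣) !))              ∎

    X Y : ℕ
    X = n ^ (2 * m ∸ 1) * (B * B)
    Y = n ! * growthConstant Q m * Q

    excess-square : ∀ A D → excess m χ good A D * excess m χ good A D * X ≤ ⟦ good A D ⟧ * ⟦ good A D ⟧ * (Y * Y)
    excess-square A D = guarded (χ A) (χ D) (A ⊑ D) (good A D) weight
      where
      a = ∣ A ∣
      k = ∣ D ∣ ∸ ∣ A ∣
      pad : ∀ x → x + 0 + 0 + 0 + 0 ≡ x
      pad = solve-∀
      guarded : ∀ c d p g {z} → (c ≡ true → d ≡ true → p ≡ true → z * z * X ≤ Y * Y) →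
        let x = ⟦ c ⟧ * (⟦ d ⟧ * (⟦ p ⟧ * (⟦ g ⟧ * z))) in x * x * X ≤ ⟦ g ⟧ * ⟦ g ⟧ * (Y * Y)
      guarded false d     p     g     z²X≤ = z≤n
      guarded true  false p     g     z²X≤ = z≤n
      guarded true  true  false g     z²X≤ = z≤n
      guarded true  true  true  false z²X≤ = z≤n
      guarded true  true  true  true {z} z²X≤ = ≤-trans (≤-reflexive (cong (λ x → x * x * X) (pad z)))
        (≤-trans (z²X≤ refl refl refl) (≤-reflexive (sym (+-identityʳ (Y * Y)))))
      Weight : ℕ → Set
      Weight b = let z = (suc k ∸ m) * (k ! * (a ! * (n ∸ b) !)) in
        b ≤ n → thin Q n b ≡ false → z * z * X ≤ Y * Y
      weight : χ A ≡ true → χ D ≡ true → (A ⊑ D) ≡ true → _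
      weight p q r = subst Weight (m+[n∸m]≡n (⊑-size A D r))
        (λ b≤n thick → pair-weight Q n m a k 1≤n 1≤m b≤n (χ⇒thick A p) thick) (∣p∣≤n D) (χ⇒thick D q)

    -- Stands for totalExcess √X ≤ #good Y: the bounds for single pairs are summed over both ends in
    -- squared form.
    total-square : totalExcess * totalExcess * X ≤ #good * #good * (Y * Y)
    total-square = ∑-rel R (λ {a} {b} {c} {d} → closed {a} {b} {c} {d})
      (λ A → ∑-rel R (λ {a} {b} {c} {d} → closed {a} {b} {c} {d}) (excess-square A))
      where
      R : ℕ → ℕ → Set
      R z k = z * z * X ≤ k * k * (Y * Y)
      closed : ∀ {a b c d} → R a b → R c d → R (a + c) (b + d)
      closed {a} {b} {c} {d} = +-square-bound {X} {Y * Y} {a} {b} {c} {d}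

    many-copies : (m * e + 1) * B ≤ N * e →
      X ≤ (supersatConstant e m * #good) * (supersatConstant e m * #good)
    many-copies many = *-cancelˡ-≤ (n ! * n !) {{m*n≢0 (n !) (n !) {{n !≢0}} {{n !≢0}}}} (begin
      n ! * n ! * X                                        ≤⟨ *-monoˡ-≤ X (*-mono-≤ (n!≤2e*totalExcess many) (n!≤2e*totalExcess many)) ⟩
      2 * e * totalExcess * (2 * e * totalExcess) * X      ≡⟨ rearrange₁ (2 * e) totalExcess X ⟩
      2 * e * (2 * e) * (totalExcess * totalExcess * X)    ≤⟨ *-monoʳ-≤ (2 * e * (2 * e)) total-square ⟩
      2 * e * (2 * e) * (#good * #good * (Y * Y))          ≡⟨ rearrange₂ (2 * e) #good (n !) (growthConstant Q m) Q ⟩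
      n ! * n ! * ((supersatConstant e m * #good) * (supersatConstant e m * #good)) ∎)
      where
      open ≤-Reasoning
      rearrange₁ : ∀ e z x → e * z * (e * z) * x ≡ e * e * (z * z * x)
      rearrange₁ = solve-∀
      rearrange₂ : ∀ e g f c q → e * e * (g * g * (f * c * q * (f * c * q))) ≡ f * f * ((e * (c * q) * g) * (e * (c * q) * g))
      rearrange₂ = solve-∀

-- Passage to rational numbers


toℚᵘ-ℕ→ℚ : ∀ k → toℚᵘ (ℕ→ℚ k) ℚᵘ.≃ ℚᵘ.mkℚᵘ (pos k) 0
toℚᵘ-ℕ→ℚ k = ℚ.toℚᵘ-fromℚᵘ (ℚᵘ.mkℚᵘ (pos k) 0)

-- A positive rational with denominator d + 1 is at least 1 / (d + 1), so the surplus can be taken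
-- as 1 / e with e = d + 1.
density-hypothesis : ∀ m p d .(c : Coprime (suc p) (suc d)) B N → (ℕ→ℚ m ℚ.+ mkℚ (pos (suc p)) d c) ℚ.* ℕ→ℚ B ℚ.≤ ℕ→ℚ N →
  (m * suc d + 1) * B ≤ N * suc d
density-hypothesis m p d c B N h = begin
  (m * suc d + 1) * B                      ≤⟨ *-monoˡ-≤ B (+-monoʳ-≤ (m * suc d) (s≤s z≤n)) ⟩
  (m * suc d + suc p) * B                  ≡⟨ tidy₁ (m * suc d) p B ⟩
  (m * suc d + suc p * 1) * B * 1          ≤⟨ ℤ.drop‿+≤+ (subst₂ ℤ._≤_ lhs rhs (ℚᵘ.drop-*≤* unnormalised)) ⟩
  N * suc ((d + 0 * suc d) * 1)                      ≡⟨ tidy₂ N d ⟩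
  N * suc d                                ∎
  where
  open ≤-Reasoning
  tidy₁ : ∀ x p b → (x + suc p) * b ≡ (x + suc p * 1) * b * 1
  tidy₁ = solve-∀
  tidy₂ : ∀ n d → n * suc ((d + 0 * suc d) * 1) ≡ n * suc d
  tidy₂ = solve-∀
  ε = mkℚ (pos (suc p)) d c
  unnormalised : (ℚᵘ.mkℚᵘ (pos m) 0 ℚᵘ.+ ℚᵘ.mkℚᵘ (pos (suc p)) d) ℚᵘ.* ℚᵘ.mkℚᵘ (pos B) 0 ℚᵘ.≤ ℚᵘ.mkℚᵘ (pos N) 0
  unnormalised = ℚᵘ.≤-respˡ-≃ (ℚᵘ.≃-trans (ℚ.toℚᵘ-homo-* (ℕ→ℚ m ℚ.+ ε) (ℕ→ℚ B))
      (ℚᵘ.*-cong (ℚᵘ.≃-trans (ℚ.toℚᵘ-homo-+ (ℕ→ℚ m) ε) (ℚᵘ.+-cong (toℚᵘ-ℕ→ℚ m) ℚᵘ.≃-refl)) (toℚᵘ-ℕ→ℚ B)))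
    (ℚᵘ.≤-respʳ-≃ (toℚᵘ-ℕ→ℚ N) (ℚ.toℚᵘ-mono-≤ h))
  lhs : (pos m ℤ.* pos (suc d) ℤ.+ pos (suc p) ℤ.* pos 1) ℤ.* pos B ℤ.* pos 1 ≡ pos ((m * suc d + suc p * 1) * B * 1)
  lhs rewrite sym (ℤ.pos-* m (suc d)) | sym (ℤ.pos-* (suc p) 1) | sym (ℤ.pos-* (m * suc d + suc p * 1) B)
    | sym (ℤ.pos-* ((m * suc d + suc p * 1) * B) 1) = refl
  rhs : pos N ℤ.* pos (suc ((d + 0 * suc d) * 1)) ≡ pos (N * suc ((d + 0 * suc d) * 1))
  rhs = sym (ℤ.pos-* N (suc ((d + 0 * suc d) * 1)))

reciprocal : ℕ → ℚ
reciprocal d = mkℚ (pos 1) d (1-coprimeTo (suc d))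

0<reciprocal : ∀ d → 0ℚ ℚ.< reciprocal d
0<reciprocal d = ℚ.*<* (ℤ.+<+ (s≤s z≤n))

copies-conclusion : ∀ d x b k → x * (b * b) ≤ (suc d * k) * (suc d * k) →
  (reciprocal d ℚ.* reciprocal d) ℚ.* (ℕ→ℚ x ℚ.* (ℕ→ℚ b ℚ.* ℕ→ℚ b)) ℚ.≤ ℕ→ℚ k ℚ.* ℕ→ℚ k
copies-conclusion d x b k h = ℚ.toℚᵘ-cancel-≤
  (ℚᵘ.≤-respˡ-≃ (ℚᵘ.≃-sym left) (ℚᵘ.≤-respʳ-≃ (ℚᵘ.≃-sym right) unnormalised))
  where
  open ≤-Reasoning
  δ = reciprocal d
  X = ℚᵘ.mkℚᵘ (pos x) 0
  B = ℚᵘ.mkℚᵘ (pos b) 0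
  K = ℚᵘ.mkℚᵘ (pos k) 0
  left : toℚᵘ ((δ ℚ.* δ) ℚ.* (ℕ→ℚ x ℚ.* (ℕ→ℚ b ℚ.* ℕ→ℚ b))) ℚᵘ.≃ (toℚᵘ δ ℚᵘ.* toℚᵘ δ) ℚᵘ.* (X ℚᵘ.* (B ℚᵘ.* B))
  left = ℚᵘ.≃-trans (ℚ.toℚᵘ-homo-* (δ ℚ.* δ) _) (ℚᵘ.*-cong (ℚ.toℚᵘ-homo-* δ δ)
    (ℚᵘ.≃-trans (ℚ.toℚᵘ-homo-* (ℕ→ℚ x) _) (ℚᵘ.*-cong (toℚᵘ-ℕ→ℚ x)
      (ℚᵘ.≃-trans (ℚ.toℚᵘ-homo-* (ℕ→ℚ b) (ℕ→ℚ b)) (ℚᵘ.*-cong (toℚᵘ-ℕ→ℚ b) (toℚᵘ-ℕ→ℚ b))))))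
  right : toℚᵘ (ℕ→ℚ k ℚ.* ℕ→ℚ k) ℚᵘ.≃ K ℚᵘ.* K
  right = ℚᵘ.≃-trans (ℚ.toℚᵘ-homo-* (ℕ→ℚ k) (ℕ→ℚ k)) (ℚᵘ.*-cong (toℚᵘ-ℕ→ℚ k) (toℚᵘ-ℕ→ℚ k))
  lhs : pos 1 ℤ.* pos 1 ℤ.* (pos x ℤ.* (pos b ℤ.* pos b)) ℤ.* pos 1 ≡ pos (1 * (x * (b * b)) * 1)
  lhs rewrite sym (ℤ.pos-* b b) | sym (ℤ.pos-* x (b * b)) | sym (ℤ.pos-* 1 (x * (b * b))) | sym (ℤ.pos-* (1 * (x * (b * b))) 1) = refl
  rhs : pos k ℤ.* pos k ℤ.* pos (suc d * suc d * 1) ≡ pos (k * k * (suc d * suc d * 1))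
  rhs rewrite sym (ℤ.pos-* k k) | sym (ℤ.pos-* (k * k) (suc d * suc d * 1)) = refl
  unit : ∀ x → 1 * x * 1 ≡ x
  unit = solve-∀
  square : ∀ d k → (d * k) * (d * k) ≡ k * k * (d * d * 1)
  square = solve-∀
  unnormalised : (toℚᵘ δ ℚᵘ.* toℚᵘ δ) ℚᵘ.* (X ℚᵘ.* (B ℚᵘ.* B)) ℚᵘ.≤ K ℚᵘ.* K
  unnormalised = ℚᵘ.*≤* (subst₂ ℤ._≤_ (sym lhs) (sym rhs) (ℤ.+≤+ (begin
    1 * (x * (b * b)) * 1              ≡⟨ unit (x * (b * b)) ⟩
    x * (b * b)                        ≤⟨ h ⟩
    (suc d * k) * (suc d * k)          ≡⟨ square (suc d) k ⟩
    k * k * (suc d * suc d * 1)        ∎)))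

dichotomy⇒supersat : ∀ m → 1 ≤ m → (Copy : ∀ {n N} → (Fin N → Subset n) → Subset N → Set) →
  (∀ {n N} (F : Fin N → Subset n) χ index → Local.LocalDichotomy F χ index m (Copy F)) → Supersat m Copy
dichotomy⇒supersat m 1≤m Copy dichotomy (mkℚ (pos zero) d c) 0<ε with ℚ.positive 0<ε
... | ()
dichotomy⇒supersat m 1≤m Copy dichotomy (mkℚ (-[1+ p ]) d c) 0<ε with ℚ.positive 0<ε
... | ()
dichotomy⇒supersat m 1≤m Copy dichotomy (mkℚ (pos (suc p)) d c) 0<ε = reciprocal D , 0<reciprocal D , supersaturated
  where
  D = supersatConstant (suc d) m
  supersaturated : ∀ n N (F : Fin N → Subset n) → Injective _≡_ _≡_ F →
    (ℕ→ℚ m ℚ.+ mkℚ (pos (suc p)) d c) ℚ.* ℕ→ℚ (centralBinom n) ℚ.≤ ℕ→ℚ N → ManyCopies (reciprocal D) n m (Copy F)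
  -- For n = 0 the required number is 0 because the exponent 2 m - 1 is positive.
  supersaturated zero N F F-inj many = 0 , ([] , refl , [] , []) , copies-conclusion D (0 ^ (2 * m ∸ 1)) 1 0
    (subst (λ x → x * 1 ≤ suc D * 0 * (suc D * 0)) (sym (0^ (2 * m ∸ 1) (∸-monoˡ-≤ 1 (*-monoʳ-≤ 2 1≤m)))) z≤n)
    where
    0^ : ∀ k → 1 ≤ k → 0 ^ k ≡ 0
    0^ (suc k) _ = refl
  supersaturated n@(suc _) N F F-inj many = K , copies copy local ,
    copies-conclusion D (n ^ (2 * m ∸ 1)) (centralBinom n) K
      (≤-trans (many-copies copy local (density-hypothesis m p d c (centralBinom n) N many))
               -- `reciprocal D` is 1 / (D + 1), hence the passage from D to D + 1.
               (*-mono-≤ (*-monoˡ-≤ K (n≤1+n D)) (*-monoˡ-≤ K (n≤1+n D))))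
    where
    copy = Copy F
    open Count F F-inj (suc d) m (s≤s z≤n) 1≤m
    local = dichotomy F χ χ⇒index
    K = #good copy local

-- A fraction below 1 with denominator d + 1 has numerator at most d, so c ≤ d / (d + 1).
proportion-bound : ∀ c s b → c ℚ.< 1ℚ → ℕ→ℚ s ℚ.≤ c ℚ.* ℕ→ℚ b →
  suc (ℚ.denominator-1 c) * s ≤ ℚ.denominator-1 c * b
proportion-bound (mkℚ num d coprime) s b (ℚ.*<* c<1) h = ℤ.drop‿+≤+ (begin
  pos (suc d * s)                 ≡⟨ trans (cong pos (tidy d s)) (ℤ.pos-* s (suc (d * 1))) ⟩
  pos s ℤ.* pos (suc (d * 1))     ≤⟨ ℚᵘ.drop-*≤* unnormalised ⟩
  num ℤ.* pos b ℤ.* pos 1         ≡⟨ ℤ.*-identityʳ (num ℤ.* pos b) ⟩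
  num ℤ.* pos b                   ≤⟨ ℤ.*-monoʳ-≤-nonNeg (pos b) num≤d ⟩
  pos d ℤ.* pos b                 ≡⟨ sym (ℤ.pos-* d b) ⟩
  pos (d * b)                     ∎)
  where
  open ℤ.≤-Reasoning
  c = mkℚ num d coprime
  tidy : ∀ d s → suc d * s ≡ s * suc (d * 1)
  tidy = solve-∀
  num≤d : num ℤ.≤ pos d
  num≤d = ℤ.i<j⇒i≤pred[j] (subst₂ ℤ._<_ (ℤ.*-identityʳ num) (ℤ.*-identityˡ (pos (suc d))) c<1)
  unnormalised : ℚᵘ.mkℚᵘ (pos s) 0 ℚᵘ.≤ ℚᵘ.mkℚᵘ num d ℚᵘ.* ℚᵘ.mkℚᵘ (pos b) 0
  unnormalised = ℚᵘ.≤-respˡ-≃ (toℚᵘ-ℕ→ℚ s)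
    (ℚᵘ.≤-respʳ-≃ (ℚᵘ.≃-trans (ℚ.toℚᵘ-homo-* c (ℕ→ℚ b)) (ℚᵘ.*-cong (ℚᵘ.≃-refl {ℚᵘ.mkℚᵘ num d}) (toℚᵘ-ℕ→ℚ b))) (ℚ.toℚᵘ-mono-≤ h))

-- Parameters of the three statements

nC⌈n/2⌉≡central : ∀ n → n C ⌈ n /2⌉ ≡ centralBinom n
nC⌈n/2⌉≡central n = trans (nCk≡nC[n∸k] (⌈n/2⌉≤n n))
  (cong (n C_) (trans (cong (_∸ ⌈ n /2⌉) (sym (⌊n/2⌋+⌈n/2⌉≡n n))) (m+n∸n≡m ⌊ n /2⌋ ⌈ n /2⌉)))

-- With t = 2 (d + 1), the t levels ending at the central one all exceed (1 - 1 / t) central m as soon as (t - 1) t² ≤ ⌊ m / 2 ⌋,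
-- and (1 - 1 / t)² ≥ d / (d + 1).
wideThreshold : ℕ → ℕ
wideThreshold d = let t = suc (suc (d + d)) in suc (d + d) * t * t

-- The factor 1 - 1 / t is lost twice: from the central level down to level a, and from level a to
-- the width that `cappedSum-base` tolerates.
cappedSum-wide : ∀ d m w → wideThreshold d ≤ ⌊ m /2⌋ → suc d * w ≤ d * centralBinom m →
  ∀ {k} → m ≤ k → cappedSum w k ≤ m * k !
cappedSum-wide d m w wide dw≤ = cappedSum-bound a 1≤a 2+a≤m w≤mCa (≤-trans w≤mCa (C-mono-below (n≤1+n a) 2[1+a]≤m))
  (cappedSum-base w m t′ a a+t′≡h tw≤)
  where
  open ≤-Reasoning
  t′ = suc (d + d)
  t = suc t′
  h = ⌊ m /2⌋
  a = h ∸ t′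
  B = centralBinom m
  t≤h : t ≤ h
  t≤h = ≤-trans (m≤n*m t (t′ * t)) wide
  a+t′≡h : a + t′ ≡ h
  a+t′≡h = m∸n+n≡m (≤-trans (n≤1+n t′) t≤h)
  1≤a : 1 ≤ a
  1≤a = m<n⇒0<n∸m t≤h
  1+a≤h : suc a ≤ h
  1+a≤h = ≤-trans (≤-trans (≤-reflexive (+-comm 1 a)) (+-monoʳ-≤ a (s≤s z≤n))) (≤-reflexive a+t′≡h)
  2[1+a]≤m : suc a + suc a ≤ m
  2[1+a]≤m = ≤-trans (+-mono-≤ 1+a≤h 1+a≤h) (⌊n/2⌋+⌊n/2⌋≤n m)
  2+a≤m : suc (suc a) ≤ m
  2+a≤m = ≤-trans (s≤s (m≤n+m (suc a) a)) 2[1+a]≤m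
  1≤h : 1 ≤ h
  1≤h = ≤-trans (s≤s z≤n) t≤h
  rearrange₁ : ∀ h t x → h * x + t * (h * x) ≡ suc t * (h * x)
  rearrange₁ = solve-∀
  rearrange₂ : ∀ t h y s b → t * (h * y + s * b) ≡ h * (t * y) + t * s * b
  rearrange₂ = solve-∀
  swap : ∀ h t x → t * (h * x) ≡ h * (t * x)
  swap = solve-∀
  t′B≤tC : t′ * B ≤ t * (m C a)
  t′B≤tC = *-cancelˡ-≤ h {{>-nonZero 1≤h}} (+-cancelˡ-≤ (h * B) _ _ (begin
    h * B + h * (t′ * B)                        ≡⟨ cong (h * B +_) (sym (swap h t′ B)) ⟩
    h * B + t′ * (h * B)                        ≡⟨ rearrange₁ h t′ B ⟩
    t * (h * B)                                 ≤⟨ *-monoʳ-≤ t (near-central m t′ a a+t′≡h) ⟩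
    t * (h * (m C a) + t′ * t * B)              ≡⟨ rearrange₂ t h (m C a) (t′ * t) B ⟩
    h * (t * (m C a)) + t * (t′ * t) * B        ≤⟨ +-monoʳ-≤ (h * (t * (m C a))) (*-monoˡ-≤ B (≤-trans (≤-reflexive (*-comm t (t′ * t))) wide)) ⟩
    h * (t * (m C a)) + h * B                   ≡⟨ +-comm _ (h * B) ⟩
    h * B + h * (t * (m C a))                   ∎))
  expand₁ : ∀ d w → suc (suc (d + d)) * (suc (suc (d + d)) * w) ≡ 4 * suc d * (suc d * w)
  expand₁ = solve-∀
  -- The identity (2 d + 1)² = 4 d (d + 1) + 1 is what makes the two losses affordable.
  expand₂ : ∀ d b → 4 * suc d * (d * b) + b ≡ suc (d + d) * (suc (d + d) * b)
  expand₂ = solve-∀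
  exchange : ∀ t t′ x → t′ * (t * x) ≡ t * (t′ * x)
  exchange = solve-∀
  tw≤ : t * w ≤ t′ * (m C a)
  tw≤ = *-cancelˡ-≤ t (begin
    t * (t * w)                 ≡⟨ expand₁ d w ⟩
    4 * suc d * (suc d * w)     ≤⟨ *-monoʳ-≤ (4 * suc d) dw≤ ⟩
    4 * suc d * (d * B)         ≤⟨ m≤m+n _ B ⟩
    4 * suc d * (d * B) + B     ≡⟨ expand₂ d B ⟩
    t′ * (t′ * B)               ≤⟨ *-monoʳ-≤ t′ t′B≤tC ⟩
    t′ * (t * (m C a))          ≡⟨ exchange t t′ (m C a) ⟩
    t * (t′ * (m C a))          ∎)
  w≤mCa : w ≤ m C a
  w≤mCa = *-cancelˡ-≤ t (≤-trans tw≤ (*-monoˡ-≤ (m C a) (n≤1+n t′)))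

copies-supersat : ∀ s → 2 ≤ s → s + (mₛ s C ⌈ mₛ s /2⌉) + 1 ≤ 2 ^ mₛ s → Supersat (mₛ s) (IsCopy s)
copies-supersat s 2≤s room with mₛ s
... | zero  = contradiction (≤-trans (+-monoˡ-≤ 1 (≤-trans (≤-trans (s≤s z≤n) 2≤s) (m≤m+n s _))) room) λ { (s≤s ()) }
... | suc m = dichotomy⇒supersat (suc m) (s≤s z≤n) (IsCopy s) λ F χ index →
  Local.copy-dichotomy F χ index (suc m) s (≤-trans (s≤s z≤n) 2≤s)
    (subst (λ x → s + x + 1 ≤ 2 ^ suc m) (nC⌈n/2⌉≡central (suc m)) room)

induced-D₄-supersat : Supersat 4 (IsInducedCopy 4)
induced-D₄-supersat = dichotomy⇒supersat 4 (s≤s z≤n) (IsInducedCopy 4) λ F χ index →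
  Local.inducedCopy-dichotomy F χ index 4 4 (s≤s (s≤s z≤n))
    -- For width 3 and m = 4 the levels contribute 1 + 3/4 + 1/2 + 3/4 + 1 = 4, so the base case
    -- holds with equality.
    (cappedSum-bound 1 ≤-refl (≤ᵇ⇒≤ 3 4 _) (≤ᵇ⇒≤ 3 4 _) (≤ᵇ⇒≤ 3 6 _) (≤ᵇ⇒≤ 96 96 _))

induced-supersat : ∀ (c : ℚ) → c ℚ.< 1ℚ → Σ ℕ λ sc → ∀ s → 2 ≤ s → sc ≤ s → ∀ m → IsMStar s m →
  ℕ→ℚ s ℚ.≤ c ℚ.* ℕ→ℚ (m C ⌊ m /2⌋) → Supersat m (IsInducedCopy s)
-- As s ≤ m C ⌈ m /2⌉ ≤ 2^m, this threshold forces m ≥ 2 H and hence ⌊ m /2⌋ ≥ H.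
induced-supersat c c<1 = 2 ^ (H + H) , λ s 2≤s sc≤s m (s≤mC , _) s≤cB →
  let wide = H≤h s sc≤s m s≤mC in
  dichotomy⇒supersat m (≤-trans (≤-trans (s≤s z≤n) wide) (⌊n/2⌋≤n m)) (IsInducedCopy s) λ F χ index →
  Local.inducedCopy-dichotomy F χ index m s 2≤s
    (cappedSum-wide d m (s ∸ 1) wide
      (≤-trans (*-monoʳ-≤ (suc d) (m∸n≤m s 1)) (proportion-bound c s (centralBinom m) c<1 s≤cB)))
  where
  d = ℚ.denominator-1 c
  H = wideThreshold d
  H≤h : ∀ s → 2 ^ (H + H) ≤ s → ∀ m → s ≤ m C ⌈ m /2⌉ → H ≤ ⌊ m /2⌋
  H≤h s sc≤s m s≤mC = ≤-trans (≤-reflexive (n≡⌊n+n/2⌋ H)) (⌊n/2⌋-mono (≮⇒≥ λ m<2H →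
    <⇒≱ (^-monoʳ-< 2 (s≤s (s≤s z≤n)) m<2H) (≤-trans sc≤s (≤-trans s≤mC (nCk≤2^n m ⌈ m /2⌉)))))

theorem1p8 :
  -- (i)
  (∀ (s : ℕ) → 2 ≤ s →
      2 ^ (mₛ s ∸ 1) ∸ 1 ≤ s →
      s + (mₛ s C ⌈ mₛ s /2⌉) + 1 ≤ 2 ^ mₛ s →
      Supersat (mₛ s) (IsCopy s))
  ×
  -- (ii)
  Supersat 4 (IsInducedCopy 4)
  ×
  -- (iii)
  (∀ (c : ℚ) → ½ ℚ.< c → c ℚ.< 1ℚ →
      Σ ℕ λ sc → ∀ (s : ℕ) → 2 ≤ s → sc ≤ s → ∀ (m : ℕ) → IsMStar s m →
        ℕ→ℚ s ℚ.≤ c ℚ.* ℕ→ℚ (m C ⌊ m /2⌋) →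
        Supersat m (IsInducedCopy s))
theorem1p8 =
  (λ s 2≤s _ room → copies-supersat s 2≤s room) ,
  induced-D₄-supersat ,
  (λ c _ c<1 → induced-supersat c c<1)
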